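{- There is a universal constant $C>0$ such that the following holds. Let $h\ge 1$ be an integer, let $G$ be a graph that excludes $K_h$ as a minor, and let $\hat G$ be a connected finite graph that is a region intersection graph over $G$. Then $$\bar{\mathfrak{s}}_1(\hat G)\le C h^2\; \bar{\mathfrak{s}}_{\mathrm{obs}}(\hat G).$$
   Context: All graphs are finite, undirected and simple; $V_G,E_G$ denote the vertex and edge sets of $G$. $\hat G$ is a region intersection graph (rig) over $G$ if there are nonempty subsets $\{R_u\subseteq V_G:u\in V_{\hat G}\}$, each inducing a connected subgraph of $G$, such that for distinct $u,v$: $\{u,v\}\in E_{\hat G}\iff R_u\cap R_v\ne\emptyset$. For a connected graph $G$ and $\omega:V_G\to[0,\infty)$, $\mathrm{dist}_\omega$ is the shortest-path pseudo-metric on $V_G$ obtained by giving each edge $\{u,v\}\in E_G$ length $\frac{\omega(u)+\omega(v)}{2}$. Put $\|\omega\|_{L^1(V_G)}=\frac1{|V_G|}\sum_{v\in V_G}\omega(v)$. The $L^1$-extremal spread of $G$ is $$\bar{\mathfrak{s}}_1(G)=\max_{\omega:V_G\to[0,\infty)}\Big\{\tfrac1{|V_G|^2}\sum_{u,v\in V_G}\mathrm{dist}_\omega(u,v):\|\omega\|_{L^1(V_G)}\le1\Big\}.$$ For a finite (pseudo-)metric space $(X,d)$, the observable spread is $$\mathfrak{s}_{\mathrm{obs}}(X,d)=\sup_{f:X\to\mathbb{R}}\Big\{\tfrac1{|X|^2}\sum_{x,y\in X}|f(x)-f(y)| : f\text{ is }1\text{ -Lipschitz}\Big\},$$ and the $L^1$-extremal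 observable spread of $G$ is $$\bar{\mathfrak{s}}_{\mathrm{obs}}(G)=\sup_{\omega:V_G\to[0,\infty)}\big\{\mathfrak{s}_{\mathrm{obs}}(V_G,\mathrm{dist}_\omega):\|\omega\|_{L^1(V_G)}\le 1\big\}.$$ Sums over $x,y$ or $u,v$ are over ordered pairs. -}

module Defs where

open import Level using (0ℓ)
open import Data.Nat.Base as ℕ using (ℕ; zero; suc; NonZero)
import Data.Nat.Properties as ℕ
open import Data.Integer.Base using (+_)
open import Data.Rational.Base as ℚ using (ℚ; 0ℚ; 1ℚ; ½)
import Data.Rational.Properties as ℚ
open import Data.Rational.Solver using (module +-*-Solver)
open import Data.Fin.Base using (Fin)
open import Data.Fin.Properties using (_≟_)
open import Data.Fin.Subset using (Subset; _∈_; _∩_; Nonempty; Empty)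
open import Data.List.Base using (List; []; [_]; _++_; map; concatMap; allFin; foldr)
import Data.Vec.Functional as Vector
open import Data.Product.Base using (Σ; ∃; ∃-syntax; _×_; _,_)
open import Data.Sum.Base using (inj₁; inj₂)
open import Function.Bundles using (_⇔_)
open import Relation.Binary.Core using (Rel)
open import Relation.Binary.Definitions using (Decidable; Symmetric; Irreflexive)
open import Relation.Binary.Construct.Closure.ReflexiveTransitive using (Star; ε; _◅_)
open import Relation.Binary.PropositionalEquality
  using (_≡_; _≢_; refl; sym; trans; cong; subst; subst₂; ≢-sym)
open import Relation.Nullary.Decidable using (Dec; yes; no; ¬?)

-- Real numbers: Cauchy sequences of rationals.  Equality of reals is
-- x ≤ y and y ≤ x, not _≡_.

record ℝ : Set where
  constructor mkℝ
  field
    seq    : ℕ → ℚ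
    cauchy : ∀ η → 0ℚ ℚ.< η →
             ∃[ N ] (∀ m n → N ℕ.≤ m → N ℕ.≤ n → ℚ.∣ seq m ℚ.- seq n ∣ ℚ.≤ η)

open ℝ public

infix 4 _<_ _≤_

_<_ : ℝ → ℝ → Set
x < y = ∃[ η ] (0ℚ ℚ.< η × ∃[ N ] (∀ n → N ℕ.≤ n → seq x n ℚ.+ η ℚ.≤ seq y n))

_≤_ : ℝ → ℝ → Set
x ≤ y = ∀ η → 0ℚ ℚ.< η → ∃[ N ] (∀ n → N ℕ.≤ n → seq x n ℚ.≤ seq y n ℚ.+ η)

private

  UniformlyContinuous : (ℚ → ℚ → ℚ) → Set
  UniformlyContinuous F = ∀ η → 0ℚ ℚ.< η → ∃[ δ ] (0ℚ ℚ.< δ ×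
    (∀ a b c d → ℚ.∣ a ℚ.- c ∣ ℚ.≤ δ → ℚ.∣ b ℚ.- d ∣ ℚ.≤ δ →
      ℚ.∣ F a b ℚ.- F c d ∣ ℚ.≤ η))

  lift₂ : (F : ℚ → ℚ → ℚ) → UniformlyContinuous F → ℝ → ℝ → ℝ
  lift₂ F uc x y = mkℝ (λ n → F (seq x n) (seq y n)) λ η η>0 →
    let δ , δ>0 , close = uc η η>0
        M , p = cauchy x δ δ>0
        N , q = cauchy y δ δ>0
    in M ℕ.⊔ N , λ m n m≥ n≥ → close _ _ _ _
         (p m n (ℕ.m⊔n≤o⇒m≤o M N m≥) (ℕ.m⊔n≤o⇒m≤o M N n≥))
         (q m n (ℕ.m⊔n≤o⇒n≤o M N m≥) (ℕ.m⊔n≤o⇒n≤o M N n≥))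

  open +-*-Solver

  half>0 : ∀ {η} → 0ℚ ℚ.< η → 0ℚ ℚ.< ½ ℚ.* η
  half>0 {η} η>0 = subst (ℚ._< ½ ℚ.* η) (ℚ.*-zeroʳ ½) (ℚ.*-monoʳ-<-pos ½ η>0)

  half+half : ∀ η → ½ ℚ.* η ℚ.+ ½ ℚ.* η ≡ η
  half+half η = trans (sym (ℚ.*-distribʳ-+ η ½ ½)) (ℚ.*-identityˡ η)

  p≤∣p∣ : ∀ p → p ℚ.≤ ℚ.∣ p ∣
  p≤∣p∣ p with ℚ.≤-total 0ℚ p
  ... | inj₁ 0≤p = ℚ.≤-reflexive (sym (ℚ.0≤p⇒∣p∣≡p 0≤p))
  ... | inj₂ p≤0 = ℚ.≤-trans p≤0 (ℚ.0≤∣p∣ p)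

  flip-dist : ∀ p q → ℚ.∣ p ℚ.- q ∣ ≡ ℚ.∣ q ℚ.- p ∣
  flip-dist p q = trans (cong ℚ.∣_∣ (solve 2 (λ p q → p :- q := :- (q :- p)) refl p q))
                        (ℚ.∣-p∣≡∣p∣ (q ℚ.- p))

  dist⇒≤ : ∀ {p q δ} → ℚ.∣ p ℚ.- q ∣ ℚ.≤ δ → p ℚ.≤ q ℚ.+ δ
  dist⇒≤ {p} {q} {δ} h =
    subst (ℚ._≤ q ℚ.+ δ) (solve 2 (λ p q → q :+ (p :- q) := p) refl p q)
      (ℚ.+-monoʳ-≤ q (ℚ.≤-trans (p≤∣p∣ (p ℚ.- q)) h))

  ≤⇒diff : ∀ {p q δ} → p ℚ.≤ q ℚ.+ δ → p ℚ.- q ℚ.≤ δ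
  ≤⇒diff {p} {q} {δ} h =
    subst (p ℚ.- q ℚ.≤_) (solve 2 (λ q δ → q :+ δ :- q := δ) refl q δ)
      (ℚ.+-monoˡ-≤ (ℚ.- q) h)

  ≤⇒dist : ∀ {p q δ} → p ℚ.≤ q ℚ.+ δ → q ℚ.≤ p ℚ.+ δ → ℚ.∣ p ℚ.- q ∣ ℚ.≤ δ
  ≤⇒dist {p} {q} {δ} h k with ℚ.∣p∣≡p∨∣p∣≡-p (p ℚ.- q)
  ... | inj₁ e = subst (ℚ._≤ δ) (sym e) (≤⇒diff h)
  ... | inj₂ e = subst (ℚ._≤ δ)
    (trans (solve 2 (λ p q → q :- p := :- (p :- q)) refl p q) (sym e)) (≤⇒diff k)

  +-uc : UniformlyContinuous ℚ._+_
  +-uc η η>0 = ½ ℚ.* η , half>0 η>0 , λ a b c d p q →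
    subst₂ ℚ._≤_
      (cong ℚ.∣_∣ (solve 4 (λ a b c d → a :- c :+ (b :- d) := a :+ b :- (c :+ d)) refl a b c d))
      (half+half η)
      (ℚ.≤-trans (ℚ.∣p+q∣≤∣p∣+∣q∣ (a ℚ.- c) (b ℚ.- d)) (ℚ.+-mono-≤ p q))

  ⊓-uc : UniformlyContinuous ℚ._⊓_
  ⊓-uc η η>0 = η , η>0 , λ a b c d p q → ≤⇒dist
    (below a b c d (dist⇒≤ p) (dist⇒≤ q))
    (below c d a b (dist⇒≤ (subst (ℚ._≤ η) (flip-dist a c) p))
                   (dist⇒≤ (subst (ℚ._≤ η) (flip-dist b d) q)))
    where
    below : ∀ a b c d → a ℚ.≤ c ℚ.+ η → b ℚ.≤ d ℚ.+ η → a ℚ.⊓ b ℚ.≤ c ℚ.⊓ d ℚ.+ η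
    below a b c d p q =
      subst (a ℚ.⊓ b ℚ.≤_) (sym (ℚ.mono-≤-distrib-⊓ (ℚ.+-monoˡ-≤ η) c d)) (ℚ.⊓-mono-≤ p q)

  neg-uc : UniformlyContinuous (λ a _ → ℚ.- a)
  neg-uc η η>0 = η , η>0 , λ a _ c _ p _ → subst (ℚ._≤ η)
    (trans (flip-dist a c)
      (cong ℚ.∣_∣ (solve 2 (λ a c → c :- a := :- a :- (:- c)) refl a c))) p

  abs-uc : UniformlyContinuous (λ a _ → ℚ.∣ a ∣)
  abs-uc η η>0 = η , η>0 , λ a _ c _ p _ → ≤⇒dist
    (below a c p) (below c a (subst (ℚ._≤ η) (flip-dist a c) p))
    where
    below : ∀ a c → ℚ.∣ a ℚ.- c ∣ ℚ.≤ η → ℚ.∣ a ∣ ℚ.≤ ℚ.∣ c ∣ ℚ.+ η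
    below a c p = ℚ.≤-trans
      (subst (λ z → ℚ.∣ z ∣ ℚ.≤ ℚ.∣ c ∣ ℚ.+ ℚ.∣ a ℚ.- c ∣)
        (solve 2 (λ a c → c :+ (a :- c) := a) refl a c) (ℚ.∣p+q∣≤∣p∣+∣q∣ c (a ℚ.- c)))
      (ℚ.+-monoʳ-≤ ℚ.∣ c ∣ p)

  scale-uc : ∀ r → UniformlyContinuous (λ a _ → r ℚ.* a)
  scale-uc r η η>0 = δ , δ>0 , λ a _ c _ p _ → begin
      ℚ.∣ r ℚ.* a ℚ.- r ℚ.* c ∣
        ≡⟨ cong ℚ.∣_∣ (solve 3 (λ r a c → r :* a :- r :* c := r :* (a :- c)) refl r a c) ⟩
      ℚ.∣ r ℚ.* (a ℚ.- c) ∣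
        ≡⟨ ℚ.∣p*q∣≡∣p∣*∣q∣ r (a ℚ.- c) ⟩
      ℚ.∣ r ∣ ℚ.* ℚ.∣ a ℚ.- c ∣
        ≤⟨ ℚ.*-monoˡ-≤-nonNeg ℚ.∣ r ∣ {{ℚ.∣-∣-nonNeg r}} p ⟩
      ℚ.∣ r ∣ ℚ.* δ
        ≤⟨ ℚ.*-monoʳ-≤-nonNeg δ {{ℚ.nonNegative (ℚ.<⇒≤ δ>0)}} (ℚ.<⇒≤ r<K) ⟩
      K ℚ.* δ
        ≡⟨ ℚ.*-assoc K (ℚ.1/ K) η ⟨
      K ℚ.* ℚ.1/ K ℚ.* η
        ≡⟨ cong (ℚ._* η) (ℚ.*-inverseʳ K) ⟩
      1ℚ ℚ.* η
        ≡⟨ ℚ.*-identityˡ η ⟩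
      η ∎
    where
    open ℚ.≤-Reasoning
    K = ℚ.∣ r ∣ ℚ.+ 1ℚ
    r<K : ℚ.∣ r ∣ ℚ.< K
    r<K = subst (ℚ._< K) (ℚ.+-identityʳ ℚ.∣ r ∣) (ℚ.+-monoʳ-< ℚ.∣ r ∣ (ℚ.positive⁻¹ 1ℚ))
    instance
      K-pos : ℚ.Positive K
      K-pos = ℚ.positive (ℚ.≤-<-trans (ℚ.0≤∣p∣ r) r<K)
      K-nonZero : ℚ.NonZero K
      K-nonZero = ℚ.pos⇒nonZero K
    δ = ℚ.1/ K ℚ.* η
    δ>0 : 0ℚ ℚ.< δ
    δ>0 = subst (ℚ._< δ) (ℚ.*-zeroʳ (ℚ.1/ K))
      (ℚ.*-monoʳ-<-pos (ℚ.1/ K) {{ℚ.1/pos⇒pos K}} η>0)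

infixl 6 _+_ _-_
infixl 7 _⊓_ _·_

fromℚ : ℚ → ℝ
fromℚ q = mkℝ (λ _ → q) λ η η>0 → 0 , λ _ _ _ _ →
  subst (ℚ._≤ η) (cong ℚ.∣_∣ (sym (ℚ.+-inverseʳ q))) (ℚ.<⇒≤ η>0)

0ℝ 1ℝ : ℝ
0ℝ = fromℚ 0ℚ
1ℝ = fromℚ 1ℚ

_+_ _⊓_ _-_ : ℝ → ℝ → ℝ
_+_ = lift₂ ℚ._+_ +-uc
_⊓_ = lift₂ ℚ._⊓_ ⊓-uc
x - y = x + lift₂ (λ a _ → ℚ.- a) neg-uc y y

∣_∣ : ℝ → ℝ
∣ x ∣ = lift₂ (λ a _ → ℚ.∣ a ∣) abs-uc x x

_·_ : ℚ → ℝ → ℝ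
r · x = lift₂ (λ a _ → r ℚ.* a) (scale-uc r) x x

∑ : ∀ {n} → (Fin n → ℝ) → ℝ
∑ = Vector.foldr _+_ 0ℝ

-- Suprema.  A supremum of reals is represented by the set of rationals
-- strictly below it, so that suprema are unions and exist without any
-- appeal to classical logic; ≤ between suprema is then inclusion.

LowerReal : Set₁
LowerReal = ℚ → Set

lower : ℝ → LowerReal
lower x q = fromℚ q < x

sup : {I : Set} → (I → LowerReal) → LowerReal
sup x q = ∃[ i ] x i q

infix 4 _≤ₗ_
infixr 7 _⊛_

_≤ₗ_ : LowerReal → LowerReal → Set
a ≤ₗ b = ∀ q → a q → b q

-- Multiplication by a real; this is the usual product only for c > 0.
_⊛_ : ℝ → LowerReal → LowerReal
(c ⊛ a) q = ∃[ r ] (a r × fromℚ q < r · c)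

-- Decidability of adjacency is part of what it means constructively for
-- the graph to be a finite object; classically it is automatic.
record Graph : Set₁ where
  field
    order : ℕ
    Edge  : Rel (Fin order) 0ℓ
    edge? : Decidable Edge
    symm  : Symmetric Edge
    irr   : Irreflexive _≡_ Edge

  V : Set
  V = Fin order

  Walk : Rel V 0ℓ
  Walk = Star Edge

open Graph public using (order; V; Edge; Walk)

record Connected (G : Graph) : Set where
  field
    nonempty : NonZero (order G)
    walk     : ∀ u v → Walk G u v

-- The subgraph of G induced on S is connected; S may be empty here.
ConnectedOn : (G : Graph) → Subset (order G) → Set
ConnectedOn G S = ∀ {x y} → x ∈ S → y ∈ S →
  Star (λ a b → Edge G a b × a ∈ S × b ∈ S) x y

complete : ℕ → Graph
complete h = record
  { order = h
  ; Edge  = _≢_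
  ; edge? = λ u v → ¬? (u ≟ v)
  ; symm  = ≢-sym
  ; irr   = λ u≡v u≢v → u≢v u≡v
  }

-- Minors given by disjoint connected branch sets.
record Minor (H G : Graph) : Set where
  field
    branch    : V H → Subset (order G)
    nonempty  : ∀ u → Nonempty (branch u)
    connected : ∀ u → ConnectedOn G (branch u)
    disjoint  : ∀ {u v} → u ≢ v → Empty (branch u ∩ branch v)
    adjacent  : ∀ {u v} → Edge H u v →
                ∃[ x ] ∃[ y ] (x ∈ branch u × y ∈ branch v × Edge G x y)

record RIG (Ĝ G : Graph) : Set where
  field
    region    : V Ĝ → Subset (order G)
    nonempty  : ∀ u → Nonempty (region u)
    connected : ∀ u → ConnectedOn G (region u)
    intersect : ∀ {u v} → u ≢ v → Edge Ĝ u v ⇔ Nonempty (region u ∩ region v)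

module _ (G : Graph) where
  open Graph G using (edge?)

  walks : ℕ → (u v : V G) → List (Walk G u v)
  walks k u v = stay (u ≟ v) ++ go k
    where
    stay : Dec (u ≡ v) → List (Walk G u v)
    stay (yes refl) = [ ε ]
    stay (no _)     = []
    step : ℕ → (w : V G) → Dec (Edge G u w) → List (Walk G u v)
    step k w (yes e) = map (e ◅_) (walks k w v)
    step k w (no _)  = []
    go : ℕ → List (Walk G u v)
    go zero    = []
    go (suc k) = concatMap (λ w → step k w (edge? u w)) (allFin (order G))

length : (G : Graph) → (V G → ℝ) → ∀ {u v} → Walk G u v → ℝ
length G ω ε = 0ℝ
length G ω (_◅_ {i = u} {j = w} _ p) = ½ · (ω u + ω w) + length G ω p

-- For ω ≥ 0 removing a cycle from a walk does not lengthen it, so the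
-- walks with at most |V| edges already attain the minimal length.  The
-- walk supplied by connectedness only serves to start the minimum.
dist : (G : Graph) → Connected G → (V G → ℝ) → V G → V G → ℝ
dist G conn ω u v =
  foldr _⊓_ (length G ω (Connected.walk conn u v))
    (map (length G ω) (walks G (order G) u v))

pairAverage : ∀ n .{{_ : NonZero n}} → (Fin n → Fin n → ℝ) → ℝ
pairAverage n F = (+ 1 ℚ./ n ℚ.* (+ 1 ℚ./ n)) · ∑ λ x → ∑ λ y → F x y

Lipschitz₁ : ∀ {n} → (Fin n → Fin n → ℝ) → (Fin n → ℝ) → Set
Lipschitz₁ d f = ∀ x y → ∣ f x - f y ∣ ≤ d x y

𝔰obs : ∀ n .{{_ : NonZero n}} → (Fin n → Fin n → ℝ) → LowerReal
𝔰obs n d = sup {∃ (Lipschitz₁ d)} λ (f , _) →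
  lower (pairAverage n λ x y → ∣ f x - f y ∣)

module _ (G : Graph) (conn : Connected G) where
  private
    n = order G
    instance
      n≢0 : NonZero n
      n≢0 = Connected.nonempty conn

  ‖_‖₁ : (V G → ℝ) → ℝ
  ‖ ω ‖₁ = (+ 1 ℚ./ n) · ∑ ω

  Weight : Set
  Weight = Σ (V G → ℝ) λ ω → (∀ v → 0ℝ ≤ ω v) × ‖ ω ‖₁ ≤ 1ℝ

  𝔰̄₁ : LowerReal
  𝔰̄₁ = sup {Weight} λ (ω , _) → lower (pairAverage n (dist G conn ω))

  𝔰̄obs : LowerReal
  𝔰̄obs = sup {Weight} λ (ω , _) → 𝔰obs n (dist G conn ω)

{-# OPTIONS --safe #-}

-- Round the weights up to natural numbers and let w be about s / h, where s is
-- the average distance.  If some ball of radius of order h w contains a third of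
-- Ĝ, the distance to its centre is an observable of spread of order s.  If a set
-- S of order h n / w vertices splits Ĝ evenly, then weight on S alone separates
-- the two sides by w / h, again up to a constant, hence by s / h².  Otherwise
-- every small separation has a big side, and these big sides form a haven.  Now
-- run the Klein–Plotkin–Rao argument on G, following the haven: cut h times into
-- an annulus around some root, always measuring distances along the pieces that
-- the regions leave in the current subset of G; then choose h points far apart
-- in the last subset.  The h balls inside the annuli and the h tails that descend
-- from the points to these balls form a K_{h,h} minor, hence a K_h minor.

module Submission where

open import Data.Bool.Base using (Bool; true; false; T; not; _∧_; _∨_; if_then_else_)
open import Data.Bool.Properties using (T-∧; T-∨; T?)
open import Data.Empty using (⊥-elim)
open import Data.Fin.Base using (Fin; zero; suc; toℕ; fromℕ<)
open import Data.Fin.Properties using (_≟_; any?; all?; toℕ<n; injective⇒≤)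
open import Data.Product.Base using (Σ; ∃; ∃-syntax; _×_; _,_; proj₁; proj₂)
open import Data.Sum.Base using (_⊎_; inj₁; inj₂)
open import Data.Unit.Base using (⊤; tt)
open import Function.Base using (_∘_; id)
open import Function.Bundles using (Equivalence)
open import Relation.Binary.Construct.Closure.ReflexiveTransitive as RT using (Star; ε; _◅_; _◅◅_)
open import Relation.Binary.PropositionalEquality
  using (_≡_; _≢_; refl; sym; trans; cong; cong₂; subst; subst₂; module ≡-Reasoning)
open import Relation.Nullary.Decidable
  using (Dec; yes; no; does; map′; ¬?; _×-dec_; _→-dec_; ¬¬-excluded-middle)
open import Relation.Nullary.Negation using (¬_)

-- Ĝ itself may contain arbitrarily large cliques, so the minor has to be built in G, while weights,
-- separators and the haven live on Ĝ. A region may fall apart inside a subset of G. Charging each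
-- of its pieces separately keeps levels meaningful for points of G, at the price that a path which
-- leaves a piece midway has already paid for all of it. This overshoot is at most `w` once the
-- heavy vertices, those of weight above `w`, have been put into the separator, and it accounts for
-- the multiples of `w` in the annuli. The two factors `h` have different origins. Tails run through
-- `h` rounds and move by a multiple of `h * w` in all, which must stay below the average distance;
-- hence `w` is of order `s / h`. The separator collects the cuts of `h` annuli and `h` points, so
-- its weight is of order `h * n`, and normalising it divides by `h` once more.

module _ where

  open import Defs using (Graph; Minor; complete; RIG; Connected)
  open Graph using (order; V; Edge; Walk; symm; irr; edge?)
  open import Algebra.Properties.CommutativeMonoid.Sum using ()
  open import Data.Fin.Subset using (Subset; _∈_)
  open import Data.Fin.Subset.Properties using (x∈p∩q⁺; x∈p∩q⁻)
  open import Data.List.Base using ([]; _∷_)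
  open import Data.Nat.Base hiding (_/_; _%_)
  open import Data.Nat.DivMod using (_/_; m/n*n≤m; m≡m%n+[m/n]*n; m%n<n)
  open import Data.Nat.Induction using (<-rec)
  open import Data.Nat.Properties hiding (_≟_)
  open import Data.Nat.Tactic.RingSolver using (solve)
  open import Data.Vec.Base using (tabulate)
  open import Data.Vec.Properties using (lookup∘tabulate; lookup⇒[]=; []=⇒lookup)

  module Sum = Algebra.Properties.CommutativeMonoid.Sum +-0-commutativeMonoid
  open Sum public using (sum)

  -- A linear inequality by certificate: `X ≤ Y` is a combination of the hypotheses with natural
  -- coefficients and `k` is the slack, so that what remains is an identity for the ring solver.
  -- Strict hypotheses enter as `suc x ≤ y`.
  lin : ∀ {a b X Y} → X ≤ Y → (k : ℕ) → a + Y + k ≡ b + X → a ≤ b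
  lin {a} {b} {X} {Y} h k e = +-cancelʳ-≤ Y a b (≤-trans (m≤m+n (a + Y) k)
    (≤-trans (≤-reflexive e) (+-monoʳ-≤ b h)))

  infixr 5 _⊕_
  _⊕_ : ∀ {a b c d} → a ≤ b → c ≤ d → a + c ≤ b + d
  _⊕_ = +-mono-≤

  times : ∀ k {a b} → a ≤ b → k * a ≤ k * b
  times k h = *-monoʳ-≤ k h

  -- Distances along pieces of regions

  module Pieces {V I : Set} (E : V → V → Set) (E-sym : ∀ {a b} → E a b → E b a)
    (R : I → V → Set) (m : I → ℕ) (w : ℕ)
    (m≥1 : ∀ v → 1 ≤ m v) (light : ∀ {v z} → R v z → m v ≤ w) where

    Step : (V → Set) → I → V → V → Set
    Step D v a b = E a b × (R v a × D a) × (R v b × D b)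

    Piece : (V → Set) → I → V → V → Set
    Piece D v = Star (Step D v)

    -- Edges of G that lie in no region are left out: they carry no cost, so nothing would bound the
    -- change of a level across them.
    Adj : (V → Set) → V → V → Set
    Adj D a b = ∃ λ v → Step D v a b

    step-sym : ∀ {D v a b} → Step D v a b → Step D v b a
    step-sym (e , a , b) = E-sym e , b , a

    adj-sym : ∀ {D a b} → Adj D a b → Adj D b a
    adj-sym (v , s) = v , step-sym s

    piece-end : ∀ {D v a b} → R v a → D a → Piece D v a b → R v b × D b
    piece-end r d ε = r , d
    piece-end r d ((_ , _ , r' , d') ◅ p) = piece-end r' d' p

    step-mono : ∀ {D D' : V → Set} {v a b} → (∀ {z} → D z → D' z) → Step D v a b → Step D' v a b
    step-mono f (e , (r , d) , (r' , d')) = e , (r , f d) , (r' , f d')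

    data Reach (D : V → Set) (x : V) : ℕ → V → Set where
      start : ∀ {t} → Reach D x t x
      step  : ∀ {t t' v a b} → Reach D x t a → R v a → D a → Piece D v a b →
              t + m v ≤ t' → Reach D x t' b

    reach-mono : ∀ {D D' : V → Set} {x t t' y} → (∀ {z} → D z → D' z) → t ≤ t' → Reach D x t y →
      Reach D' x t' y
    reach-mono f h start = start
    reach-mono f h (step r rv d p q) = step (reach-mono f ≤-refl r) rv (f d) (RT.map (step-mono f) p)
      (≤-trans q h)

    reach-trans : ∀ {D x t y t' z} → Reach D x t y → Reach D y t' z → Reach D x (t + t') z
    reach-trans {t = t} r start = reach-mono id (m≤m+n t _) r
    reach-trans {t = t} r (step {t = s} {t' = t'} {v = v} r' rv d p q) = step (reach-trans r r') rv d p
      (≤-trans (≤-reflexive (+-assoc t s (m v))) (+-monoʳ-≤ t q))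

    reach-sym : ∀ {D x t y} → Reach D x t y → Reach D y t x
    reach-sym start = start
    reach-sym (step {t = t} {v = v} r rv d p q) = let rv' , d' = piece-end rv d p in
      reach-mono id (≤-trans (≤-reflexive (+-comm (m v) t)) q)
        (reach-trans (step start rv' d' (RT.reverse step-sym p) ≤-refl) (reach-sym r))

    reach-in : ∀ {D x t y} → D x → Reach D x t y → D y
    reach-in d start = d
    reach-in d (step r rv d' p q) = proj₂ (piece-end rv d' p)

    -- Every point passed on the way is itself reached within the total time, a piece being charged
    -- in full from its first edge on. So `P` holds along the whole path.
    reach⇒star : ∀ {D : V → Set} {P : V → Set} {x t y} → (∀ {z} → Reach D x t z → P z) →
                 Reach D x t y → Star (λ a b → E a b × P a × P b) x y
    reach⇒star f start = ε
    reach⇒star {D} {P} {x} {t} f (step {t = s} {v = v} r rv d p q) =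
      reach⇒star (f ∘ reach-mono id (≤-trans (m≤m+n s (m v)) q)) r ◅◅ go ε p
      where
      go : ∀ {a' b} → Piece D v _ a' → Piece D v a' b → Star (λ a b → E a b × P a × P b) a' b
      go pre ε = ε
      go pre (s ◅ p) = (proj₁ s , f (step r rv d pre q) , f (step r rv d (pre ◅◅ s ◅ ε) q)) ◅ go
        (pre ◅◅ s ◅ ε) p

    -- lev is the distance from x inside D: each piece, a component of a region
    -- within D, costs its weight m v however far it is followed.
    record Level (D : V → Set) (x : V) (lev : V → ℕ) : Set where
      field
        root∈ : D x
        root  : lev x ≡ 0
        lip   : ∀ {v a b} → R v a → D a → Piece D v a b → lev b ≤ lev a + m v
        desc  : ∀ {z} → D z → z ≡ x ⊎ ∃ λ v → ∃ λ b → R v z × Piece D v z b × lev b + m v ≤ lev z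

      reach-lip : ∀ {D' : V → Set} {a t b} → (∀ {z} → D' z → D z) → Reach D' a t b → lev b ≤ lev a + t
      reach-lip f start = m≤m+n _ _
      reach-lip {a = a} f (step {t = t} {t' = t'} {v = v} {a = c} {b = b} r rv d p q) =
        go (lev b) (lev c) (lev a) t (m v) t' (lip rv (f d) (RT.map (step-mono f) p)) (reach-lip f r) q
        where
        go : ∀ b c a t m t' → b ≤ c + m → c ≤ a + t → t + m ≤ t' → b ≤ a + t'
        go b c a t m t' p q r = lin (p ⊕ q ⊕ r) 0 (solve (b ∷ c ∷ a ∷ t ∷ m ∷ t' ∷ []))

      edge-lip : ∀ {v a b} → Step D v a b → lev b ≤ lev a + w
      edge-lip {a = a} s@(_ , (ra , da) , _) =
        ≤-trans (lip ra da (s ◅ ε)) (+-monoʳ-≤ (lev a) (light ra))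

    -- Descent along a level function

    record Descent (D : V → Set) (lev : V → ℕ) (e : ℕ) (z : V) : Set where
      constructor descent
      field
        last below : V
        time : ℕ
        last-reach  : Reach (λ y → D y × e < lev y × lev y ≤ lev z) z time last
        below-reach : Reach D z time below
        time≤  : time + e ≤ lev z + w
        edge   : E last below
        below∈ : D below
        below≤ : lev below ≤ e
        drop   : lev last ≤ lev below + w

    module _ {D : V → Set} {x : V} {lev : V → ℕ} (L : Level D x lev) (e : ℕ) where
      open Level L

      -- Follow the pieces given by `desc` until one of them first enters the levels up to `e`.
      -- After complete pieces, time and level together never exceed `lev z`; the last piece may be
      -- left midway but is charged in full, hence the overshoot by `w`.
      descend : ∀ {z} → D z → e < lev z → Descent D lev e z
      descend {z} dz e<z = loop (lev z) z ≤-refl 0 start (dz , e<z , ≤-refl) ≤-refl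
        where
        D> : V → Set
        D> y = D y × e < lev y × lev y ≤ lev z
        loop : ∀ fuel c → lev c ≤ fuel → ∀ t → Reach D> z t c → D> c → t + lev c ≤ lev z → Descent D lev e z
        loop fuel c hf t r (dc , e<c , c≤z) ht with desc dc
        ... | inj₁ refl = ⊥-elim (n≮0 (subst (e <_) root e<c))
        loop zero c hf t r (dc , e<c , c≤z) ht | inj₂ _ = ⊥-elim (n≮0 (<-≤-trans e<c hf))
        loop (suc fuel) c hf t r (dc , e<c , c≤z) ht | inj₂ (v , b , rc , p , hb) =
          walk c rc (dc , e<c , c≤z) ε p
          where
          spent = t + m v
          spent≤ : spent + e ≤ lev z + w
          spent≤ = go t (m v) e (lev z) w (lev c) (light rc) (<⇒≤ e<c) ht
            where
            go : ∀ t m e z w c → m ≤ w → e ≤ c → t + c ≤ z → t + m + e ≤ z + w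
            go t m e z w c p q r = lin (p ⊕ q ⊕ r) 0 (solve (t ∷ m ∷ e ∷ z ∷ w ∷ c ∷ []))
          walk : ∀ u → R v u → D> u → Piece D> v c u → Piece D v u b → Descent D lev e z
          walk u ru du pre ε =
            loop fuel u (≤-pred (≤-trans
              (≤-trans (≤-reflexive (+-comm 1 (lev u))) (≤-trans (+-monoʳ-≤ (lev u) (m≥1 v)) hb)) hf))
              spent (step r rc (dc , e<c , c≤z) pre ≤-refl) du
              (≤-trans (≤-reflexive
                (trans (+-assoc t (m v) (lev u)) (cong (t +_) (+-comm (m v) (lev u)))))
                  (≤-trans (+-monoʳ-≤ t hb) ht))
          walk u ru du pre (_◅_ {j = u'} s p) with e <? lev u'
          ... | no ¬e< = descent u u' spent
                (step r rc (dc , e<c , c≤z) pre ≤-refl)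
                (step (reach-mono proj₁ ≤-refl r) rc dc (RT.map (step-mono proj₁) pre ◅◅ s ◅ ε) ≤-refl)
                spent≤ (proj₁ s) (proj₂ (proj₂ (proj₂ s))) (≮⇒≥ ¬e<) (edge-lip (step-sym s))
          ... | yes e<' = walk u' (proj₁ (proj₂ (proj₂ s))) du'
            (pre ◅◅ (proj₁ s , (ru , du) , (proj₁ (proj₂ (proj₂ s)) , du')) ◅ ε) p
            where
            -- Seen from the far end `b`, no point of the piece lies higher than its starting point
            -- `c`, since `lev b + m v ≤ lev c`.
            back : lev u' ≤ lev b + m v
            back = let rb , db = piece-end ru (proj₁ du) (s ◅ p) in lip rb db (RT.reverse step-sym p)
            du' : D> u'
            du' = proj₂ (proj₂ (proj₂ s)) , e<' , ≤-trans back (≤-trans hb c≤z)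

      -- As in `descend`, a piece that leads down never rises above the level where it starts, so
      -- the way from a point of the ball to the root stays in the ball.
      ball-connected : ∀ {y} → D y → lev y ≤ e →
        Star (λ a b → E a b × (D a × lev a ≤ e) × (D b × lev b ≤ e)) x y
      ball-connected {y} dy hy = RT.reverse (λ (e , a , b) → E-sym e , b , a) (loop (lev y) y ≤-refl dy hy)
        where
        EB : V → V → Set
        EB a b = E a b × (D a × lev a ≤ e) × (D b × lev b ≤ e)
        loop : ∀ fuel y → lev y ≤ fuel → D y → lev y ≤ e → Star EB y x
        loop fuel y hf dy hy with desc dy
        ... | inj₁ refl = ε
        loop zero y hf dy hy | inj₂ (v , b , ry , p , hb) =
          ⊥-elim (n≮0 (≤-trans (≤-trans (m≥1 v) (m≤n+m (m v) (lev b))) (≤-trans hb hf)))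
        loop (suc fuel) y hf dy hy | inj₂ (v , b , ry , p , hb) = walk y ry dy hy p
          where
          walk : ∀ u → R v u → D u → lev u ≤ e → Piece D v u b → Star EB u x
          walk u ru du hu ε = loop fuel u
            (≤-pred (≤-trans (≤-trans (≤-reflexive (+-comm 1 (lev u)))
              (≤-trans (+-monoʳ-≤ (lev u) (m≥1 v)) hb)) hf)) du hu
          walk u ru du hu (_◅_ {j = u'} s@(eu , _ , (ru' , du')) p) = (eu , (du , hu) , (du' , hu')) ◅
            walk u' ru' du' hu' p
            where
            hu' : lev u' ≤ e
            hu' = let rb , db = piece-end ru' du' p in
              ≤-trans (lip rb db (RT.reverse step-sym p)) (≤-trans hb hy)

    -- Annuli, tails and balls

    multiple : ∀ a b {_ : T (a ≤ᵇ b)} → a * w ≤ b * w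
    multiple a b {h} = *-monoˡ-≤ w (≤ᵇ⇒≤ a b h)

    Within : (V → Set) → V → V → Set
    Within P a b = E a b × P a × P b

    -- D' is a component of the annulus e + 7w < lev ≤ u of D: the 7w levels
    -- below it leave room for the tails to descend before they meet the ball.
    record Round (D D' : V → Set) : Set where
      field
        {x}    : V
        {lev}  : V → ℕ
        level  : Level D x lev
        e u    : ℕ
        u≤     : u ≤ e + 9 * w
        sub    : ∀ {y} → D' y → D y × e + 7 * w < lev y × lev y ≤ u
        closed : ∀ {v y y'} → D' y → Step D v y y' → e + 7 * w < lev y' → lev y' ≤ u → D' y'

    data Chain (D₀ : V → Set) : ℕ → (V → Set) → Set₁ where
      base : Chain D₀ 0 D₀
      _▷_  : ∀ {k D D'} → Chain D₀ k D → Round D D' → Chain D₀ (suc k) D'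

    chain-sub : ∀ {D₀ k D} → Chain D₀ k D → ∀ {y} → D y → D₀ y
    chain-sub base d = d
    chain-sub (c ▷ r) d = chain-sub c (proj₁ (Round.sub r d))

    -- The tails A and the balls B of a K_{J,k} minor.  Of D only the points close
    -- to the representatives p are used, so that D is free for further rounds.
    record System (D₀ D : V → Set) (k : ℕ) (J : Set) (p : J → V) : Set₁ where
      field
        A      : J → V → Set
        B      : Fin k → V → Set
        hub    : Fin k → V
        A-rep  : ∀ a → A a (p a)
        A-conn : ∀ {a y} → A a y → Star (Within (A a)) (p a) y
        A-near : ∀ {a y} → A a y → Reach D₀ (p a) (k * (12 * w)) y
        A-safe : ∀ {a y} → A a y → D y → Reach D (p a) (3 * w) y
        A∩B    : ∀ {a j y} → A a y → ¬ B j y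
        B-hub  : ∀ j → B j (hub j)
        B-conn : ∀ {j y} → B j y → Star (Within (B j)) (hub j) y
        B-disj : ∀ {i j y} → i ≢ j → B i y → ¬ B j y
        B-out  : ∀ {j y} → B j y → ¬ D y
        touch  : ∀ a j → ∃ λ y → ∃ λ b → A a y × B j b × E y b

    reach-closed : ∀ {D' D> : V → Set} {x t y} → (∀ {v a b} → D' a → Step D> v a b → D' b) →
                   D' x → Reach D> x t y → Reach D' x t y
    reach-closed cl d start = start
    reach-closed {D'} {D>} cl d (step {v = v} r rv d> p q) =
      step r' rv da (go da p) q
      where
      r' = reach-closed cl d r
      da = reach-in d r'
      go : ∀ {a b} → D' a → Piece D> v a b → Piece D' v a b
      go d ε = ε
      go d (s@(e , (ra , _) , (rb , _)) ◅ p) = (e , (ra , d) , (rb , cl d s)) ◅ go (cl d s) p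

    -- `rep` is where the tail continues in the next round outwards. Its level leaves `3 * w` on
    -- either side: a point within `3 * w` of `rep` in `D` has level above `e`, so it misses the
    -- ball, and at most `e + 7 * w`, so it misses `D'`.
    record Tail (D₀ D D' : V → Set) (lev : V → ℕ) (e : ℕ) (p : V) : Set₁ where
      field
        Trail       : V → Set
        rep     : V
        rep∈    : D rep
        rep≤    : lev rep ≤ e + 4 * w
        rep>    : e + 3 * w < lev rep
        trail-start : Trail p
        trail-rep   : Trail rep
        trail-conn  : ∀ {y} → Trail y → Star (Within Trail) p y
        trail-near  : ∀ {y} → Trail y → Reach D₀ p (12 * w) y
        trail-in    : ∀ {y} → Trail y → D y × e < lev y
        trail-safe  : ∀ {y} → Trail y → D' y → Reach D' p (3 * w) y
        touch   : ∃ λ y → ∃ λ b → Trail y × D b × lev b ≤ e × E y b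

    component-conn : ∀ {P : V → Set} {p y} → Star (Within P) p y → Star (Within (Star (Within P) p)) p y
    component-conn {P} {p} s = go ε s
      where
      go : ∀ {a y} → Star (Within P) p a → Star (Within P) a y → Star (Within (Star (Within P) p)) a y
      go pre ε = ε
      go pre (s ◅ r) = (proj₁ s , pre , pre ◅◅ s ◅ ε) ◅ go (pre ◅◅ s ◅ ε) r

    module _ {D₀ D D' : V → Set} (D⊆D₀ : ∀ {y} → D y → D₀ y) (r : Round D D') where
      open Round r
      open Level level

      -- The 12w are 3w + 4w + 5w for the three descents, each of which overshoots
      -- by at most w.
      tail : ∀ {p} → D' p → Tail D₀ D D' lev e p
      tail {p} dp = record
        { Trail = Trail ; rep = b₂ ; rep∈ = S₂.below∈ ; rep≤ = S₂.below≤ ; rep> = rep>'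
        ; trail-start = ε ; trail-rep = in-b₂ ; trail-conn = component-conn
        ; trail-near = λ t → proj₁ (P-of t)
        ; trail-in = λ t → in-of (proj₂ (P-of t))
        ; trail-safe = λ t → safe-of (proj₂ (P-of t))
        ; touch = S₃.last , S₃.below , in-y₃ , S₃.below∈ , S₃.below≤ , S₃.edge
        }
        where
        c = e + 7 * w
        D⇒ : D p
        D⇒ = proj₁ (sub dp)
        module S₁ = Descent (descend level c D⇒ (proj₁ (proj₂ (sub dp))))
        b₁ = S₁.below
        -- The first descent rises no higher than `p`, hence stays in the annulus, where `D'` is
        -- closed under steps.
        seg₁ : ∀ {y t} → Reach (λ y → D y × c < lev y × lev y ≤ lev p) p t y → Reach D' p t y
        seg₁ = reach-closed (λ { d (eq , (ra , _) , (rb , db , c<b , b≤)) →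
          closed d (eq , (ra , proj₁ (sub d)) , (rb , db)) c<b (≤-trans b≤ (proj₂ (proj₂ (sub dp)))) }) dp
        t₁≤ : S₁.time ≤ 3 * w
        t₁≤ = go S₁.time e w (lev p) u S₁.time≤ (proj₂ (proj₂ (sub dp))) u≤
          where
          go : ∀ t e w p u → t + (e + 7 * w) ≤ p + w → p ≤ u → u ≤ e + 9 * w → t ≤ 3 * w
          go t e w p u h₁ h₂ h₃ = lin (h₁ ⊕ h₂ ⊕ h₃) 0 (solve (t ∷ e ∷ w ∷ p ∷ u ∷ []))
        b₁> : e + 6 * w < lev b₁
        b₁> = go e w (lev S₁.last) (lev b₁) (proj₁ (proj₂ (reach-last))) S₁.drop
          where
          reach-last = reach-in (D⇒ , proj₁ (proj₂ (sub dp)) , ≤-refl) S₁.last-reach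
          go : ∀ e w y b → e + 7 * w < y → y ≤ b + w → e + 6 * w < b
          go e w y b h₁ h₂ = lin (h₁ ⊕ h₂) 0 (solve (e ∷ w ∷ y ∷ b ∷ []))
        module S₂ = Descent (descend level (e + 4 * w) S₁.below∈
          (≤-<-trans (+-monoʳ-≤ e (multiple 4 6)) b₁>))
        b₂ = S₂.below
        rep>' : e + 3 * w < lev b₂
        rep>' = go e w (lev S₂.last) (lev b₂) (proj₁ (proj₂ (reach-last))) S₂.drop
          where
          reach-last = reach-in (S₁.below∈ , (≤-<-trans (+-monoʳ-≤ e (multiple 4 6)) b₁>) , ≤-refl)
            S₂.last-reach
          go : ∀ e w y b → e + 4 * w < y → y ≤ b + w → e + 3 * w < b
          go e w y b h₁ h₂ = lin (h₁ ⊕ h₂) 0 (solve (e ∷ w ∷ y ∷ b ∷ []))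
        t₂≤ : S₂.time ≤ 4 * w
        t₂≤ = go S₂.time e w (lev b₁) S₂.time≤ S₁.below≤
          where
          go : ∀ t e w p → t + (e + 4 * w) ≤ p + w → p ≤ e + 7 * w → t ≤ 4 * w
          go t e w p h₁ h₂ = lin (h₁ ⊕ h₂) 0 (solve (t ∷ e ∷ w ∷ p ∷ []))
        e<b₂ : e < lev b₂
        e<b₂ = ≤-<-trans (m≤m+n e (3 * w)) rep>'
        module S₃ = Descent (descend level e S₂.below∈ e<b₂)
        t₃≤ : S₃.time ≤ 5 * w
        t₃≤ = go S₃.time e w (lev b₂) S₃.time≤ S₂.below≤
          where
          go : ∀ t e w p → t + e ≤ p + w → p ≤ e + 4 * w → t ≤ 5 * w
          go t e w p h₁ h₂ = lin (h₁ ⊕ h₂) 0 (solve (t ∷ e ∷ w ∷ p ∷ []))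
        D'⇒D₀ : ∀ {y} → D' y → D₀ y
        D'⇒D₀ d = D⊆D₀ (proj₁ (sub d))
        -- Apart from connectedness, the demands on a tail concern single points. With `Trail` as
        -- the component of `p` in the set of points that meet them, it only remains to check that
        -- the three descents stay in that set.
        P : V → Set
        P y = Reach D₀ p (12 * w) y × (Reach D' p (3 * w) y ⊎ D y × e < lev y × lev y ≤ c)
        Trail : V → Set
        Trail = Star (Within P) p
        in-of : ∀ {y} → Reach D' p (3 * w) y ⊎ D y × e < lev y × lev y ≤ c → D y × e < lev y
        in-of (inj₁ h) = let d , c< , _ = sub (reach-in dp h) in d , ≤-<-trans (m≤m+n e (7 * w)) c<
        in-of (inj₂ (d , h , _)) = d , h
        safe-of : ∀ {y} → Reach D' p (3 * w) y ⊎ D y × e < lev y × lev y ≤ c → D' y → Reach D' p (3 * w) y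
        safe-of (inj₁ h) _ = h
        safe-of (inj₂ (_ , _ , h)) d' = ⊥-elim (<⇒≱ (proj₁ (proj₂ (sub d'))) h)
        P-p : P p
        P-p = start , inj₁ start
        P-of : ∀ {y} → Trail y → P y
        P-of s = go P-p s
          where
          go : ∀ {a y} → P a → Star (Within P) a y → P y
          go h ε = h
          go h (s ◅ r) = go (proj₂ (proj₂ s)) r
        trail-last : ∀ {y y'} → Trail y → E y y' → P y' → Trail y'
        trail-last t eq h = t ◅◅ (eq , P-of t , h) ◅ ε
        near₁ : Reach D₀ p (3 * w) b₁
        near₁ = reach-mono D⊆D₀ t₁≤ S₁.below-reach
        near₂ : Reach D₀ p (7 * w) b₂
        near₂ = reach-mono id (≤-reflexive (sym (*-distribʳ-+ w 3 4)))
          (reach-trans near₁ (reach-mono D⊆D₀ t₂≤ S₂.below-reach))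
        in-y₁ : Trail S₁.last
        in-y₁ = reach⇒star (λ h → let h' = reach-mono id t₁≤ h in
            reach-mono D'⇒D₀ (multiple 3 12) h' , inj₁ h')
          (seg₁ S₁.last-reach)
        in-b₁ : Trail b₁
        in-b₁ = trail-last in-y₁ S₁.edge (reach-mono id (multiple 3 12) near₁ ,
          inj₂ (S₁.below∈ , ≤-<-trans (m≤m+n e (6 * w)) b₁> , S₁.below≤))
        seg : ∀ {f z t d} → Reach D₀ p d z → d + t ≤ 12 * w → e ≤ f → f < lev z → lev z ≤ c → D z →
              ∀ {y} → Reach (λ y → D y × f < lev y × lev y ≤ lev z) z t y → P y
        seg near le e≤f f<z z≤c dz h = let dy , f<y , y≤ = reach-in (dz , f<z , ≤-refl) h in
          reach-mono id le (reach-trans near (reach-mono (D⊆D₀ ∘ proj₁) ≤-refl h)) ,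
          inj₂ (dy , ≤-<-trans e≤f f<y , ≤-trans y≤ z≤c)
        in-y₂ : Trail S₂.last
        in-y₂ = in-b₁ ◅◅ reach⇒star (seg near₁
            (≤-trans (+-monoʳ-≤ (3 * w) t₂≤)
              (≤-trans (≤-reflexive (sym (*-distribʳ-+ w 3 4))) (multiple 7 12)))
            (m≤m+n e (4 * w))
            (≤-<-trans (+-monoʳ-≤ e (multiple 4 6)) b₁>) S₁.below≤ S₁.below∈) S₂.last-reach
        b₂≤c : lev b₂ ≤ c
        b₂≤c = ≤-trans S₂.below≤ (+-monoʳ-≤ e (multiple 4 7))
        in-b₂ : Trail b₂
        in-b₂ = trail-last in-y₂ S₂.edge (reach-mono id (multiple 7 12) near₂ ,
          inj₂ (S₂.below∈ , e<b₂ , b₂≤c))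
        in-y₃ : Trail S₃.last
        in-y₃ = in-b₂ ◅◅ reach⇒star (seg near₂
            (≤-trans (+-monoʳ-≤ (7 * w) t₃≤) (≤-reflexive (sym (*-distribʳ-+ w 7 5))))
            ≤-refl e<b₂ (≤-trans S₂.below≤ (+-monoʳ-≤ e (multiple 4 7))) S₂.below∈) S₃.last-reach

    within-mono : ∀ {P Q : V → Set} → (∀ {y} → P y → Q y) → ∀ {a b} → Within P a b → Within Q a b
    within-mono f (e , p , q) = e , f p , f q

    within-sym : ∀ {P : V → Set} {a b} → Within P a b → Within P b a
    within-sym (e , p , q) = E-sym e , q , p

    -- The tails are grown from the innermost round outwards.
    system : ∀ {D₀ D k J} → Chain D₀ k D → (p : J → V) → (∀ a → D (p a)) → System D₀ D k J p
    system base p dp = record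
      { A = λ a y → y ≡ p a ; B = λ () ; hub = λ ()
      ; A-rep = λ a → refl ; A-conn = λ { refl → ε } ; A-near = λ { refl → start }
      ; A-safe = λ { refl _ → start } ; A∩B = λ { {j = ()} }
      ; B-hub = λ () ; B-conn = λ { {()} } ; B-disj = λ { {()} } ; B-out = λ { {()} } ; touch = λ _ () }
    system {D₀} {D'} {suc k} {J} (_▷_ {D = D} ch r) p dp = record
      { A = A ; B = B ; hub = hub
      ; A-rep = λ a → inj₁ (Tl.trail-start a)
      ; A-conn = A-conn
      ; A-near = A-near
      ; A-safe = A-safe
      ; A∩B = λ {a} {j} → A∩B {a} {j}
      ; B-hub = λ { zero → root∈ , ≤-trans (≤-reflexive root) z≤n ; (suc j) → S.B-hub j }
      ; B-conn = λ { {zero} (d , h) → ball-connected level e d h ; {suc j} b → S.B-conn b }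
      ; B-disj = B-disj
      ; B-out = λ { {zero} (d , h) d' → B₀-out d' h ; {suc j} b d' → S.B-out b (proj₁ (sub d')) }
      ; touch = λ { a zero → let y , b , t , d , h , eq = Tl.touch a in y , b , inj₁ t , (d , h) , eq
                  ; a (suc j) → let y , b , t , h , eq = S.touch a j in y , b , inj₂ t , h , eq }
      }
      where
      open Round r
      open Level level
      module Tl (a : J) = Tail (tail (chain-sub ch) r (dp a))
      module S = System (system ch Tl.rep Tl.rep∈)
      A : J → V → Set
      A a y = Tl.Trail a y ⊎ S.A a y
      B : Fin (suc k) → V → Set
      B zero y = D y × lev y ≤ e
      B (suc j) = S.B j
      hub : Fin (suc k) → V
      hub zero = x
      hub (suc j) = S.hub j
      B₀-out : ∀ {y} → D' y → ¬ lev y ≤ e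
      B₀-out d' h = <⇒≱ (proj₁ (proj₂ (sub d'))) (≤-trans h (m≤m+n e (7 * w)))
      A-conn : ∀ {a y} → A a y → Star (Within (A a)) (p a) y
      A-conn {a} (inj₁ t) = RT.map (within-mono inj₁) (Tl.trail-conn a t)
      A-conn {a} (inj₂ t) = RT.map (within-mono inj₁) (Tl.trail-conn a (Tl.trail-rep a))
        ◅◅ RT.map (within-mono inj₂) (S.A-conn t)
      A-near : ∀ {a y} → A a y → Reach D₀ (p a) (suc k * (12 * w)) y
      A-near {a} (inj₁ t) = reach-mono id (m≤m+n (12 * w) _) (Tl.trail-near a t)
      A-near {a} (inj₂ t) = reach-trans (Tl.trail-near a (Tl.trail-rep a)) (S.A-near t)
      rep-lip : ∀ {a y} → S.A a y → D y → lev y ≤ lev (Tl.rep a) + 3 * w × lev (Tl.rep a) ≤ lev y + 3 * w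
      rep-lip t d = let h = S.A-safe t d in reach-lip id h , reach-lip id (reach-sym h)
      A-safe : ∀ {a y} → A a y → D' y → Reach D' (p a) (3 * w) y
      A-safe {a} (inj₁ t) d' = Tl.trail-safe a t d'
      A-safe {a} {y} (inj₂ t) d' = let d , c< , _ = sub d' in
        ⊥-elim (<⇒≱ c< (go (lev y) (lev (Tl.rep a)) e w (proj₁ (rep-lip t d)) (Tl.rep≤ a)))
        where
        go : ∀ y b e w → y ≤ b + 3 * w → b ≤ e + 4 * w → y ≤ e + 7 * w
        go y b e w h₁ h₂ = lin (h₁ ⊕ h₂) 0 (solve (y ∷ b ∷ e ∷ w ∷ []))
      A∩B : ∀ {a j y} → A a y → ¬ B j y
      A∩B {a} {zero} (inj₁ t) (d , h) = <⇒≱ (proj₂ (Tl.trail-in a t)) h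
      A∩B {a} {zero} {y} (inj₂ t) (d , h) =
        <⇒≱ (go (lev y) (lev (Tl.rep a)) e w (proj₂ (rep-lip t d)) (Tl.rep> a)) h
        where
        go : ∀ y b e w → b ≤ y + 3 * w → e + 3 * w < b → e < y
        go y b e w h₁ h₂ = lin (h₁ ⊕ h₂) 0 (solve (y ∷ b ∷ e ∷ w ∷ []))
      A∩B {a} {suc j} (inj₁ t) b = S.B-out b (proj₁ (Tl.trail-in a t))
      A∩B {a} {suc j} (inj₂ t) b = S.A∩B t b
      B-disj : ∀ {i j y} → i ≢ j → B i y → ¬ B j y
      B-disj {zero} {zero} i≢j _ _ = i≢j refl
      B-disj {zero} {suc j} _ (d , _) b = S.B-out b d
      B-disj {suc i} {zero} _ b (d , _) = S.B-out b d
      B-disj {suc i} {suc j} i≢j b b' = S.B-disj (i≢j ∘ cong suc) b b'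

  -- Everything built on G serves to refute the absence of a minor, so that it is
  -- enough to have it up to double negation.
  ¬¬-∀ : ∀ {ℓ n} {A : Fin n → Set ℓ} → (∀ i → ¬ ¬ A i) → ¬ ¬ (∀ i → A i)
  ¬¬-∀ {n = zero} f k = k λ ()
  ¬¬-∀ {n = suc n} f k = f zero λ x → ¬¬-∀ (f ∘ suc) λ xs → k λ { zero → x ; (suc i) → xs i }

  ¬¬-decide : ∀ {n} (P : Fin n → Set) → ¬ ¬ (∀ i → Dec (P i))
  ¬¬-decide P = ¬¬-∀ λ i → ¬¬-excluded-middle

  ¬¬-least : (P : ℕ → Set) → ∀ {t} → P t → ¬ ¬ (∃ λ t → P t × ∀ s → P s → t ≤ s)
  ¬¬-least P {t} p k = <-rec (λ t → ¬ P t)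
    (λ t rec p → k (t , p , λ s q → ≮⇒≥ λ s<t → rec s<t q)) t p

  module _ {N : ℕ} {I : Set} (E : Fin N → Fin N → Set) (E-sym : ∀ {a b} → E a b → E b a)
    (R : I → Fin N → Set) (m : I → ℕ) (w : ℕ)
    (m≥1 : ∀ v → 1 ≤ m v) (light : ∀ {v z} → R v z → m v ≤ w) where
    open Pieces E E-sym R m w m≥1 light

    -- The level is the least time at which a point is reached, which exists only up to double
    -- negation; `desc` reads off the last step of a quickest path.
    level-exists : ∀ {D x} → D x → (∀ {z} → D z → Star (Adj D) x z) → ¬ ¬ (∃ (Level D x))
    level-exists {D} {x} dx conn k = ¬¬-∀ least λ f → k (proj₁ ∘ f , record
      { root∈ = dx
      ; root  = n≤0⇒n≡0 (proj₂ (proj₂ (f x) dx) 0 start)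
      ; lip   = λ {v} {y} {z} ry dy p → proj₂ (proj₂ (f z) (proj₂ (piece-end ry dy p))) _
                  (step (proj₁ (proj₂ (f y) dy)) ry dy p ≤-refl)
      ; desc  = λ {z} dz → desc f z dz (proj₁ (proj₂ (f z) dz))
      })
      where
      Least : Fin N → ℕ → Set
      Least z t = Reach D x t z × ∀ s → Reach D x s z → t ≤ s
      reached : ∀ {y z t} → Reach D x t y → Star (Adj D) y z → ∃ λ t → Reach D x t z
      reached r ε = _ , r
      reached r ((v , s@(_ , (ry , dy) , _)) ◅ p) = reached (step r ry dy (s ◅ ε) ≤-refl) p
      least : ∀ z → ¬ ¬ (Σ ℕ λ t → D z → Least z t)
      least z k = ¬¬-excluded-middle λ
        { (yes dz) → ¬¬-least (λ t → Reach D x t z) (proj₂ (reached (start {t = 0}) (conn dz)))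
                       λ (t , l) → k (t , λ _ → l)
        -- `Level` constrains `lev` on `D` only, so any value will do here.
        ; (no ¬dz) → k (0 , λ dz → ⊥-elim (¬dz dz)) }
      desc : (f : ∀ z → Σ ℕ λ t → D z → Least z t) → ∀ z → D z → ∀ {s} → Reach D x s z →
             z ≡ x ⊎ ∃ λ v → ∃ λ b → R v z × Piece D v z b × proj₁ (f b) + m v ≤ s
      desc f z dz start = inj₁ refl
      desc f z dz (step {t = t} {v = v} {a = y} r ry dy p q) = let rz , _ = piece-end ry dy p in
        inj₂ (v , y , rz , RT.reverse step-sym p , ≤-trans (+-monoˡ-≤ (m v) (proj₂ (proj₂ (f y) dy) t r)) q)

  -- Minors with predicates as branch sets

  record MinorModel (h : ℕ) (G : Graph) : Set₁ where
    field
      branch : Fin h → V G → Set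
      hub : ∀ a → Σ (V G) (branch a)
      connected : ∀ {a y z} → branch a y → branch a z →
        Star (λ y z → Edge G y z × branch a y × branch a z) y z
      disjoint : ∀ {a b y} → a ≢ b → branch a y → ¬ branch b y
      adjacent : ∀ {a b} → a ≢ b → ∃ λ x → ∃ λ y → branch a x × branch b y × Edge G x y

  -- A `Subset` is Boolean, so membership in the branch sets has to be decided; for finitely many
  -- points that is available under double negation.
  minor : ∀ {h G} → MinorModel h G → ¬ ¬ Minor (complete h) G
  minor {h} {G} M k = ¬¬-∀ (λ a → ¬¬-decide (branch a)) λ dec →
    let sub : Fin h → Subset (order G)
        sub a = tabulate (λ y → does (dec a y))
        to : ∀ {a y} → y ∈ sub a → branch a y
        to {a} {y} p = from-does (dec a y) (trans (sym (lookup∘tabulate _ y)) ([]=⇒lookup p))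
        from : ∀ {a y} → branch a y → y ∈ sub a
        from {a} {y} b = lookup⇒[]= y (sub a) (trans (lookup∘tabulate _ y) (to-does (dec a y) b))
    in k record
      { branch = sub
      ; nonempty = λ a → proj₁ (hub a) , from (proj₂ (hub a))
      ; connected = λ a p q → RT.map (λ (e , p , q) → e , from p , from q) (connected (to p) (to q))
      ; disjoint = λ a≢b (y , p) → let p , q = x∈p∩q⁻ _ _ p in disjoint a≢b (to p) (to q)
      ; adjacent = λ a≢b → let x , y , p , q , e = adjacent a≢b in x , y , from p , from q , e
      }
    where
    open MinorModel M
    from-does : ∀ {A : Set} (d : Dec A) → does d ≡ true → A
    from-does (yes a) _ = a
    to-does : ∀ {A : Set} (d : Dec A) → A → does d ≡ true
    to-does (yes _) _ = refl
    to-does (no ¬a) a = ⊥-elim (¬a a)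

  module _ {I : Set} {G : Graph}
    (R : I → V G → Set) (m : I → ℕ) (w : ℕ)
    (m≥1 : ∀ v → 1 ≤ m v) (light : ∀ {v z} → R v z → m v ≤ w) where
    open Pieces (Edge G) (symm G) R m w m≥1 light

    -- K_{h,h} with the a-th tail and the a-th ball merged.
    system⇒model : ∀ {D₀ D h p} → System D₀ D h (Fin h) p →
      (∀ {a b} → a ≢ b → ¬ Reach D₀ (p a) (2 * (h * (12 * w))) (p b)) → MinorModel h G
    system⇒model {D₀} {h = h} {p} S far = record
      { branch = Br
      ; hub = λ a → p a , inj₁ (A-rep a)
      ; connected = λ {a} b c → RT.reverse within-sym (from-p b) ◅◅ from-p c
      ; disjoint = disj
      ; adjacent = λ {a} {b} a≢b → let y , z , t , u , e = touch a b in y , z , inj₁ t , inj₂ u , e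
      }
      where
      open System S
      Br : Fin h → V G → Set
      Br a y = A a y ⊎ B a y
      from-p : ∀ {a y} → Br a y → Star (Within (Br a)) (p a) y
      from-p (inj₁ t) = RT.map (within-mono inj₁) (A-conn t)
      from-p {a} (inj₂ b) = let y , z , t , u , e = touch a a in
        RT.map (within-mono inj₁) (A-conn t) ◅◅ (e , inj₁ t , inj₂ u) ◅
        (RT.map (within-mono inj₂) (RT.reverse within-sym (B-conn u) ◅◅ B-conn b))
      disj : ∀ {a b y} → a ≢ b → Br a y → ¬ Br b y
      disj a≢b (inj₁ t) (inj₁ t') = far a≢b (reach-mono id
        (≤-reflexive (cong (h * (12 * w) +_) (sym (+-identityʳ _))))
        (reach-trans (A-near t) (reach-sym (A-near t'))))
      disj a≢b (inj₁ t) (inj₂ u) = A∩B t u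
      disj a≢b (inj₂ u) (inj₁ t) = A∩B t u
      disj a≢b (inj₂ u) (inj₂ u') = B-disj a≢b u u'

  -- Separations and havens

  sum-mono : ∀ {n} {f g : Fin n → ℕ} → (∀ i → f i ≤ g i) → sum f ≤ sum g
  sum-mono {zero} h = z≤n
  sum-mono {suc n} h = +-mono-≤ (h zero) (sum-mono (h ∘ suc))

  sum-+ : ∀ {n} (f g : Fin n → ℕ) → sum (λ i → f i + g i) ≡ sum f + sum g
  sum-+ = Sum.∑-distrib-+

  sum-const : ∀ n c → sum {n} (λ _ → c) ≡ n * c
  sum-const zero c = refl
  sum-const (suc n) c = cong (c +_) (sum-const n c)

  sum-* : ∀ {n} (f : Fin n → ℕ) c → sum (λ i → f i * c) ≡ sum f * c
  sum-* {zero} f c = refl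
  sum-* {suc n} f c = trans (cong (f zero * c +_) (sum-* (f ∘ suc) c)) (sym (*-distribʳ-+ c (f zero) _))

  ≤-sum : ∀ {n} (f : Fin n → ℕ) i → f i ≤ sum f
  ≤-sum f zero = m≤m+n (f zero) _
  ≤-sum f (suc i) = ≤-trans (≤-sum (f ∘ suc) i) (m≤n+m _ (f zero))

  pigeonhole-sum : ∀ {n} → 1 ≤ n → (f : Fin n → ℕ) → ∃ λ i → f i * n ≤ sum f
  pigeonhole-sum {n} 1≤n f with any? (λ i → f i * n ≤? sum f)
  ... | yes h = h
  ... | no ¬h = ⊥-elim (<-irrefl refl (begin-strict
      n * sum f                    <⟨ *-monoʳ-< n {{>-nonZero 1≤n}} (n<1+n (sum f)) ⟩
      n * suc (sum f)              ≡⟨ sum-const n (suc (sum f)) ⟨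
      sum {n} (λ _ → suc (sum f))  ≤⟨ sum-mono (λ i → ≰⇒> λ h → ¬h (i , h)) ⟩
      sum (λ i → f i * n)          ≡⟨ sum-* f n ⟩
      sum f * n                    ≡⟨ *-comm (sum f) n ⟩
      n * sum f                    ∎))
    where open ≤-Reasoning

  -- Counting with Boolean predicates

  bit : Bool → ℕ
  bit true = 1
  bit false = 0

  bit-mono : ∀ {a b} → (T a → T b) → bit a ≤ bit b
  bit-mono {false} h = z≤n
  bit-mono {true} {true} h = ≤-refl
  bit-mono {true} {false} h = ⊥-elim (h tt)

  T-not : ∀ {b} → ¬ T b → T (not b)
  T-not {false} h = tt
  T-not {true} h = ⊥-elim (h tt)

  not-T : ∀ {b} → T (not b) → ¬ T b
  not-T {false} _ ()

  ∧-i : ∀ {a b} → T a → T b → T (a ∧ b)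
  ∧-i p q = Equivalence.from T-∧ (p , q)

  ∧-e : ∀ {a b} → T (a ∧ b) → T a × T b
  ∧-e = Equivalence.to T-∧

  # : ∀ {n} → (Fin n → Bool) → ℕ
  # b = sum (bit ∘ b)

  #-mono : ∀ {n} {P Q : Fin n → Bool} → (∀ v → T (P v) → T (Q v)) → # P ≤ # Q
  #-mono h = sum-mono (λ v → bit-mono (h v))

  #-cover₂ : ∀ {n} {P A B : Fin n → Bool} → (∀ v → T (P v) → T (A v) ⊎ T (B v)) → # P ≤ # A + # B
  #-cover₂ {P = P} {A} {B} h = ≤-trans (sum-mono pt) (≤-reflexive (sum-+ (bit ∘ A) (bit ∘ B)))
    where
    pt : ∀ v → bit (P v) ≤ bit (A v) + bit (B v)
    pt v with P v | A v | B v | h v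
    ... | false | _ | _ | _ = z≤n
    ... | true | true | _ | _ = s≤s z≤n
    ... | true | false | true | _ = s≤s z≤n
    ... | true | false | false | k with k tt
    ... | inj₁ ()
    ... | inj₂ ()

  #-nonempty : ∀ {n} (P : Fin n → Bool) → 1 ≤ # P → ∃ λ v → T (P v)
  #-nonempty {zero} P ()
  #-nonempty {suc n} P h with P zero in eq
  ... | true = zero , subst T (sym eq) tt
  ... | false = let v , p = #-nonempty (P ∘ suc) h in suc v , p

  #-all : ∀ {n} → # {n} (λ _ → true) ≡ n
  #-all {n} = trans (sum-const n 1) (*-identityʳ n)

  #-none : ∀ {n} → # {n} (λ _ → false) ≡ 0
  #-none {n} = trans (sum-const n 0) (*-zeroʳ n)

  -- A vertex at level `l` with weight `m` occupies the levels from `l - m` up to, but excluding,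
  -- `l + m`; a cut at any of them removes it.
  near : ℕ → ℕ → ℕ → Bool
  near l m c = (c <ᵇ l + m) ∧ (l ≤ᵇ c + m)

  -- Telescoping: `F c` counts the levels below `c` in the interval of `near`, negative ones
  -- included. It grows by one at each hit and never exceeds `2 * m`.
  near-count : ∀ w a l m → sum {w} (λ i → bit (near l m (a + toℕ i))) ≤ 2 * m
  near-count w a l m = ≤-trans (m+n≤o⇒m≤o _ (tele w a))
    (≤-trans (∸-monoˡ-≤ l (+-monoˡ-≤ m (m⊓n≤n (a + w) (l + m)))) (≤-reflexive eq))
    where
    F : ℕ → ℕ
    F c = c ⊓ (l + m) + m ∸ l
    eq : l + m + m ∸ l ≡ 2 * m
    eq = trans (cong (_∸ l) (+-assoc l m m)) (trans (m+n∸m≡n l (m + m)) (cong (m +_) (sym (+-identityʳ m))))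
    F-mono : ∀ c → F c ≤ F (suc c)
    F-mono c = ∸-monoˡ-≤ l (+-monoˡ-≤ m (⊓-monoˡ-≤ (l + m) (n≤1+n c)))
    one : ∀ c → bit (near l m c) + F c ≤ F (suc c)
    one c with c <ᵇ l + m in e₁
    ... | false = F-mono c
    ... | true with l ≤ᵇ c + m in e₂
    ... | false = F-mono c
    ... | true = ≤-reflexive (begin
        suc (c ⊓ (l + m) + m ∸ l)   ≡⟨ cong (λ z → suc (z + m ∸ l)) (m≤n⇒m⊓n≡m (<⇒≤ c<)) ⟩
        suc (c + m ∸ l)             ≡⟨ +-∸-assoc 1 l≤ ⟨
        suc c + m ∸ l               ≡⟨ cong (λ z → z + m ∸ l) (m≤n⇒m⊓n≡m c<) ⟨
        suc c ⊓ (l + m) + m ∸ l     ∎)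
      where
      open ≡-Reasoning
      c< : c < l + m
      c< = <ᵇ⇒< c (l + m) (subst T (sym e₁) tt)
      l≤ : l ≤ c + m
      l≤ = ≤ᵇ⇒≤ l (c + m) (subst T (sym e₂) tt)
    tele : ∀ w a → sum {w} (λ i → bit (near l m (a + toℕ i))) + F a ≤ F (a + w)
    tele zero a = ≤-reflexive (cong F (sym (+-identityʳ a)))
    tele (suc w) a = begin
        bit (near l m (a + 0)) + sum {w} (λ i → bit (near l m (a + suc (toℕ i)))) + F a
          ≡⟨ cong₂ (λ x y → bit (near l m x) + y + F a) (+-identityʳ a)
               (Sum.sum-cong-≗ {w} (λ i → cong (bit ∘ near l m) (+-suc a (toℕ i)))) ⟩
        bit (near l m a) + s + F a
          ≡⟨ cong (_+ F a) (+-comm (bit (near l m a)) s) ⟩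
        s + bit (near l m a) + F a
          ≡⟨ +-assoc s _ _ ⟩
        s + (bit (near l m a) + F a)
          ≤⟨ +-monoʳ-≤ s (one a) ⟩
        s + F (suc a)
          ≤⟨ tele w (suc a) ⟩
        F (suc a + w)
          ≡⟨ cong F (+-suc a w) ⟨
        F (a + suc w) ∎
      where
      open ≤-Reasoning
      s = sum {w} (λ i → bit (near l m (suc a + toℕ i)))

  Region : ℕ → Set
  Region n = Fin n → Bool

  infixr 7 _⋂_
  infixr 6 _⋃_
  _⋂_ _⋃_ : ∀ {n} → Region n → Region n → Region n
  (P ⋂ Q) v = P v ∧ Q v
  (P ⋃ Q) v = P v ∨ Q v

  ∁ : ∀ {n} → Region n → Region n
  ∁ P v = not (P v)

  ∨-l : ∀ {a b} → T a → T (a ∨ b)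
  ∨-l p = Equivalence.from T-∨ (inj₁ p)

  ∨-r : ∀ {a b} → T b → T (a ∨ b)
  ∨-r p = Equivalence.from T-∨ (inj₂ p)

  #-⋃ : ∀ {n} (P Q : Region n) → # (P ⋃ Q) ≤ # P + # Q
  #-⋃ P Q = #-cover₂ {P = P ⋃ Q} {P} {Q} λ v → Equivalence.to T-∨

  -- A haven: as long as no small set S splits the graph evenly, one side of every
  -- small separation is the big one, and the big sides are closed under ⋂.
  module Haven {n : ℕ} (1≤n : 1 ≤ n) (Adj : Fin n → Fin n → Set) (Adj-sym : ∀ {u v} → Adj u v → Adj v u)
    (w β : ℕ) (1≤w : 1 ≤ w) (β-small : 6 * β ≤ n * w) where

    -- Outside `S`, `P` is a union of components of the graph without `S`; the values of `P` on `S`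
    -- are arbitrary.
    Closed : Region n → Region n → Set
    Closed S P = ∀ u v → Adj u v → ¬ T (S u) → ¬ T (S v) → T (P u) → T (P v)

    Small : Region n → Set
    Small S = # S * w ≤ β

    NoSplit : Set
    NoSplit = ∀ S P → Closed S P → Small S → 6 * # (∁ S ⋂ P) < n ⊎ 6 * # (∁ S ⋂ ∁ P) < n

    record Big (S P : Region n) : Set where
      constructor big
      field
        closed : Closed S P
        out    : 6 * # (∁ S ⋂ ∁ P) < n

    6#S≤n : ∀ {S} → Small S → 6 * # S ≤ n
    6#S≤n {S} h = *-cancelʳ-≤ (6 * # S) n w {{>-nonZero 1≤w}}
      (≤-trans (≤-reflexive (*-assoc 6 (# S) w)) (≤-trans (*-monoʳ-≤ 6 h) β-small))

    closed-∁ : ∀ {S P} → Closed S P → Closed S (∁ P)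
    closed-∁ cl u v a su sv p = T-not λ q → not-T p (cl v u (Adj-sym a) sv su q)

    closed-⋂ : ∀ {S P Q} → Closed S P → Closed S Q → Closed S (P ⋂ Q)
    closed-⋂ c d u v a su sv p = let x , y = ∧-e p in ∧-i (c u v a su sv x) (d u v a su sv y)

    up : ∀ {S P P'} → Big S P → Closed S P' → (∀ v → ¬ T (S v) → T (P v) → T (P' v)) → Big S P'
    up {S} {P} {P'} (big c o) cl h = big cl (≤-<-trans (*-monoʳ-≤ 6 (#-mono {P = ∁ S ⋂ ∁ P'} {∁ S ⋂ ∁ P}
      λ v t → let s , p = ∧-e t in ∧-i s (T-not λ q → not-T p (h v (not-T s) q)))) o)

    weaken : ∀ {S S' P} → (∀ v → T (S v) → T (S' v)) → Big S P → Big S' P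
    weaken {S} {S'} {P} h (big c o) = big (λ u v a su sv → c u v a (su ∘ h u) (sv ∘ h v))
      (≤-<-trans (*-monoʳ-≤ 6 (#-mono {P = ∁ S' ⋂ ∁ P} {∁ S ⋂ ∁ P}
        λ v t → let s , p = ∧-e t in ∧-i (T-not λ q → not-T s (h v q)) p)) o)

    module _ (noSplit : NoSplit) where

      dichotomy : ∀ {S P} → Small S → Closed S P → Big S P ⊎ Big S (∁ P)
      dichotomy {S} {P} s c with noSplit S P c s
      ... | inj₂ o = inj₁ (big c o)
      ... | inj₁ o = inj₂ (big (closed-∁ c) (≤-<-trans (*-monoʳ-≤ 6 (#-mono {P = ∁ S ⋂ ∁ (∁ P)} {∁ S ⋂ P}
        λ v t → let s , p = ∧-e {not (S v)} {not (not (P v))} t in ∧-i {not (S v)} {P v} s (nn p))) o))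
        where
        nn : ∀ {b} → T (not (not b)) → T b
        nn {true} _ = tt

    -- At most a sixth of the vertices lie in `S` and less than a sixth on the other side, which
    -- leaves more than two thirds for the big side.
    cover : ∀ {S P} → Small S → Big S P → ∀ Q → (∀ v → ¬ T (S v) → T (P v) → T (Q v)) → 4 * n < 6 * # Q
    cover {S} {P} s (big _ o) Q h = go (# S) (# (∁ S ⋂ ∁ P)) (# Q) n (6#S≤n s) o all
      where
      all : n ≤ # S + (# (∁ S ⋂ ∁ P) + # Q)
      all = ≤-trans (≤-reflexive (sym #-all)) (≤-trans
        (#-cover₂ {P = λ _ → true} {S} {∁ S ⋂ ∁ P ⋃ Q} pt)
        (+-monoʳ-≤ (# S) (#-⋃ (∁ S ⋂ ∁ P) Q)))
        where
        pt : ∀ v → T true → T (S v) ⊎ T ((∁ S ⋂ ∁ P ⋃ Q) v)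
        pt v _ with T? (S v) | T? (P v)
        ... | yes s | _ = inj₁ s
        ... | no s | yes p = inj₂ (∨-r {(∁ S ⋂ ∁ P) v} (h v s p))
        ... | no s | no p = inj₂ (∨-l (∧-i (T-not s) (T-not p)))
      go : ∀ s o q n → 6 * s ≤ n → 6 * o < n → n ≤ s + (o + q) → 4 * n < 6 * q
      go s o q n h₁ h₂ h₃ = lin (h₁ ⊕ h₂ ⊕ times 6 h₃) 0 (solve (s ∷ o ∷ q ∷ n ∷ []))

    inhabited : ∀ {S P} → Small S → Big S P → ∃ λ v → T (P v) × ¬ T (S v)
    inhabited {S} {P} s b = let v , t = #-nonempty (∁ S ⋂ P) (pos _ (cover s b (∁ S ⋂ P) λ v sv pv → ∧-i (T-not sv) pv))
                                sv , pv = ∧-e {not (S v)} t in v , pv , not-T sv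
      where
      pos : ∀ q → 4 * n < 6 * q → 1 ≤ q
      pos zero ()
      pos (suc q) _ = s≤s z≤n

    module _ (noSplit : NoSplit) where

      -- Were `P ⋂ Q` the small side, it and the complement of `Q`, each less than a sixth, would
      -- together cover the big side `P`, against the two thirds of `cover`.
      meet : ∀ {S P Q} → Small S → Big S P → Big S Q → Big S (P ⋂ Q)
      meet {S} {P} {Q} s b@(big c o) b'@(big c' o') with noSplit S (P ⋂ Q) (closed-⋂ {S} {P} {Q} c c') s
      ... | inj₂ h = big (closed-⋂ {S} {P} {Q} c c') h
      ... | inj₁ h = ⊥-elim (go (# (∁ S ⋂ P ⋂ Q)) (# (∁ S ⋂ ∁ Q)) n h o'
          (<-≤-trans (cover s b (∁ S ⋂ P ⋂ Q ⋃ ∁ S ⋂ ∁ Q) pt) (*-monoʳ-≤ 6 (#-⋃ (∁ S ⋂ P ⋂ Q) (∁ S ⋂ ∁ Q)))))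
        where
        pt : ∀ v → ¬ T (S v) → T (P v) → T ((∁ S ⋂ P ⋂ Q ⋃ ∁ S ⋂ ∁ Q) v)
        pt v sv pv with T? (Q v)
        ... | yes q = ∨-l (∧-i (T-not sv) (∧-i pv q))
        ... | no q = ∨-r {(∁ S ⋂ P ⋂ Q) v} (∧-i (T-not sv) (T-not q))
        go : ∀ a b n → 6 * a < n → 6 * b < n → ¬ (4 * n < 6 * (a + b))
        go a b n h₁ h₂ h₃ = <-irrefl refl
          (lin {suc (4 * n)} {4 * n} (h₁ ⊕ h₂ ⊕ h₃) (2 * n + 2) (solve (a ∷ b ∷ n ∷ [])))

  -- Sweeping a level function over the big side

  near-above : ∀ {l m c} → ¬ T (near l m c) → c < l → c + m < l
  near-above {l} {m} {c} ¬n c<l = ≰⇒> λ l≤ → ¬n (∧-i (<⇒<ᵇ (<-≤-trans c<l (m≤m+n l m))) (≤⇒≤ᵇ l≤))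

  near-below : ∀ {l m c} → ¬ T (near l m c) → l ≤ c → l + m ≤ c
  near-below {l} {m} {c} ¬n l≤c = ≮⇒≥ λ c< → ¬n (∧-i (<⇒<ᵇ c<) (≤⇒≤ᵇ (≤-trans l≤c (m≤m+n c m))))

  first-change : ∀ {A B : ℕ → Set} → (∀ j → A j ⊎ B j) → A 0 → ∀ J → ¬ A J → ∃ λ j → A j × B (suc j)
  first-change s a zero ¬a = ⊥-elim (¬a a)
  first-change {A} s a (suc J) ¬a with s 1
  ... | inj₂ b = 0 , a , b
  ... | inj₁ a' = map₁' (first-change (s ∘ suc) a' J ¬a)
    where
    map₁' : ∀ {P : ℕ → Set} → ∃ (P ∘ suc) → ∃ P
    map₁' (j , p) = suc j , p

  module Sweep {n : ℕ} (1≤n : 1 ≤ n) (Adj : Fin n → Fin n → Set) (Adj-sym : ∀ {u v} → Adj u v → Adj v u)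
    (w β : ℕ) (1≤w : 1 ≤ w) (β-small : 6 * β ≤ n * w)
    (noSplit : Haven.NoSplit 1≤n Adj Adj-sym w β 1≤w β-small)
    (m : Fin n → ℕ) (W : ℕ) (m≤W : sum m ≤ W) where

    open Haven 1≤n Adj Adj-sym w β 1≤w β-small public

    _⊆_ : Region n → Region n → Set
    S ⊆ S' = ∀ v → T (S v) → T (S' v)

    -- If no part were big, all complements would be, and so would their intersection, which is
    -- empty because the parts cover `K`.
    component : ∀ {N} (conn : Fin N → Region n) {S K} → Small S → Big S K →
      (∀ z → Closed S (K ⋂ conn z)) → (∀ v → ¬ T (S v) → T (K v) → ∃ λ z → T (conn z v)) →
      ∃ λ z → Big S (K ⋂ conn z)
    component {zero} conn s b cl cov = let v , k , sv = inhabited s b in case-⊥ (cov v sv k)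
      where
      case-⊥ : ∀ {A : Set} {P : Fin zero → Set} → ∃ P → A
      case-⊥ (() , _)
    component {suc N} conn {S} {K} s b cl cov with dichotomy noSplit s (cl zero)
    ... | inj₁ h = zero , h
    ... | inj₂ h = let z , r = component (conn ∘ suc) s (meet noSplit s b h) cl' cov' in
        suc z , up r (cl (suc z)) λ v _ t → let k , c = ∧-e {(K ⋂ ∁ (K ⋂ conn zero)) v} t in ∧-i (proj₁ (∧-e {K v} k)) c
      where
      cl' : ∀ z → Closed S ((K ⋂ ∁ (K ⋂ conn zero)) ⋂ conn (suc z))
      cl' z u v a su sv t =
        let k , c = ∧-e {(K ⋂ ∁ (K ⋂ conn zero)) u} t
            k₁ , k₂ = ∧-e {K u} k
            r₁ , r₂ = ∧-e {K v} (cl (suc z) u v a su sv (∧-i k₁ c))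
        in ∧-i (∧-i r₁ (Big.closed h u v a su sv k₂)) r₂
      cov' : ∀ v → ¬ T (S v) → T ((K ⋂ ∁ (K ⋂ conn zero)) v) → ∃ λ z → T (conn (suc z) v)
      cov' v sv t with ∧-e {K v} t
      ... | k , k' with cov v sv k
      ... | suc z , c = z , c
      ... | zero , c = ⊥-elim (not-T k' (∧-i k c))

    module _ (l : Fin n → ℕ) where

      cut : ℕ → Region n
      cut c v = near (l v) (m v) c

      above : ℕ → Region n
      above c v = c <ᵇ l v

      -- By `near-count` a vertex lies in at most `2 * m v` of the `w` cuts, so the smallest cut is
      -- no larger than the average `2 * W / w`.
      cheap-cut : ∀ a → ∃ λ c → a ≤ c × c < a + w × # (cut c) * w ≤ 2 * W
      cheap-cut a = let i , h = pigeonhole-sum 1≤w f in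
        a + toℕ i , m≤m+n a (toℕ i) , +-monoʳ-< a (toℕ<n i) , ≤-trans h total
        where
        f : Fin w → ℕ
        f i = # (cut (a + toℕ i))
        open ≤-Reasoning
        total : sum f ≤ 2 * W
        total = begin
          sum f                                                        
            ≡⟨ Sum.∑-comm {w} {n} (λ i v → bit (cut (a + toℕ i) v)) ⟩
          sum (λ v → sum (λ (i : Fin w) → bit (cut (a + toℕ i) v)))    
            ≤⟨ sum-mono (λ v → near-count w a (l v) (m v)) ⟩
          sum (λ v → 2 * m v)                                          
            ≡⟨ Sum.sum-cong-≗ (λ v → *-comm 2 (m v)) ⟩
          sum (λ v → m v * 2)                                           ≡⟨ sum-* m 2 ⟩
          sum m * 2                                                     ≤⟨ *-monoˡ-≤ 2 m≤W ⟩
          W * 2                                                         ≡⟨ *-comm W 2 ⟩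
          2 * W                                                         ∎

      module _ {S M : Region n} (b : Big S M)
        (lip : ∀ {u v} → Adj u v → ¬ T (S u) → ¬ T (S v) → T (M u) → T (M v) → l u ≤ l v + m u + m v)
        {k : ℕ} (#S : # S * w ≤ k) where

        -- An edge that leaves the upper side would drop from more than `c + m u` to at most
        -- `c - m v`, further than `lip` allows. This is why a cut removes each vertex up to its own
        -- weight on both sides.
        closed-above : ∀ c {S'} → (∀ v → T ((S ⋃ cut c) v) → T (S' v)) → Closed S' (M ⋂ above c)
        closed-above c sub u v a su sv t = ∧-i mv (<⇒<ᵇ (≰⇒> ¬lv))
          where
          su' = su ∘ sub u ∘ ∨-l
          sv' = sv ∘ sub v ∘ ∨-l
          mu = proj₁ (∧-e {M u} t)
          mv = Big.closed b u v a su' sv' mu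
          lu : c + m u < l u
          lu = near-above {l u} {m u} (su ∘ sub u ∘ ∨-r {S u}) (<ᵇ⇒< c (l u) (proj₂ (∧-e {M u} t)))
          ¬lv : ¬ l v ≤ c
          ¬lv h = go c (m u) (m v) (l u) (l v) lu (near-below {l v} {m v} (sv ∘ sub v ∘ ∨-r {S v}) h)
            (lip a su' sv' mu mv)
            where
            go : ∀ c p q x y → c + p < x → y + q ≤ c → ¬ (x ≤ y + p + q)
            go c p q x y h₁ h₂ h₃ = <-irrefl {c} refl (lin (h₁ ⊕ h₂ ⊕ h₃) 0 (solve (c ∷ p ∷ q ∷ x ∷ y ∷ [])))

        small-cut : ∀ {c} → # (cut c) * w ≤ 2 * W → k + 2 * W ≤ β → Small (S ⋃ cut c)
        small-cut {c} h hk = ≤-trans (#-cut {c} h) hk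
          where
          #-cut : ∀ {c} → # (cut c) * w ≤ 2 * W → # (S ⋃ cut c) * w ≤ k + 2 * W
          #-cut {c} h = ≤-trans (*-monoˡ-≤ w (#-⋃ S (cut c)))
            (≤-trans (≤-reflexive (*-distribʳ-+ w (# S) (# (cut c)))) (+-mono-≤ #S h))

        split : ∀ c → Small (S ⋃ cut c) → Big (S ⋃ cut c) (M ⋂ above c) ⊎ Big (S ⋃ cut c) (M ⋂ ∁ (above c))
        split c s with dichotomy noSplit s (closed-above c (λ _ → id))
        ... | inj₁ h = inj₁ h
        ... | inj₂ h = inj₂ (up (meet noSplit s bM h)
              (λ u v a su sv t → let mu , q = ∧-e {M u} t
                                     mv = Big.closed bM u v a su sv mu in
                ∧-i mv (T-not λ p → not-T q
                  (proj₂ (∧-e {M u} (closed-above c (λ _ → id) v u (Adj-sym a) sv su (∧-i mv p))))))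
              λ v sv t → let mv , q = ∧-e {M v} t in ∧-i mv (T-not λ p → not-T q (∧-i mv p)))
          where
          bM : Big (S ⋃ cut c) M
          bM = weaken (λ _ → ∨-l) b

        -- Quantified over all larger separators, since the sweep adds a cut to `S` before it asks
        -- on which side of it the big part lies.
        Deep : ℕ → Set
        Deep a = ∀ {S' P} → S ⊆ S' → Small S' → Big S' P →
          ¬ (∀ v → ¬ T (S' v) → T (P v) → T (M v) × l v ≤ a + w)

        record Outside (a k' : ℕ) : Set where
          field
            {S' M'} : Region n
            S⊆S'  : S ⊆ S'
            #S'   : # S' * w ≤ k'
            big'  : Big S' M'
            sub   : ∀ {v} → ¬ T (S' v) → T (M' v) → T (M v)
            above' : ∀ {v} → ¬ T (S' v) → T (M' v) → a + m v < l v

        private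
          not-low : ∀ {a c} → Deep a → c < a + w → Small (S ⋃ cut c) → ¬ Big (S ⋃ cut c) (M ⋂ ∁ (above c))
          not-low {a} {c} deep c< s h = deep (λ _ → ∨-l) s h λ v _ t → let mv , q = ∧-e {M v} t in
            mv , ≤-trans (≮⇒≥ λ p → not-T q (<⇒<ᵇ p)) (<⇒≤ c<)

        outside : ∀ a → Deep a → k + 2 * W ≤ β → Outside a (k + 2 * W)
        outside a deep hk with cheap-cut a
        ... | c , a≤c , c< , h with split c (small-cut h hk)
        ... | inj₂ low = ⊥-elim (not-low deep c< (small-cut h hk) low)
        ... | inj₁ b' = record
            { S⊆S' = λ _ → ∨-l
            ; #S' = ≤-trans (*-monoˡ-≤ w (#-⋃ S (cut c)))
              (≤-trans (≤-reflexive (*-distribʳ-+ w (# S) (# (cut c)))) (+-mono-≤ #S h))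
            ; big' = b'
            ; sub = λ {v} _ t → proj₁ (∧-e {M v} t)
            ; above' = λ {v} sv t → ≤-<-trans (+-monoˡ-≤ (m v) a≤c)
                (near-above {l v} {m v} (sv ∘ ∨-r {S v}) (<ᵇ⇒< c (l v) (proj₂ (∧-e {M v} t))))
            }

        record Annulus (a k' : ℕ) : Set where
          field
            {S' M'} : Region n
            lo hi : ℕ
            a≤lo  : a ≤ lo
            hi≤   : hi ≤ lo + 2 * w
            S⊆S'  : S ⊆ S'
            #S'   : # S' * w ≤ k'
            big'  : Big S' M'
            sub   : ∀ {v} → ¬ T (S' v) → T (M' v) → T (M v)
            above' : ∀ {v} → ¬ T (S' v) → T (M' v) → lo + m v < l v
            below' : ∀ {v} → ¬ T (S' v) → T (M' v) → l v + m v ≤ hi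

        -- The two cuts come from neighbouring windows of `w` levels, hence the thickness `2 * w`,
        -- and each costs `2 * W`.
        annulus-at : ∀ {a c c'} j → a + j * w ≤ c → c' < a + suc j * w + w →
          # (cut c) * w ≤ 2 * W → # (cut c') * w ≤ 2 * W → k + 4 * W ≤ β →
          Big (S ⋃ cut c) (M ⋂ above c) → Big (S ⋃ cut c') (M ⋂ ∁ (above c')) → Annulus a (k + 4 * W)
        annulus-at {a} {c} {c'} j c≥ c'< #c #c' hk bA bB = record
          { S' = U ; M' = (M ⋂ above c) ⋂ (M ⋂ ∁ (above c')) ; lo = c ; hi = c'
          ; a≤lo = ≤-trans (m≤m+n a (j * w)) c≥
          ; hi≤ = go a (j * w) w c c' c'< c≥
          ; S⊆S' = λ _ → ∨-l
          ; #S' = #U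
          ; big' = meet noSplit sU (weaken subA bA) (weaken subB bB)
          ; sub = λ {v} _ t → proj₁ (∧-e {M v} (proj₁ (∧-e {(M ⋂ above c) v} t)))
          ; above' = λ {v} sv t → near-above {l v} {m v} (sv ∘ ∨-r {S v} ∘ ∨-l)
              (<ᵇ⇒< c (l v) (proj₂ (∧-e {M v} (proj₁ (∧-e {(M ⋂ above c) v} t)))))
          ; below' = λ {v} sv t → near-below {l v} {m v} (sv ∘ ∨-r {S v} ∘ ∨-r {cut c v})
              (≮⇒≥ λ p → not-T (proj₂ (∧-e {M v} (proj₂ (∧-e {(M ⋂ above c) v} t)))) (<⇒<ᵇ p))
          }
          where
          U : Region n
          U = S ⋃ (cut c ⋃ cut c')
          #U : # U * w ≤ k + 4 * W
          #U = ≤-trans (*-monoˡ-≤ w (≤-trans (#-⋃ S _) (+-monoʳ-≤ (# S) (#-⋃ (cut c) (cut c')))))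
            (go' (# S) (# (cut c)) (# (cut c')) w k W #S #c #c')
            where
            go' : ∀ x y z w k W → x * w ≤ k → y * w ≤ 2 * W → z * w ≤ 2 * W → (x + (y + z)) * w ≤ k + 4 * W
            go' x y z w k W h₁ h₂ h₃ = lin (h₁ ⊕ h₂ ⊕ h₃) 0 (solve (x ∷ y ∷ z ∷ w ∷ k ∷ W ∷ []))
          sU : Small U
          sU = ≤-trans #U hk
          subA : (S ⋃ cut c) ⊆ U
          subA v t with Equivalence.to (T-∨ {S v}) t
          ... | inj₁ p = ∨-l p
          ... | inj₂ p = ∨-r {S v} (∨-l p)
          subB : (S ⋃ cut c') ⊆ U
          subB v t with Equivalence.to (T-∨ {S v}) t
          ... | inj₁ p = ∨-l p
          ... | inj₂ p = ∨-r {S v} (∨-r {cut c v} p)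
          go : ∀ a x w p q → q < a + (w + x) + w → a + x ≤ p → q ≤ p + 2 * w
          go a x w p q h₁ h₂ = lin (h₁ ⊕ h₂) 1 (solve (a ∷ x ∷ w ∷ p ∷ q ∷ []))

        annulus-from : ∀ a → Deep a → k + 4 * W ≤ β → (c : ℕ → ℕ) → (∀ j → a + j * w ≤ c j) →
          (∀ j → c j < a + j * w + w) → (∀ j → # (cut (c j)) * w ≤ 2 * W) → Annulus a (k + 4 * W)
        annulus-from a deep hk c c≥ c< #c =
          let j , bA , bB = first-change (λ j → split (c j) (s j)) A₀ last not-last in
          annulus-at j (c≥ j) (c< (suc j)) (#c j) (#c (suc j)) hk bA bB
          where
          s : ∀ j → Small (S ⋃ cut (c j))
          s j = small-cut (#c j) (≤-trans (+-monoʳ-≤ k (*-monoˡ-≤ W (≤ᵇ⇒≤ 2 4 _))) hk)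
          low : ¬ Big (S ⋃ cut (c 0)) (M ⋂ ∁ (above (c 0)))
          low = not-low deep (≤-trans (c< 0) (≤-reflexive (cong (_+ w) (+-identityʳ a)))) (s 0)
          A₀ : Big (S ⋃ cut (c 0)) (M ⋂ above (c 0))
          A₀ with split (c 0) (s 0)
          ... | inj₁ h = h
          ... | inj₂ h = ⊥-elim (low h)
          -- Each level is at most the sum of all levels, so nothing lies above the cut from window
          -- `sum l`, and the big side changes from above to below in some earlier window.
          last : ℕ
          last = sum l
          not-last : ¬ Big (S ⋃ cut (c last)) (M ⋂ above (c last))
          not-last h = let v , t , _ = inhabited (s last) h in
            <⇒≱ (<ᵇ⇒< (c last) (l v) (proj₂ (∧-e {M v} t)))
              (≤-trans (≤-sum l v) (≤-trans (m≤m*n last w {{>-nonZero 1≤w}})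
                (≤-trans (m≤n+m (last * w) a) (c≥ last))))

        annulus : ∀ a → Deep a → k + 4 * W ≤ β → Annulus a (k + 4 * W)
        annulus a deep hk = annulus-from a deep hk (λ j → proj₁ (cc j)) (λ j → proj₁ (proj₂ (cc j)))
          (λ j → proj₁ (proj₂ (proj₂ (cc j)))) (λ j → proj₂ (proj₂ (proj₂ (cc j))))
          where
          cc = λ j → cheap-cut (a + j * w)

  -- Chopping the big side

  T-does : ∀ {A : Set} (d : Dec A) → T (does d) → A
  T-does (yes a) _ = a

  does-T : ∀ {A : Set} (d : Dec A) → A → T (does d)
  does-T (yes _) _ = tt
  does-T (no ¬a) a = ¬a a

  -- `budget` pays for the heavy vertices, two cuts for each of `h` annuli and one cut for each of
  -- `h` points. The 52 in `spread` is twice the 24 of `far`, plus 2 for the window in which a cut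
  -- is chosen and 2 for the weights of the two end vertices.
  module Unsplittable (h : ℕ) (1≤h : 1 ≤ h) (G Ĝ : Graph) (rig : RIG Ĝ G) (1≤n : 1 ≤ order Ĝ)
    (m : V Ĝ → ℕ) (m≥1 : ∀ v → 1 ≤ m v) (W : ℕ) (m≤W : sum m ≤ W)
    (w β : ℕ) (1≤w : 1 ≤ w) (β-small : 6 * β ≤ order Ĝ * w)
    (budget : W + h * (4 * W) + h * (2 * W) ≤ β)
    (noSplit : Haven.NoSplit 1≤n (Edge Ĝ) (symm Ĝ) w β 1≤w β-small)
    (f : V Ĝ → V Ĝ → ℕ) (f-refl : ∀ v → f v v ≡ 0)
    (f-edge : ∀ v {u u'} → Edge Ĝ u u' → f v u' ≤ f v u + (m u + m u'))
    (spread : ∀ v → 3 * # (λ u → f v u ≤ᵇ 52 * (h * w)) < order Ĝ) where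

    n = order Ĝ
    open Sweep 1≤n (Edge Ĝ) (symm Ĝ) w β 1≤w β-small noSplit m W m≤W
    open RIG rig

    -- Heavy vertices get an empty region: they belong to the separator anyway, and without them no
    -- step changes a level by more than `w`.
    R : V Ĝ → V G → Set
    R v z = z ∈ region v × m v ≤ w

    open Pieces (Edge G) (symm G) R m w m≥1 proj₂

    base-point : V Ĝ → V G
    base-point v = proj₁ (nonempty v)

    base∈ : ∀ v → base-point v ∈ region v
    base∈ v = proj₂ (nonempty v)

    Inside : (V G → Set) → V Ĝ → Set
    Inside D v = ∀ {z} → z ∈ region v → D z

    region-piece : ∀ {D v y z} → m v ≤ w → Inside D v → y ∈ region v → z ∈ region v → Piece D v y z
    region-piece light ins y∈ z∈ = RT.map (λ (e , a , b) → e , ((a , light) , ins a) , ((b , light) , ins b))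
      (connected _ y∈ z∈)

    region-path : ∀ {D v y z} → m v ≤ w → Inside D v → y ∈ region v → z ∈ region v → Star (Adj D) y z
    region-path light ins y∈ z∈ = RT.map (_ ,_) (region-piece light ins y∈ z∈)

    common : ∀ {u v} → Edge Ĝ u v → ∃ λ z → z ∈ region u × z ∈ region v
    common {u} {v} e = let z , p = Equivalence.to (intersect (λ u≡v → irr Ĝ u≡v e)) e in
      z , x∈p∩q⁻ _ _ p

    module _ {D : V G → Set} {x : V G} {lev : V G → ℕ} (L : Level D x lev) where
      open Level L

      region-lip : ∀ {v y z} → m v ≤ w → Inside D v → y ∈ region v → z ∈ region v → lev z ≤ lev y + m v
      region-lip light ins y∈ z∈ = lip (y∈ , light) (ins y∈) (region-piece light ins y∈ z∈)

      edge-region-lip : ∀ {u v} → Edge Ĝ u v → m u ≤ w → m v ≤ w → Inside D u → Inside D v →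
        lev (base-point u) ≤ lev (base-point v) + m u + m v
      edge-region-lip {u} {v} e lu lv iu iv = let z , zu , zv = common e in
        go (lev (base-point u)) (lev (base-point v)) (lev z) (m u) (m v)
           (region-lip lu iu zu (base∈ u)) (region-lip lv iv (base∈ v) zv)
        where
        go : ∀ a b c p q → a ≤ c + p → c ≤ b + q → a ≤ b + p + q
        go a b c p q h₁ h₂ = lin (h₁ ⊕ h₂) 0 (solve (a ∷ b ∷ c ∷ p ∷ q ∷ []))

      -- f is the shortest-path metric on Ĝ, doubled.
      f-level : ∀ {v₀} → x ∈ region v₀ → ∀ {z u} → D z → z ∈ region u → f v₀ u ≤ 2 * lev z + (m v₀ + m u)
      f-level {v₀} x∈ {z} = loop (lev z) ≤-refl
        where
        loop : ∀ fuel {z u} → lev z ≤ fuel → D z → z ∈ region u → f v₀ u ≤ 2 * lev z + (m v₀ + m u)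
        loop fuel {z} {u} hf dz z∈ with desc dz
        ... | inj₁ refl with v₀ ≟ u
        ... | yes refl = ≤-trans (≤-reflexive (f-refl v₀)) z≤n
        ... | no v₀≢u = ≤-trans
              (f-edge v₀ (Equivalence.from (intersect v₀≢u) (z , x∈p∩q⁺ (x∈ , z∈))))
              (+-monoˡ-≤ (m v₀ + m u) {f v₀ v₀} {2 * lev x} (≤-trans (≤-reflexive (f-refl v₀)) z≤n))
        loop zero {z} hf dz z∈ | inj₂ (v , b , rz , p , hb) =
          ⊥-elim (n≮0 (≤-trans (≤-trans (m≥1 v) (m≤n+m (m v) (lev b))) (≤-trans hb hf)))
        loop (suc fuel) {z} {u} hf dz z∈ | inj₂ (v , b , rz , p , hb) with v ≟ u
        ... | yes refl = ≤-trans IH (+-monoˡ-≤ (m v₀ + m v) (*-monoʳ-≤ 2 (≤-trans (m≤m+n (lev b) (m v)) hb)))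
          where
          IH = loop fuel (≤-pred
            (≤-trans (≤-trans (≤-reflexive (+-comm 1 (lev b))) (≤-trans (+-monoʳ-≤ (lev b) (m≥1 v)) hb)) hf))
                    (proj₂ (piece-end rz dz p)) (proj₁ (proj₁ (piece-end rz dz p)))
        ... | no v≢u = go (f v₀ v) (f v₀ u) (lev b) (lev z) (m v₀) (m v) (m u) IH
                (f-edge v₀ (Equivalence.from (intersect v≢u) (z , x∈p∩q⁺ (proj₁ rz , z∈)))) hb
          where
          IH = loop fuel (≤-pred
            (≤-trans (≤-trans (≤-reflexive (+-comm 1 (lev b))) (≤-trans (+-monoʳ-≤ (lev b) (m≥1 v)) hb)) hf))
                    (proj₂ (piece-end rz dz p)) (proj₁ (proj₁ (piece-end rz dz p)))
          go : ∀ f g b z p q r → f ≤ 2 * b + (p + q) → g ≤ f + (q + r) → b + q ≤ z → g ≤ 2 * z + (p + r)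
          go f g b z p q r h₁ h₂ h₃ = lin (h₁ ⊕ h₂ ⊕ times 2 h₃) 0 (solve (f ∷ g ∷ b ∷ z ∷ p ∷ q ∷ r ∷ []))

    Heavy⊆ : Region n → Set
    Heavy⊆ S = ∀ v → ¬ T (S v) → m v ≤ w

    -- By `f-level`, a big side in the first `a + w` levels lies within doubled distance
    -- `2 * a + 4 * w` of `v₀`. Such a ball holds less than a third of Ĝ, a big side more than two
    -- thirds.
    deep : ∀ {D v₀ lev S M} → Level D (base-point v₀) lev → m v₀ ≤ w → Heavy⊆ S →
      (∀ {v} → ¬ T (S v) → T (M v) → Inside D v) → (b : Big S M) → ∀ {a} → 2 * a + 4 * w ≤ 52 * (h * w) →
      ∀ {S' P} → S ⊆ S' → Small S' → Big S' P →
      ¬ (∀ v → ¬ T (S' v) → T (P v) → T (M v) × lev (base-point v) ≤ a + w)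
    deep {D} {v₀} {lev} {S} {M} L light heavy ins b {a} ha {S'} {P} S⊆ s b' low =
      go (# Q) n (cover s b' Q inQ) (spread v₀)
      where
      Q : Region n
      Q u = f v₀ u ≤ᵇ 52 * (h * w)
      inQ : ∀ v → ¬ T (S' v) → T (P v) → T (Q v)
      inQ v sv pv = let mv , lv = low v sv pv in
        ≤⇒≤ᵇ (≤-trans (go' (f v₀ v) (lev (base-point v)) (m v₀) (m v) a w
          (f-level L (base∈ v₀) (ins (sv ∘ S⊆ v) mv (base∈ v)) (base∈ v)) lv light (heavy v (sv ∘ S⊆ v))) ha)
        where
        go' : ∀ f l p q a w → f ≤ 2 * l + (p + q) → l ≤ a + w → p ≤ w → q ≤ w → f ≤ 2 * a + 4 * w
        go' f l p q a w h₁ h₂ h₃ h₄ = lin (h₁ ⊕ times 2 h₂ ⊕ h₃ ⊕ h₄) 0 (solve (f ∷ l ∷ p ∷ q ∷ a ∷ w ∷ []))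
      go : ∀ q n → 4 * n < 6 * q → ¬ (3 * q < n)
      go q n h₁ h₂ = <-irrefl {4 * n} refl
        (lin {suc (4 * n)} {4 * n} (h₁ ⊕ times 2 h₂) (2 * n + 2) (solve (q ∷ n ∷ [])))

    -- The haven as seen from G: a connected part of G that contains the regions of the big side.
    record Core (D : V G → Set) (k : ℕ) : Set where
      field
        {S M} : Region n
        #S    : # S * w ≤ k
        heavy : Heavy⊆ S
        isBig : Big S M
        ins   : ∀ {v} → ¬ T (S v) → T (M v) → Inside D v
        hub   : V G
        conn  : ∀ {z} → D z → Star (Adj D) hub z

    star-end : ∀ {K : V G → Set} {a b} → K a → Star (Adj K) a b → K b
    star-end k ε = k
    star-end k ((_ , _ , _ , _ , k') ◅ s) = star-end k' s

    -- Regions of adjacent vertices share a point, so the vertices whose regions lie in one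
    -- component of `K` form a closed part of the big side, and `component` tells which component to
    -- keep.
    component-core : ∀ {K S M k} → # S * w ≤ k → Small S → Heavy⊆ S → Big S M →
      (∀ {v} → ¬ T (S v) → T (M v) → Inside K v) →
      ¬ ¬ (∃ λ D → Core D k × (∀ {y} → D y → K y) × (∀ {v y y'} → D y → Step K v y y' → D y'))
    component-core {K} {S} {M} {k} #S s heavy b ins ret =
      ¬¬-∀ (λ z → ¬¬-decide (λ v → Star (Adj K) z (base-point v))) decided
      where
      trace : ∀ z {a y} → Star (Adj K) z a → Star (Adj K) a y → Star (Adj (Star (Adj K) z)) a y
      trace z pre ε = ε
      trace z pre (st@(v , e , (ra , _) , (rb , _)) ◅ r) =
        (v , e , (ra , pre) , (rb , pre ◅◅ st ◅ ε)) ◅ trace z (pre ◅◅ st ◅ ε) r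

      decided : ¬ (∀ z v → Dec (Star (Adj K) z (base-point v)))
      decided dec = found (component conn s b closed λ v sv mv →
        base-point v , does-T (dec (base-point v) v) ε)
        where
        conn : V G → Region n
        conn z v = does (dec z v)
        closed : ∀ z → Closed S (M ⋂ conn z)
        closed z u v e su sv t = extend (∧-e {M u} t) (common e)
          where
          extend : T (M u) × T (conn z u) → (∃ λ y → y ∈ region u × y ∈ region v) → T ((M ⋂ conn z) v)
          extend (mu , cu) (y , yu , yv) = ∧-i mv (does-T (dec z v) (T-does (dec z u) cu
              ◅◅ region-path (heavy u su) (ins su mu) (base∈ u) yu
              ◅◅ region-path (heavy v sv) (ins sv mv) yv (base∈ v)))
            where
            mv : T (M v)
            mv = Big.closed b u v e su sv mu
        found : ¬ (∃ λ z → Big S (M ⋂ conn z))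
        found (z , bz) = result (inhabited s bz)
          where
          ins' : ∀ {v} → ¬ T (S v) → T (M v) × T (conn z v) → Inside (Star (Adj K) z) v
          ins' {v} sv (mv , c) y∈ = T-does (dec z v) c ◅◅ region-path (heavy v sv) (ins sv mv) (base∈ v) y∈
          result : ¬ (∃ λ v → T ((M ⋂ conn z) v) × ¬ T (S v))
          result (v , t , sv) = ret (Star (Adj K) z , record
              { #S = #S ; heavy = heavy ; isBig = bz
              ; ins = λ {v} sv t → ins' sv (∧-e {M v} t)
              ; hub = z
              ; conn = trace z ε
              }
            , star-end kz , λ d st → d ◅◅ (_ , st) ◅ ε)
            where
            mc = ∧-e {M v} t
            kz : K z
            kz = star-end (ins sv (proj₁ mc) (base∈ v)) (RT.reverse adj-sym (T-does (dec z v) (proj₂ mc)))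

    core-level : ∀ {D k} (C : Core D k) → k ≤ β → ¬ ¬ (∃ λ v₀ → ∃ λ lev →
      ¬ T (Core.S C v₀) × T (Core.M C v₀) × Level D (base-point v₀) lev)
    core-level {D} C k≤ ret = found (inhabited (≤-trans #S k≤) isBig)
      where
      open Core C
      found : ¬ (∃ λ v → T (M v) × ¬ T (S v))
      found (v₀ , mv , sv) = level-exists (Edge G) (symm G) R m w m≥1 proj₂ x∈
        (λ dz → RT.reverse adj-sym (conn x∈) ◅◅ conn dz) λ (lev , L) → ret (v₀ , lev , sv , mv , L)
        where
        x∈ : D (base-point v₀)
        x∈ = ins sv mv (base∈ v₀)

    w≤hw : w ≤ h * w
    w≤hw = ≤-trans (≤-reflexive (sym (*-identityˡ w))) (*-monoˡ-≤ w 1≤h)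

    module _ {D k} (C : Core D k) {v₀ lev} (L : Level D (base-point v₀) lev) where
      open Core C

      private
        l : V Ĝ → ℕ
        l v = lev (base-point v)

      core-lip : ∀ {u v} → Edge Ĝ u v → ¬ T (S u) → ¬ T (S v) → T (M u) → T (M v) → l u ≤ l v + m u + m v
      core-lip e su sv mu mv = edge-region-lip L e (heavy _ su) (heavy _ sv) (ins su mu) (ins sv mv)

      -- The cuts have removed every vertex whose base point is within its own weight of a boundary
      -- level. The remaining regions therefore lie in the annulus as a whole, not only with their
      -- base points.
      annulus-round : ∀ {k'} → k' ≤ β → Annulus l isBig core-lip #S (7 * w) k' →
        ¬ ¬ (∃ λ D' → Core D' k' × Round D D')
      annulus-round {k'} hk A ret = component-core A.#S' (≤-trans A.#S' hk) light' A.big' insK result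
        where
        module A = Annulus A
        K : V G → Set
        K y = D y × A.lo < lev y × lev y ≤ A.hi
        light' : Heavy⊆ A.S'
        light' v sv = heavy v (sv ∘ A.S⊆S' v)
        insK : ∀ {v} → ¬ T (A.S' v) → T (A.M' v) → Inside K v
        insK {v} sv mv {z} z∈ = ins' z∈
          , +-cancelʳ-< (m v) A.lo (lev z)
            (<-≤-trans (A.above' sv mv) (region-lip L (light' v sv) ins' z∈ (base∈ v)))
          , ≤-trans (region-lip L (light' v sv) ins' (base∈ v) z∈) (A.below' sv mv)
          where
          ins' : Inside D v
          ins' = ins (sv ∘ A.S⊆S' v) (A.sub sv mv)
        -- The subtraction is exact, because the sweep starts at level `7 * w`.
        e = A.lo ∸ 7 * w
        lo≡ : e + 7 * w ≡ A.lo
        lo≡ = m∸n+n≡m A.a≤lo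
        result : ¬ (∃ λ D' → Core D' k' × (∀ {y} → D' y → K y) × (∀ {v y y'} → D' y → Step K v y y' → D' y'))
        result (D' , C' , sub , closed) = ret (D' , C' , record
          { level = L ; e = e ; u = A.hi
          ; u≤ = go A.hi A.lo e w A.hi≤ lo≡
          ; sub = λ {y} d → let dy , lo , hi = sub d in dy , subst (_< lev y) (sym lo≡) lo , hi
          ; closed = λ { {y' = y'} d' (eq , (ra , da) , (rb , db)) lo hi →
              closed d' (eq , (ra , sub d') , (rb , db , subst (_< lev y') lo≡ lo , hi)) }
          })
          where
          go : ∀ hi lo e w → hi ≤ lo + 2 * w → e + 7 * w ≡ lo → hi ≤ e + 9 * w
          go hi lo e w h refl = lin h 0 (solve (hi ∷ e ∷ w ∷ []))

    round : ∀ {D k} → Core D k → k + 4 * W ≤ β → ¬ ¬ (∃ λ D' → Core D' (k + 4 * W) × Round D D')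
    round {D} {k} C hk ret = core-level C (≤-trans (m≤m+n k _) hk) λ (v₀ , lev , sv₀ , mv₀ , L) →
      annulus-round C L hk (annulus _ isBig (core-lip C L) #S (7 * w)
        (deep L (heavy v₀ sv₀) heavy ins isBig {7 * w} (go w (h * w) w≤hw)) hk) ret
      where
      open Core C
      go : ∀ w hw → w ≤ hw → 2 * (7 * w) + 4 * w ≤ 52 * hw
      go w hw h = lin (times 18 h) (34 * hw) (solve (w ∷ hw ∷ []))

    rounds : ∀ r {i D₀ D k} → Chain D₀ i D → Core D k → k + r * (4 * W) + h * (2 * W) ≤ β →
      ¬ ¬ (∃ λ D' → ∃ λ k' → Chain D₀ (r + i) D' × Core D' k' × k' + h * (2 * W) ≤ β)
    rounds zero {k = k} ch C hk ret =
      ret (_ , _ , ch , C , ≤-trans (≤-reflexive (cong (_+ h * (2 * W)) (sym (+-identityʳ k)))) hk)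
    rounds (suc r) {i} {D₀} {k = k} ch C hk ret =
      round C (≤-trans (≤-trans (+-monoʳ-≤ k (m≤m+n (4 * W) _)) (m≤m+n _ _)) hk)
      λ (D' , C' , rd) → rounds r (ch ▷ rd) C'
        (≤-trans (≤-reflexive (cong (_+ h * (2 * W)) (+-assoc k (4 * W) (r * (4 * W))))) hk)
        λ (D'' , k' , ch' , C'' , hk') →
          ret (D'' , k' , subst (λ j → Chain D₀ j D'') (+-suc r i) ch' , C'' , hk')

    -- A tail moves by at most 12w per round, so tails from points at distance
    -- more than 24hw are disjoint.
    far : ℕ
    far = 2 * (h * (12 * w))

    -- Distances are taken in `D₀`, the set before all rounds, because the tails leave `D` on their
    -- way down. `remote` keeps the rest of the big side far from the points chosen so far, so that
    -- the next point may be the base point of any vertex there.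
    record Points (D₀ D : V G → Set) (k j : ℕ) : Set where
      field
        {S M} : Region n
        #S    : # S * w ≤ k
        heavy : Heavy⊆ S
        isBig : Big S M
        ins   : ∀ {v} → ¬ T (S v) → T (M v) → Inside D v
        p     : Fin j → V G
        p∈    : ∀ a → D (p a)
        p-far : ∀ {a b} → a ≢ b → ¬ Reach D₀ (p a) far (p b)
        remote : ∀ a {v} → ¬ T (S v) → T (M v) → ∀ {z} → z ∈ region v → ¬ Reach D₀ (p a) far z

    points-core : ∀ {D₀ D k j} → Core D₀ k → (∀ {y} → D y → D₀ y) → ∀ {k'} → Points D₀ D k' j → Core D₀ k'
    points-core C D⊆ P = record
      { #S = #S ; heavy = heavy ; isBig = isBig ; ins = λ sv mv z∈ → D⊆ (ins sv mv z∈)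
      ; hub = Core.hub C ; conn = Core.conn C }
      where open Points P

    new-point : ∀ {D₀ D k₀ k j} → Core D₀ k₀ → (∀ {y} → D y → D₀ y) → Points D₀ D k j → k + 2 * W ≤ β →
      ¬ ¬ Points D₀ D (k + 2 * W) (suc j)
    new-point {D₀} {D} {k = k} {j} C₀ D⊆ P hk ret =
      core-level (points-core C₀ D⊆ P) (≤-trans (m≤m+n k _) hk) λ (v₀ , lev , sv₀ , mv₀ , L) →
        ret (add sv₀ mv₀ L (outside _ isBig (core-lip C L) #S far
          (deep L (heavy v₀ sv₀) heavy (Core.ins C) isBig {far} (go h w (h * w) refl w≤hw)) hk))
      where
      open Points P
      C = points-core C₀ D⊆ P
      add : ∀ {v₀ lev k'} → ¬ T (S v₀) → T (M v₀) → (L : Level D₀ (base-point v₀) lev) →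
        Outside (λ v → lev (base-point v)) isBig (core-lip C L) #S far k' → Points D₀ D k' (suc j)
      add {v₀} {lev} sv₀ mv₀ L O = record
        { #S = O.#S' ; heavy = λ v sv → heavy v (sv ∘ O.S⊆S' v) ; isBig = O.big'
        ; ins = λ {v} sv mv → ins (sv ∘ O.S⊆S' v) (O.sub sv mv)
        ; p = p' ; p∈ = λ { zero → ins sv₀ mv₀ (base∈ v₀) ; (suc a) → p∈ a }
        ; p-far = λ {a} {b} → p-far' a b
        ; remote = λ { zero sv mv → remote-new sv mv
                     ; (suc a) {v} sv mv → remote a (sv ∘ O.S⊆S' v) (O.sub sv mv) }
        }
        where
        module O = Outside O
        remote-new : ∀ {v} → ¬ T (O.S' v) → T (O.M' v) → ∀ {z} → z ∈ region v →
          ¬ Reach D₀ (base-point v₀) far z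
        remote-new {v} sv mv {z} z∈ r = <⇒≱ (O.above' sv mv)
          (≤-trans (region-lip L (heavy v (sv ∘ O.S⊆S' v)) (Core.ins C (sv ∘ O.S⊆S' v) (O.sub sv mv)) z∈
            (base∈ v))
            (+-monoˡ-≤ (m v) (≤-trans (Level.reach-lip L id r) (≤-reflexive (cong (_+ far) (Level.root L))))))
        p' : Fin (suc j) → V G
        p' zero = base-point v₀
        p' (suc a) = p a
        p-far' : ∀ a b → a ≢ b → ¬ Reach D₀ (p' a) far (p' b)
        p-far' zero zero a≢b = λ _ → a≢b refl
        p-far' zero (suc b) _ r = remote b sv₀ mv₀ (base∈ v₀) (reach-sym r)
        p-far' (suc a) zero _ r = remote a sv₀ mv₀ (base∈ v₀) r
        p-far' (suc a) (suc b) a≢b = p-far (a≢b ∘ cong suc)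
      go : ∀ h w hw → h * w ≡ hw → w ≤ hw → 2 * (2 * (h * (12 * w))) + 4 * w ≤ 52 * hw
      go h w hw refl le = lin (times 4 le) 0 (solve (h ∷ w ∷ []))

    points : ∀ r {D₀ D k₀ k j} → Core D₀ k₀ → (∀ {y} → D y → D₀ y) → Points D₀ D k j → k + r * (2 * W) ≤ β →
      ¬ ¬ (∃ λ k' → Points D₀ D k' (r + j))
    points zero C₀ D⊆ P hk ret = ret (_ , P)
    points (suc r) {D₀} {D} {k = k} {j = j} C₀ D⊆ P hk ret =
      new-point C₀ D⊆ P (≤-trans (+-monoʳ-≤ k (m≤m+n (2 * W) _)) hk)
      λ P' → points r C₀ D⊆ P' (≤-trans (≤-reflexive (+-assoc k (2 * W) (r * (2 * W)))) hk)
        λ (k' , P'') → ret (k' , subst (Points D₀ D k') (+-suc r j) P'')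

    heavy-set : Region n
    heavy-set v = w <ᵇ m v

    #heavy : # heavy-set * w ≤ W
    #heavy = ≤-trans (≤-reflexive (sym (sum-* (λ v → bit (heavy-set v)) w))) (≤-trans (sum-mono pt) m≤W)
      where
      pt : ∀ v → bit (heavy-set v) * w ≤ m v
      pt v with w <ᵇ m v in eq
      ... | false = z≤n
      ... | true = ≤-trans (≤-reflexive (*-identityˡ w)) (<⇒≤ (<ᵇ⇒< w (m v) (subst T (sym eq) tt)))

    has-minor : ¬ ¬ Minor (complete h) G
    has-minor ret =
      component-core {λ _ → ⊤} #heavy (≤-trans #heavy (≤-trans (m≤m+n W _) (≤-trans (m≤m+n _ _) budget)))
        (λ v sv → ≮⇒≥ λ p → sv (<⇒<ᵇ p)) whole (λ _ _ _ → tt) λ (D₀ , C₀ , _) →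
      rounds h base C₀ budget λ (D , k , ch , C , hk) →
      points h C₀ (chain-sub ch) (record
        { #S = Core.#S C ; heavy = Core.heavy C ; isBig = Core.isBig C ; ins = Core.ins C
        ; p = λ () ; p∈ = λ () ; p-far = λ { {()} } ; remote = λ () }) hk λ (_ , P) →
      let ch' = subst (λ j → Chain D₀ j D) (+-identityʳ h) ch
          P' = subst (Points D₀ D _) (+-identityʳ h) P
          open Points P'
      in minor (system⇒model {G = G} R m w m≥1 proj₂ (system ch' p p∈) p-far) ret
      where
      whole : Big heavy-set (λ _ → true)
      whole = big (λ _ _ _ _ _ _ → tt)
        (≤-trans (s≤s (≤-trans (*-monoʳ-≤ 6 (#-mono {P = ∁ heavy-set ⋂ ∁ (λ _ → true)} {λ _ → false}
        λ v t → proj₂ (∧-e {not (heavy-set v)} t)))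
          (≤-reflexive (trans (cong (6 *_) (#-none {n})) (*-zeroʳ 6))))) 1≤n)

  -- Observables

  module Weighted (G : Graph) (m : V G → ℕ) where

    -- Twice the length of a walk, to avoid the halves in the length of an edge.
    cost : ∀ {u v} → Walk G u v → ℕ
    cost ε = 0
    cost (_◅_ {i = u} {j = w} _ p) = m u + m w + cost p

    cost-◅◅ : ∀ {u v w} (p : Walk G u v) (q : Walk G v w) → cost (p ◅◅ q) ≡ cost p + cost q
    cost-◅◅ ε q = refl
    cost-◅◅ (_◅_ {i = u} {j = w} e p) q = trans (cong (m u + m w +_) (cost-◅◅ p q))
      (sym (+-assoc (m u + m w) _ _))

    sum-< : ∀ {n} {f g : Fin n → ℕ} → (∀ i → f i ≤ g i) → ∀ i → f i < g i → sum f < sum g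
    sum-< h zero lt = +-mono-<-≤ lt (sum-mono (h ∘ suc))
    sum-< h (suc i) lt = +-mono-≤-< (h zero) (sum-< (h ∘ suc) i lt)

    -- These walks are shortest: adding up `lip` along any walk from `v` to `x` bounds
    -- `cost (path x)` by its cost. Walks are kept, and not just their costs, because the lower
    -- bound `spread` speaks of walks.
    record Potential (v : V G) : Set where
      field
        path : ∀ x → Walk G v x
        root : cost (path v) ≡ 0
        lip  : ∀ {x y} → Edge G x y → cost (path y) ≤ cost (path x) + (m x + m y)

    -- Bellman–Ford relaxation of the given walks.
    relax : (∀ u v → Walk G u v) → ∀ v → Potential v
    relax walk v = <-rec _ go _ init init-root refl
      where
      go : ∀ t → (∀ {t'} → t' < t → (path : ∀ x → Walk G v x) → cost (path v) ≡ 0 →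
        sum (cost ∘ path) ≡ t' → Potential v) →
           (path : ∀ x → Walk G v x) → cost (path v) ≡ 0 → sum (cost ∘ path) ≡ t → Potential v
      go t rec path root refl
        with any? (λ x → any? (λ y → edge? G x y ×-dec (cost (path x) + (m x + m y) <? cost (path y))))
      ... | no ¬h = record { path = path ; root = root ; lip = λ e → ≮⇒≥ λ lt → ¬h (_ , _ , e , lt) }
      ... | yes (x , y , e , lt) = rec (sum-< smaller y strict) path' root' refl
        where
        path' : ∀ z → Walk G v z
        path' z with z ≟ y
        ... | yes refl = path x ◅◅ e ◅ ε
        ... | no _ = path z
        shorter : cost (path x ◅◅ e ◅ ε) < cost (path y)
        shorter = subst (_< cost (path y)) (sym (trans (cost-◅◅ (path x) (e ◅ ε))
          (cong (cost (path x) +_) (+-identityʳ (m x + m y))))) lt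
        smaller : ∀ z → cost (path' z) ≤ cost (path z)
        smaller z with z ≟ y
        ... | yes refl = <⇒≤ shorter
        ... | no _ = ≤-refl
        strict : cost (path' y) < cost (path y)
        strict with y ≟ y
        ... | yes refl = shorter
        ... | no y≢y = ⊥-elim (y≢y refl)
        root' : cost (path' v) ≡ 0
        root' = n≤0⇒n≡0 (≤-trans (smaller v) (≤-reflexive root))
      init : ∀ x → Walk G v x
      init x with v ≟ x
      ... | yes refl = ε
      ... | no _ = walk v x
      init-root : cost (init v) ≡ 0
      init-root with v ≟ v
      ... | yes refl = refl
      ... | no v≢v = ⊥-elim (v≢v refl)

  -- Up to pointwise equality there are finitely many Boolean functions; requiring `Q` to respect
  -- that equality replaces function extensionality.
  region? : ∀ {n} (Q : Region n → Set) → (∀ P → Dec (Q P)) →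
    (∀ {P P'} → (∀ v → P v ≡ P' v) → Q P → Q P') → Dec (∃ Q)
  region? {zero} Q dec resp = map′ (λ q → _ , q) (λ (P , q) → resp (λ ()) q) (dec λ ())
  region? {suc n} Q dec resp = join (try true) (try false)
    where
    _∷ʳ_ : Bool → Region n → Region (suc n)
    (b ∷ʳ P) zero = b
    (b ∷ʳ P) (suc v) = P v
    try : ∀ b → Dec (∃ λ P → Q (b ∷ʳ P))
    try b = region? (λ P → Q (b ∷ʳ P)) (λ P → dec (b ∷ʳ P)) λ eq → resp λ { zero → refl ; (suc v) → eq v }
    join : Dec (∃ λ P → Q (true ∷ʳ P)) → Dec (∃ λ P → Q (false ∷ʳ P)) → Dec (∃ Q)
    join (yes (P , q)) _ = yes (_ , q)
    join (no _) (yes (P , q)) = yes (_ , q)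
    join (no ¬t) (no ¬f) = no λ (P , q) → excluded P q
      where
      excluded : ∀ P → ¬ Q P
      excluded P q with P zero in eq
      ... | true = ¬t (P ∘ suc , resp (λ { zero → eq ; (suc v) → refl }) q)
      ... | false = ¬f (P ∘ suc , resp (λ { zero → eq ; (suc v) → refl }) q)

  ∑∑ : ∀ {n} → (Fin n → Fin n → ℕ) → ℕ
  ∑∑ F = sum λ x → sum λ y → F x y

  variation : ∀ {n} → (Fin n → ℕ) → ℕ
  variation f = ∑∑ λ x y → ∣ f x - f y ∣

  -- More than 36 · 104 · 168, as needed by uniform below.
  C₀ : ℕ
  C₀ = 1000000

  -- A rescaled weight g / D and a rescaled Lipschitz function f / 2D.
  record Observable (G : Graph) (h s : ℕ) : Set where
    field
      g f : V G → ℕ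
      D   : ℕ
      1≤D : 1 ≤ D
      ∑g≤ : sum g ≤ D * order G
      lip : ∀ {x y} → Edge G x y → f x ≤ f y + (g x + g y)
      large : 2 * D * (order G * order G) * suc s < variation f * (h * h * C₀)

  product-count : ∀ {n} (P Q : Region n) (t : ℕ) (f : Fin n → ℕ) →
    (∀ x y → T (P x) → T (Q y) → t ≤ ∣ f x - f y ∣) → # P * # Q * t ≤ variation f
  product-count P Q t f h = begin
    # P * # Q * t                                ≡⟨ *-assoc (# P) (# Q) t ⟩
    # P * (# Q * t)                              ≡⟨ sum-* (bit ∘ P) (# Q * t) ⟨
    sum (λ x → bit (P x) * (# Q * t))            ≤⟨ sum-mono row ⟩
    variation f                                  ∎
    where
    open ≤-Reasoning
    row : ∀ x → bit (P x) * (# Q * t) ≤ sum (λ y → ∣ f x - f y ∣)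
    row x with P x in eq
    ... | false = z≤n
    ... | true = begin
      # Q * t + 0                  ≡⟨ +-identityʳ _ ⟩
      # Q * t                      ≡⟨ sum-* (bit ∘ Q) t ⟨
      sum (λ y → bit (Q y) * t)    ≤⟨ sum-mono entry ⟩
      sum (λ y → ∣ f x - f y ∣)    ∎
      where
      entry : ∀ y → bit (Q y) * t ≤ ∣ f x - f y ∣
      entry y with Q y in eq'
      ... | false = z≤n
      ... | true = ≤-trans (≤-reflexive (+-identityʳ t)) (h x y (subst T (sym eq) tt) (subst T (sym eq') tt))

  -- Only the pairs from `P` to `Q` are counted, at least one in 36 of all ordered pairs.
  halves : ∀ {n} (P Q : Region n) (t : ℕ) (f : Fin n → ℕ) → n ≤ 6 * # P → n ≤ 6 * # Q →
    (∀ x y → T (P x) → T (Q y) → t ≤ ∣ f x - f y ∣) → n * n * t ≤ 36 * variation f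
  halves {n} P Q t f hP hQ h = ≤-trans (*-monoˡ-≤ t (*-mono-≤ hP hQ))
    (≤-trans (≤-reflexive (go (# P) (# Q) t)) (times 36 (product-count P Q t f h)))
    where
    go : ∀ p q t → 6 * p * (6 * q) * t ≡ 36 * (p * q * t)
    go p q t = solve (p ∷ q ∷ t ∷ [])

  division-bounds : ∀ s k .{{_ : NonZero k}} → s / k * k ≤ s × s < suc (s / k) * k
  division-bounds s k = m/n*n≤m s k ,
    subst (_< suc (s / k) * k) (sym (m≡m%n+[m/n]*n s k)) (+-monoˡ-< (s / k * k) (m%n<n s k))

  #-initial : ∀ {n} k → k ≤ n → # {n} (λ x → toℕ x <ᵇ k) ≡ k
  #-initial {n} zero h = #-none {n}
  #-initial {suc n} (suc k) (s≤s h) = cong suc (#-initial k h)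

  #-∁ : ∀ {n} (P : Region n) → n ≤ # P + # (∁ P)
  #-∁ {n} P = ≤-trans (≤-reflexive (sym (#-all {n}))) (#-cover₂ {P = λ _ → true} {P} {∁ P} λ v _ → pt v)
    where
    pt : ∀ v → T (P v) ⊎ T (not (P v))
    pt v with P v
    ... | true = inj₁ tt
    ... | false = inj₂ tt

  -- Observables for integer weights

  module Discrete (h : ℕ) (1≤h : 1 ≤ h) (G Ĝ : Graph) (rig : RIG Ĝ G) (no-minor : ¬ Minor (complete h) G)
    (walk : ∀ u v → Walk Ĝ u v) (2≤n : 2 ≤ order Ĝ)
    (m : V Ĝ → ℕ) (m≥1 : ∀ v → 1 ≤ m v) (m≤4n : sum m ≤ 4 * order Ĝ) (s : ℕ)
    (spread : ∀ v (p : ∀ x → Walk Ĝ v x) → s * order Ĝ ≤ sum (λ x → Weighted.cost Ĝ m (p x))) where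

    open Weighted Ĝ m
    n = order Ĝ

    1≤n : 1 ≤ n
    1≤n = ≤-trans (s≤s z≤n) 2≤n

    1≤h² : 1 ≤ h * h
    1≤h² = *-mono-≤ 1≤h 1≤h

    n² : ∀ {a b} → a < b → n * n * a < n * n * b
    n² lt = *-monoʳ-< (n * n) {{>-nonZero (*-mono-≤ 1≤n 1≤n)}} lt

    -- For s of order h² any two halves of Ĝ with the uniform weight do.
    uniform : s < 104 * h * (168 * h) → Observable Ĝ h s
    uniform hs = record
      { g = λ _ → 1 ; f = f ; D = 1 ; 1≤D = ≤-refl
      ; ∑g≤ = ≤-reflexive (trans (sum-const n 1) (*-comm n 1))
      ; lip = λ {x} _ → ≤-trans (f≤2 x) (m≤n+m 2 _)
      ; large = *-cancelˡ-< 36 _ _ (≤-<-trans (≤-reflexive (e₁ n s)) (<-≤-trans (n² (e₂ h s hs 1≤h²)) e₃))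
      }
      where
      half = ⌊ n /2⌋
      P : Region n
      P x = toℕ x <ᵇ half
      f : V Ĝ → ℕ
      f x = if P x then 2 else 0
      f≤2 : ∀ x → f x ≤ 2
      f≤2 x with P x
      ... | true = ≤-refl
      ... | false = z≤n
      diff : ∀ x y → T (P x) → T (∁ P y) → 2 ≤ ∣ f x - f y ∣
      diff x y p q with P x | P y
      ... | true | false = ≤-refl
      half≤ : half ≤ n
      half≤ = ⌊n/2⌋≤n n
      n≤6half : n ≤ 6 * half
      n≤6half = go n half (≤-trans (≤-reflexive (sym (⌊n/2⌋+⌈n/2⌉≡n n))) (+-monoʳ-≤ half (⌈n/2⌉≤ n)))
        (⌊n/2⌋-mono 2≤n)
        where
        ⌈n/2⌉≤ : ∀ n → ⌈ n /2⌉ ≤ suc ⌊ n /2⌋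
        ⌈n/2⌉≤ zero = z≤n
        ⌈n/2⌉≤ (suc zero) = ≤-refl
        ⌈n/2⌉≤ (suc (suc n)) = s≤s (⌈n/2⌉≤ n)
        go : ∀ n k → n ≤ k + suc k → 1 ≤ k → n ≤ 6 * k
        go n k h₁ h₂ = lin (h₁ ⊕ h₂) (3 * k) (solve (n ∷ k ∷ []))
      #P : n ≤ 6 * # P
      #P = subst (λ k → n ≤ 6 * k) (sym (#-initial half half≤)) n≤6half
      #Q : n ≤ 6 * # (∁ P)
      #Q = go n half (# (∁ P)) (subst (λ k → n ≤ k + # (∁ P)) (#-initial half half≤) (#-∁ P))
        (≤-trans (+-monoʳ-≤ half (⌊n/2⌋≤⌈n/2⌉ n)) (≤-reflexive (⌊n/2⌋+⌈n/2⌉≡n n)))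
        where
        go : ∀ n k q → n ≤ k + q → k + k ≤ n → n ≤ 6 * q
        go n k q h₁ h₂ = lin (times 2 h₁ ⊕ h₂) (4 * q) (solve (n ∷ k ∷ q ∷ []))
      T≥ : n * n * 2 ≤ 36 * variation f
      T≥ = halves P (∁ P) 2 f #P #Q diff
      e₁ : ∀ n s → 36 * (2 * 1 * (n * n) * suc s) ≡ n * n * (72 * suc s)
      e₁ n s = solve (n ∷ s ∷ [])
      e₂ : ∀ h s → s < 104 * h * (168 * h) → 1 ≤ h * h → 72 * suc s < 2 * (h * h * C₀)
      e₂ h s h₁ h₂ = go (h * h) s (subst (s <_) (reorder h) h₁) h₂
        where
        reorder : ∀ h → 104 * h * (168 * h) ≡ 17472 * (h * h)
        reorder h = gen 104 168 h
          where
          gen : ∀ a b h → a * h * (b * h) ≡ a * b * (h * h)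
          gen a b h = solve (a ∷ b ∷ h ∷ [])
        go : ∀ q s → s < 17472 * q → 1 ≤ q → 72 * suc s < 2 * (q * 1000000)
        go q s h₁ h₂ = lin (times 72 h₁ ⊕ h₂) (742015 * q) (solve (q ∷ s ∷ []))
      e₃ : n * n * (2 * (h * h * C₀)) ≤ 36 * (variation f * (h * h * C₀))
      e₃ = go (n * n) (h * h * C₀) (variation f) T≥
        where
        go : ∀ q H T → q * 2 ≤ 36 * T → q * (2 * H) ≤ 36 * (T * H)
        go q H T h = ≤-trans (≤-reflexive (sym (*-assoc q 2 H)))
          (≤-trans (*-monoˡ-≤ H h) (≤-reflexive (*-assoc 36 T H)))

    module _ (v : V Ĝ) (pot : Potential v) where
      open Potential pot

      -- The cost from `v` averages at least `s`, so its excess over `r` averages at least `s / 2`.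
      -- Each vertex differs by its excess from every vertex of the ball, which is a third of all.
      -- `D = 4` normalises the weight `m`.
      concentrated : ∀ r → 2 * r ≤ s → 1 ≤ s → n ≤ 3 * # (λ x → cost (path x) ≤ᵇ r) → Observable Ĝ h s
      concentrated r 2r≤s 1≤s hB = record
        { g = m ; f = f ; D = 4 ; 1≤D = s≤s z≤n ; ∑g≤ = m≤4n
        ; lip = λ {x} {y} e → ≤-trans (lip (symm Ĝ e)) (≤-reflexive (cong (f y +_) (+-comm (m y) (m x))))
        ; large = *-cancelˡ-< 6 _ _
          (≤-<-trans (≤-reflexive (e₁ n s)) (<-≤-trans (n² (e₂ (h * h) s 1≤h² 1≤s)) e₃))
        }
        where
        f : V Ĝ → ℕ
        f x = cost (path x)
        B : Region n
        B x = f x ≤ᵇ r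
        Z = sum (λ x → f x ∸ r)
        row : ∀ x → # B * (f x ∸ r) ≤ sum (λ y → ∣ f x - f y ∣)
        row x = ≤-trans (≤-reflexive (sym (sum-* (bit ∘ B) (f x ∸ r)))) (sum-mono entry)
          where
          entry : ∀ y → bit (B y) * (f x ∸ r) ≤ ∣ f x - f y ∣
          entry y with f y ≤ᵇ r in eq
          ... | false = z≤n
          ... | true = ≤-trans (≤-reflexive (+-identityʳ (f x ∸ r)))
            (≤-trans (∸-monoʳ-≤ (f x) (≤ᵇ⇒≤ (f y) r (subst T (sym eq) tt))) (m∸n≤∣m-n∣ (f x) (f y)))
        rows : Z * # B ≤ variation f
        rows = ≤-trans (≤-reflexive (trans (sym (sum-* (λ x → f x ∸ r) (# B)))
          (Sum.sum-cong-≗ (λ x → *-comm (f x ∸ r) (# B))))) (sum-mono row)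
        Z≥ : s * n ≤ Z + n * r
        Z≥ = ≤-trans (spread v path) (≤-trans (sum-mono (λ x → m≤m∸n+n (f x) r))
          (≤-reflexive (trans (sum-+ (λ x → f x ∸ r) (λ _ → r)) (cong (Z +_) (sum-const n r)))))
          where
          m≤m∸n+n : ∀ a b → a ≤ a ∸ b + b
          m≤m∸n+n a b = ≤-trans (m≤n+m∸n a b) (≤-reflexive (+-comm b (a ∸ b)))
        2Z≥ : s * n ≤ 2 * Z
        2Z≥ = go s n Z r Z≥ (*-monoʳ-≤ n 2r≤s)
          where
          go : ∀ s n Z r → s * n ≤ Z + n * r → n * (2 * r) ≤ n * s → s * n ≤ 2 * Z
          go s n Z r h₁ h₂ = lin (times 2 h₁ ⊕ h₂) 0 (solve (s ∷ n ∷ Z ∷ r ∷ []))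
        V≥ : n * n * s ≤ 6 * variation f
        V≥ = go n (# B) Z s (variation f) (*-mono-≤ hB 2Z≥) rows
          where
          go : ∀ n b Z s V → n * (s * n) ≤ 3 * b * (2 * Z) → Z * b ≤ V → n * n * s ≤ 6 * V
          go n b Z s V h₁ h₂ = lin (h₁ ⊕ times 6 h₂) 0 (solve (n ∷ b ∷ Z ∷ s ∷ V ∷ []))
        e₁ : ∀ n s → 6 * (2 * 4 * (n * n) * suc s) ≡ n * n * (48 * suc s)
        e₁ n s = solve (n ∷ s ∷ [])
        e₂ : ∀ q s → 1 ≤ q → 1 ≤ s → 48 * suc s < s * (q * C₀)
        e₂ q s h₁ h₂ = <-≤-trans (go s h₂) (*-monoʳ-≤ s (*-monoˡ-≤ C₀ h₁))
          where
          go : ∀ s → 1 ≤ s → 48 * suc s < s * 1000000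
          go s h = lin (times 49 h) (999903 * s) (solve (s ∷ []))
        e₃ : n * n * (s * (h * h * C₀)) ≤ 6 * (variation f * (h * h * C₀))
        e₃ = go (n * n) (h * h * C₀) (variation f) V≥
          where
          go : ∀ q H T → q * s ≤ 6 * T → q * (s * H) ≤ 6 * (T * H)
          go q H T h = ≤-trans (≤-reflexive (sym (*-assoc q s H)))
            (≤-trans (*-monoˡ-≤ H h) (≤-reflexive (*-assoc 6 T H)))

    module _ (w : ℕ) (1≤w : 1 ≤ w) (w-large : 168 * h ≤ w) (s< : s < suc w * (104 * h)) where

      -- The budget `W + h * (4 * W) + h * (2 * W)` is at most `7 * h * W`, with `W = 4 * n`. A
      -- separator may hold at most a sixth of the vertices, and `6 * 28` is the 168 in `w-large`.
      β : ℕ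
      β = 28 * h * n

      β-small : 6 * β ≤ n * w
      β-small = ≤-trans (≤-reflexive (go h n)) (*-monoʳ-≤ n w-large)
        where
        go : ∀ h n → 6 * (28 * h * n) ≡ n * (168 * h)
        go h n = solve (h ∷ n ∷ [])

      open Haven 1≤n (Edge Ĝ) (symm Ĝ) w β 1≤w β-small

      Even : Region n → Region n → Set
      Even S P = Closed S P × Small S × n ≤ 6 * # (∁ S ⋂ P) × n ≤ 6 * # (∁ S ⋂ ∁ P)

      even? : ∀ S P → Dec (Even S P)
      even? S P = all? (λ u → all? λ v → edge? Ĝ u v →-dec ¬? (T? (S u)) →-dec ¬? (T? (S v)) →-dec T?
        (P u) →-dec T? (P v))
        ×-dec (# S * w ≤? β) ×-dec (n ≤? 6 * # (∁ S ⋂ P)) ×-dec (n ≤? 6 * # (∁ S ⋂ ∁ P))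

      even-resp : ∀ {S S' P P'} → (∀ v → S v ≡ S' v) → (∀ v → P v ≡ P' v) → Even S P → Even S' P'
      even-resp {S} {S'} {P} {P'} eS eP (c , s , a , b) =
        (λ u v e su sv p → subst T (eP v)
          (c u v e (su ∘ subst T (eS u)) (sv ∘ subst T (eS v)) (subst T (sym (eP u)) p))) ,
        subst (λ k → k * w ≤ β) (#-cong eS) s ,
        subst (λ k → n ≤ 6 * k) (#-cong (λ v → cong₂ (λ x y → not x ∧ y) (eS v) (eP v))) a ,
        subst (λ k → n ≤ 6 * k) (#-cong (λ v → cong₂ (λ x y → not x ∧ not y) (eS v) (eP v))) b
        where
        #-cong : ∀ {A B : Region n} → (∀ v → A v ≡ B v) → # A ≡ # B
        #-cong e = Sum.sum-cong-≗ (λ v → cong bit (e v))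

      -- Weight `w` on `S` lets `f` rise from 0 on one side to `w` on `S` and `2 * w` on the other;
      -- by `Closed` no edge joins the two sides directly. `Small` bounds the total weight by
      -- `28 * h * n`, whence `D`.
      separated : ∀ {S P} → Even S P → Observable Ĝ h s
      separated {S} {P} (closed , small , hP , hQ) = record
        { g = g ; f = f ; D = 28 * h ; 1≤D = ≤-trans 1≤h (m≤n*m h 28)
        ; ∑g≤ = ≤-trans (≤-reflexive (trans (Sum.sum-cong-≗ g≡) (sum-* (bit ∘ S) w))) small
        ; lip = λ {x} {y} → lip x y
        ; large = *-cancelˡ-< 36 _ _
          (≤-<-trans (≤-reflexive (e₁ n s h)) (<-≤-trans (n² (e₂ h s w s< 1≤w 1≤h)) e₃))
        }
        where
        g f : V Ĝ → ℕ
        g v = if S v then w else 0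
        f v = if S v then w else if P v then 2 * w else 0
        g≡ : ∀ v → g v ≡ bit (S v) * w
        g≡ v with S v
        ... | true = sym (*-identityˡ w)
        ... | false = refl
        lip : ∀ x y → Edge Ĝ x y → f x ≤ f y + (g x + g y)
        lip x y e with S x in sx | S y in sy | P x in px | P y in py
        ... | true | b | _ | c = ≤-trans (m≤m+n w (if b then w else 0))
          (m≤n+m (w + (if b then w else 0)) (if b then w else if c then 2 * w else 0))
        ... | false | _ | false | _ = z≤n
        ... | false | true | true | _ = ≤-reflexive (cong (w +_) (+-identityʳ w))
        ... | false | false | true | true = m≤m+n (2 * w) 0
        ... | false | false | true | false =
          ⊥-elim (subst T py (closed x y e (subst T sx) (subst T sy) (subst T (sym px) tt)))
        diff : ∀ x y → T ((∁ S ⋂ P) x) → T ((∁ S ⋂ ∁ P) y) → 2 * w ≤ ∣ f x - f y ∣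
        diff x y p q with S x | P x | S y | P y
        ... | false | true | false | false = ≤-reflexive (sym (∣-∣-identityʳ (2 * w)))
        T≥ : n * n * (2 * w) ≤ 36 * variation f
        T≥ = halves (∁ S ⋂ P) (∁ S ⋂ ∁ P) (2 * w) f hP hQ diff
        e₁ : ∀ n s h → 36 * (2 * (28 * h) * (n * n) * suc s) ≡ n * n * (2016 * (h * suc s))
        e₁ n s h = solve (n ∷ s ∷ h ∷ [])
        e₂ : ∀ h s w → s < suc w * (104 * h) → 1 ≤ w → 1 ≤ h → 2016 * (h * suc s) < 2 * w * (h * h * C₀)
        e₂ h s w h₁ h₂ h₃ = begin-strict
          2016 * (h * suc s)                    ≤⟨ *-monoʳ-≤ 2016 (*-monoʳ-≤ h h₁) ⟩
          2016 * (h * (suc w * (104 * h)))      ≡⟨ left 2016 104 h w ⟩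
          209664 * (h * h + w * (h * h))       
            ≤⟨ *-monoʳ-≤ 209664 (+-monoˡ-≤ (w * (h * h)) (m≤n*m (h * h) w {{>-nonZero h₂}})) ⟩
          209664 * (w * (h * h) + w * (h * h))  ≡⟨ cong (209664 *_) (double (w * (h * h))) ⟩
          209664 * (2 * (w * (h * h)))          ≡⟨ *-assoc 209664 2 (w * (h * h)) ⟨
          419328 * (w * (h * h))               
            <⟨ *-monoˡ-< (w * (h * h)) {{>-nonZero (*-mono-≤ h₂ (*-mono-≤ h₃ h₃))}} (<ᵇ⇒< 419328 2000000 _) ⟩
          2000000 * (w * (h * h))               ≡⟨ right 2 C₀ h w ⟩
          2 * w * (h * h * C₀)                  ∎
          where
          open ≤-Reasoning
          double : ∀ x → x + x ≡ 2 * x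
          double x = cong (x +_) (sym (+-identityʳ x))
          left : ∀ a b h w → a * (h * (suc w * (b * h))) ≡ a * b * (h * h + w * (h * h))
          left a b h w = solve (a ∷ b ∷ h ∷ w ∷ [])
          right : ∀ a c h w → a * c * (w * (h * h)) ≡ a * w * (h * h * c)
          right a c h w = solve (a ∷ c ∷ h ∷ w ∷ [])
        e₃ : n * n * (2 * w * (h * h * C₀)) ≤ 36 * (variation f * (h * h * C₀))
        e₃ = go (n * n) (h * h * C₀) (variation f) (2 * w) T≥
          where
          go : ∀ q H T t → q * t ≤ 36 * T → q * (t * H) ≤ 36 * (T * H)
          go q H T t h = ≤-trans (≤-reflexive (sym (*-assoc q t H)))
            (≤-trans (*-monoˡ-≤ H h) (≤-reflexive (*-assoc 36 T H)))

      budget : 4 * n + h * (4 * (4 * n)) + h * (2 * (4 * n)) ≤ β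
      budget = go h n 1≤h
        where
        go : ∀ h n → 1 ≤ h → 4 * n + h * (4 * (4 * n)) + h * (2 * (4 * n)) ≤ 28 * h * n
        go h n p = lin (times (4 * n) p) 0 (solve (h ∷ n ∷ []))

      potential : ∀ v → Potential v
      potential = relax walk

      dist : V Ĝ → V Ĝ → ℕ
      dist v x = cost (Potential.path (potential v) x)

      -- The ball and the separation are found by finite search, so that the double negation around
      -- the minor matters only for refuting the remaining case.
      large-case : 1 ≤ s → 2 * (52 * (h * w)) ≤ s → Observable Ĝ h s
      large-case 1≤s 2r≤s with any? (λ v → n ≤? 3 * # (λ x → dist v x ≤ᵇ 52 * (h * w)))
      ... | yes (v , hB) = concentrated v (potential v) (52 * (h * w)) 2r≤s 1≤s hB
      ... | no ¬conc with region? (λ S → ∃ (Even S)) (λ S → region? (Even S) (even? S) (even-resp λ _ → refl))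
                           (λ eS (P , e) → P , even-resp eS (λ _ → refl) e)
      ... | yes (S , P , e) = separated e
      ... | no ¬even = ⊥-elim (Unsplittable.has-minor h 1≤h G Ĝ rig 1≤n m m≥1 (4 * n) m≤4n w β 1≤w β-small
        budget
          noSplit dist (λ v → Potential.root (potential v)) (λ v → Potential.lip (potential v))
          (λ v → ≰⇒> λ hB → ¬conc (v , hB)) no-minor)
        where
        noSplit : NoSplit
        noSplit S P c s with 6 * # (∁ S ⋂ P) <? n | 6 * # (∁ S ⋂ ∁ P) <? n
        ... | yes a | _ = inj₁ a
        ... | no _ | yes b = inj₂ b
        ... | no a | no b = ⊥-elim (¬even (S , P , c , s , ≮⇒≥ a , ≮⇒≥ b))

    observable : Observable Ĝ h s
    observable = decide (168 * h ≤? w)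
      where
      instance
        k≢0 : NonZero (104 * h)
        k≢0 = >-nonZero (≤-trans 1≤h (m≤n*m h 104))
      -- The largest `w` for which the doubled radius `52 * (h * w)` is at most half of `s`, as
      -- `concentrated` requires.
      w = s / (104 * h)
      bounds = division-bounds s (104 * h)
      w≤ : w * (104 * h) ≤ s
      w≤ = proj₁ bounds
      s< : s < suc w * (104 * h)
      s< = proj₂ bounds
      reorder : ∀ w h → 2 * (52 * (h * w)) ≡ w * (104 * h)
      reorder w h = solve (w ∷ h ∷ [])
      decide : Dec (168 * h ≤ w) → Observable Ĝ h s
      decide (no ¬large) = uniform
        (<-≤-trans s< (≤-trans (*-monoˡ-≤ (104 * h) (≰⇒> ¬large)) (≤-reflexive (*-comm (168 * h) (104 * h)))))
      decide (yes large) = large-case w 1≤w large s< (≤-trans (*-mono-≤ 1≤w (>-nonZero⁻¹ (104 * h))) w≤)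
          (≤-trans (≤-reflexive (reorder w h)) w≤)
        where
        1≤w : 1 ≤ w
        1≤w = ≤-trans (≤-trans 1≤h (m≤n*m h 168)) large

module _ where

  open import Defs using (Graph; walks; length; ℝ; seq)
  open Graph using (order; V; Edge; Walk; edge?)
  open import Data.List.Base as List using (List; []; _∷_; concatMap; allFin; lookup)
  open import Data.List.Membership.Propositional using (_∈_; lose)
  open import Data.List.Membership.Propositional.Properties
    using (∈-allFin; ∈-concatMap⁺; ∈-map⁺; ∈-++⁺ʳ; ∈-lookup)
  open import Data.List.Membership.DecPropositional using () renaming (_∈?_ to member?)
  open import Data.List.Relation.Unary.All as All using ([]; _∷_)
  open import Data.List.Relation.Unary.AllPairs using ([]; _∷_)
  open import Data.List.Relation.Unary.Any using (here; there)
  open import Data.List.Relation.Unary.Unique.Propositional using (Unique)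
  open import Data.Nat.Base hiding (_/_; _%_)
  open import Data.Nat.Properties hiding (_≟_)
  open import Data.Rational.Base as ℚ using (½)

  -- The walks over which dist minimises

  module Shorten (G : Graph) (m : V G → ℕ) where
    open Weighted G m

    edges : ∀ {u v} → Walk G u v → ℕ
    edges ε = 0
    edges (_ ◅ p) = suc (edges p)

    trace : ∀ {u v} → Walk G u v → List (V G)
    trace {u} ε = u ∷ []
    trace {u} (_ ◅ p) = u ∷ trace p

    length-trace : ∀ {u v} (p : Walk G u v) → List.length (trace p) ≡ suc (edges p)
    length-trace ε = refl
    length-trace (_ ◅ p) = cong suc (length-trace p)

    suffix : ∀ {u v x} (p : Walk G u v) → x ∈ trace p → Unique (trace p) →
      ∃ λ (q : Walk G x v) → cost q ≤ cost p × Unique (trace q)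
    suffix ε (here refl) un = ε , ≤-refl , un
    suffix (e ◅ p) (here refl) un = e ◅ p , ≤-refl , un
    suffix (_◅_ {i = u} {j = w} e p) (there x∈) (_ ∷ un) =
      let q , h , un' = suffix p x∈ un in q , ≤-trans h (m≤n+m (cost p) (m u + m w)) , un'

    -- If the new head already occurs on the simplified rest, the walk is restarted from that
    -- occurrence; dropping the loop does not raise the cost.
    simple : ∀ {u v} (p : Walk G u v) → ∃ λ (q : Walk G u v) → cost q ≤ cost p × Unique (trace q)
    simple ε = ε , z≤n , [] ∷ []
    simple (_◅_ {i = u} {j = w} e p) with simple p
    ... | q , h , un with member? _≟_ u (trace q)
    ... | yes u∈ = let r , h' , un' = suffix q u∈ un in
          r , ≤-trans h' (≤-trans h (m≤n+m (cost p) (m u + m w))) , un'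
    ... | no u∉ = e ◅ q , +-monoʳ-≤ (m u + m w) h , All.tabulate
      (λ y∈ u≡y → u∉ (subst (_∈ trace q) (sym u≡y) y∈)) ∷ un

    lookup-injective : ∀ {n} {xs : List (Fin n)} → Unique xs → ∀ {i j} → lookup xs i ≡ lookup xs j → i ≡ j
    lookup-injective {xs = _ ∷ _} un {zero} {zero} eq = refl
    lookup-injective {xs = x ∷ xs} (x∉ ∷ un) {zero} {suc j} eq =
      ⊥-elim (All.lookup x∉ (∈-lookup {xs = xs} j) eq)
    lookup-injective {xs = x ∷ xs} (x∉ ∷ un) {suc i} {zero} eq =
      ⊥-elim (All.lookup x∉ (∈-lookup {xs = xs} i) (sym eq))
    lookup-injective {xs = _ ∷ _} (_ ∷ un) {suc i} {suc j} eq = cong suc (lookup-injective un eq)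

    edges≤ : ∀ {u v} (p : Walk G u v) → Unique (trace p) → edges p ≤ order G
    edges≤ p un = ≤-trans (n≤1+n (edges p)) (≤-trans (≤-reflexive (sym (length-trace p)))
      (injective⇒≤ {f = lookup (trace p)} (lookup-injective un)))

    -- The function mapped in the definition of walks is local to Defs; unification
    -- against that definition gives access to it.
    private
      fibres : ∀ {X : Set} {L xs : List X} {F : V G → List X} →
        L ≡ xs List.++ concatMap F (allFin (order G)) → V G → List X
      fibres {F = F} _ = F

      first-step : ∀ k u v → V G → List (Walk G u v)
      first-step k u v = fibres {L = walks G (suc k) u v} refl

      first-step∈ : ∀ k {u w v} → Edge G u w → {q : Walk G w v} → q ∈ walks G k w v →
        ∃ λ (e : Edge G u w) → (e ◅ q) ∈ first-step k u v w
      first-step∈ k {u} {w} e q∈ with edge? G u w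
      ... | yes e' = e' , ∈-map⁺ (e' ◅_) q∈
      ... | no ¬e = ⊥-elim (¬e e)

    -- The listed walk takes its edges from `edge?`, whose proofs of adjacency may differ from those
    -- in `p`; hence equality of lengths and not of walks.
    listed : ∀ ω k {u v} (p : Walk G u v) → edges p ≤ k →
      ∃ λ q → q ∈ walks G k u v × (∀ i → seq (length G ω q) i ≡ seq (length G ω p) i)
    listed ω k {u} ε h with u ≟ u
    ... | yes refl = ε , here refl , λ _ → refl
    ... | no u≢u = ⊥-elim (u≢u refl)
    listed ω (suc k) {u} {v} (_◅_ {j = w} e p) (s≤s h) =
      let q , q∈ , eq = listed ω k p h
          e' , r∈ = first-step∈ k e q∈
      in e' ◅ q , ∈-++⁺ʳ _ (∈-concatMap⁺ (first-step k u v) (lose (∈-allFin w) r∈)) , λ i →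
        cong (½ ℚ.* (seq (ω u) i ℚ.+ seq (ω w) i) ℚ.+_) (eq i)

module _ where

  open import Defs hiding (_≤_; _<_; _+_; _-_; _·_; _⊓_; ∣_∣)
  import Defs as R
  open import Data.Integer.Base as ℤ using (-[1+_])
  import Data.Integer.Properties as ℤ
  open import Data.List.Base as List using (List; []; _∷_)
  open import Data.List.Membership.Propositional using (_∈_)
  open import Data.List.Relation.Unary.Any using (here; there)
  open import Data.Nat.Base as ℕ using (ℕ; zero; suc; NonZero; z≤n; s≤s)
  open import Data.Nat.Coprimality as Coprime using (1-coprimeTo)
  import Data.Nat.DivMod as ℕ
  import Data.Nat.Properties as ℕ
  open import Data.Rational.Base as ℚ
    using (ℚ; mkℚ; 0ℚ; 1ℚ; ½; _+_; _*_; _-_; -_; _≤_; _<_; *≤*; *<*; _/_; Positive)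
  open import Data.Rational.Properties as ℚ using (≤-trans; ≤-reflexive; ≤-refl; +-mono-≤)
  open import Data.Rational.Solver using (module +-*-Solver)
  import Data.Vec.Functional as Vector

  -- Passage to the reals

  ι : ℕ → ℚ
  ι k = mkℚ (ℤ.+ k) 0 (Coprime.sym (1-coprimeTo k))

  /1≡ι : ∀ k → ℤ.+ k / 1 ≡ ι k
  /1≡ι k = ℚ.↥p/↧p≡p (ι k)

  ι-+ : ∀ a b → ι (a ℕ.+ b) ≡ ι a + ι b
  ι-+ a b = trans (sym (/1≡ι (a ℕ.+ b)))
    (cong (_/ 1) (trans (ℤ.pos-+ a b) (sym (cong₂ ℤ._+_ (ℤ.*-identityʳ (ℤ.+ a)) (ℤ.*-identityʳ (ℤ.+ b))))))

  ι-* : ∀ a b → ι (a ℕ.* b) ≡ ι a * ι b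
  ι-* a b = trans (sym (/1≡ι (a ℕ.* b))) (cong (_/ 1) (ℤ.pos-* a b))

  ι-mono : ∀ {a b} → a ℕ.≤ b → ι a ≤ ι b
  ι-mono {a} {b} h = *≤* (subst₂ ℤ._≤_ (sym (ℤ.*-identityʳ (ℤ.+ a))) (sym (ℤ.*-identityʳ (ℤ.+ b))) (ℤ.+≤+ h))

  ι-mono-< : ∀ {a b} → a ℕ.< b → ι a < ι b
  ι-mono-< {a} {b} h = *<* (subst₂ ℤ._<_ (sym (ℤ.*-identityʳ (ℤ.+ a))) (sym (ℤ.*-identityʳ (ℤ.+ b)))
    (ℤ.+<+ h))

  ι-cancel : ∀ {a b} → ι a ≤ ι b → a ℕ.≤ b
  ι-cancel {a} {b} h = ℤ.drop‿+≤+ (subst₂ ℤ._≤_ (ℤ.*-identityʳ (ℤ.+ a)) (ℤ.*-identityʳ (ℤ.+ b))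
    (ℚ.drop-*≤* h))

  0≤ι : ∀ k → 0ℚ ≤ ι k
  0≤ι k = ι-mono {0} z≤n

  recip : ∀ n .{{_ : NonZero n}} → ℚ
  recip n = ℤ.+ 1 / n

  recip-pos : ∀ n .{{_ : NonZero n}} → Positive (recip n)
  recip-pos (suc d) = subst Positive (sym (ℚ.↥p/↧p≡p (mkℚ (ℤ.+ 1) d (1-coprimeTo (suc d))))) _

  recip-inv : ∀ n .{{_ : NonZero n}} → recip n * ι n ≡ 1ℚ
  recip-inv (suc d) = trans (cong (_* ι (suc d)) (ℚ.↥p/↧p≡p (mkℚ (ℤ.+ 1) d (1-coprimeTo (suc d)))))
    (ℚ.*-inverseˡ (ι (suc d)))

  floor : ∀ p → 0ℚ ≤ p → ∃ λ k → ι k ≤ p × p < ι (suc k)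
  floor (mkℚ (ℤ.+ x) d c) _ = k ,
    *≤* (subst₂ ℤ._≤_ (ℤ.pos-* k (suc d)) (sym (ℤ.*-identityʳ (ℤ.+ x))) (ℤ.+≤+ (ℕ.m/n*n≤m x (suc d)))) ,
    *<* (subst₂ ℤ._<_ (sym (ℤ.*-identityʳ (ℤ.+ x))) (ℤ.pos-* (suc k) (suc d))
      (ℤ.+<+ (proj₂ (division-bounds x (suc d)))))
    where k = x ℕ./ suc d
  floor (mkℚ -[1+ x ] d c) h = ⊥-elim (absurd (ℚ.drop-*≤* h))
    where
    absurd : ¬ (ℤ.+ 0 ℤ.* ℤ.+ suc d ℤ.≤ -[1+ x ] ℤ.* ℤ.+ 1)
    absurd ()

  ∑ℚ : ∀ {n} → (Fin n → ℚ) → ℚ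
  ∑ℚ = Vector.foldr _+_ 0ℚ

  seq-∑ : ∀ {n} (f : Fin n → ℝ) k → seq (∑ f) k ≡ ∑ℚ (λ i → seq (f i) k)
  seq-∑ {zero} f k = refl
  seq-∑ {suc n} f k = cong (seq (f zero) k +_) (seq-∑ (f ∘ suc) k)

  ∑ℚ-cong : ∀ {n} {f g : Fin n → ℚ} → (∀ i → f i ≡ g i) → ∑ℚ f ≡ ∑ℚ g
  ∑ℚ-cong {zero} h = refl
  ∑ℚ-cong {suc n} h = cong₂ _+_ (h zero) (∑ℚ-cong (h ∘ suc))

  ∑ℚ-mono : ∀ {n} {f g : Fin n → ℚ} → (∀ i → f i ≤ g i) → ∑ℚ f ≤ ∑ℚ g
  ∑ℚ-mono {zero} h = ≤-refl
  ∑ℚ-mono {suc n} h = +-mono-≤ (h zero) (∑ℚ-mono (h ∘ suc))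

  ∑ℚ-scale : ∀ {n} c (f : Fin n → ℕ) → ∑ℚ (λ i → c * ι (f i)) ≡ c * ι (sum f)
  ∑ℚ-scale {zero} c f = sym (ℚ.*-zeroʳ c)
  ∑ℚ-scale {suc n} c f = trans (cong (c * ι (f zero) +_) (∑ℚ-scale c (f ∘ suc)))
    (trans (sym (ℚ.*-distribˡ-+ c (ι (f zero)) (ι (sum (f ∘ suc)))))
      (cong (c *_) (sym (ι-+ (f zero) (sum (f ∘ suc))))))

  ∑ℚ-shift : ∀ {n} c (f : Fin n → ℚ) → ∑ℚ (λ i → f i + c) ≡ ∑ℚ f + ι n * c
  ∑ℚ-shift {zero} c f = sym (trans (ℚ.+-identityˡ _) (ℚ.*-zeroˡ c))
  ∑ℚ-shift {suc n} c f = trans (cong (f zero + c +_) (∑ℚ-shift c (f ∘ suc)))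
    (trans (go (f zero) c (∑ℚ (f ∘ suc)) (ι n)) (cong (λ z → f zero + ∑ℚ (f ∘ suc) + z * c) (sym (ι-+ 1 n))))
    where
    open +-*-Solver
    go : ∀ x c s n → x + c + (s + n * c) ≡ x + s + (1ℚ + n) * c
    go = solve 4 (λ x c s n → x :+ c :+ (s :+ n :* c) := x :+ s :+ (con 1ℚ :+ n) :* c) refl

  ι-dist : ∀ a b → ℚ.∣ ι a - ι b ∣ ≡ ι ℕ.∣ a - b ∣
  ι-dist a b with ℕ.≤-total a b
  ... | inj₁ a≤b = trans
    (cong (λ z → ℚ.∣ ι a - z ∣) (trans (cong ι (sym (ℕ.m+[n∸m]≡n a≤b))) (ι-+ a (b ℕ.∸ a))))
      (trans (cong ℚ.∣_∣ (go (ι a) (ι (b ℕ.∸ a)))) (trans (ℚ.∣-p∣≡∣p∣ (ι (b ℕ.∸ a)))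
      (trans (ℚ.0≤p⇒∣p∣≡p (0≤ι (b ℕ.∸ a))) (cong ι (sym (ℕ.m≤n⇒∣m-n∣≡n∸m a≤b))))))
    where
    open +-*-Solver
    go : ∀ x y → x - (x + y) ≡ - y
    go = solve 2 (λ x y → x :- (x :+ y) := :- y) refl
  ... | inj₂ b≤a = trans
    (cong (λ z → ℚ.∣ z - ι b ∣) (trans (cong ι (sym (ℕ.m+[n∸m]≡n b≤a))) (ι-+ b (a ℕ.∸ b))))
      (trans (cong ℚ.∣_∣ (go (ι b) (ι (a ℕ.∸ b))))
      (trans (ℚ.0≤p⇒∣p∣≡p (0≤ι (a ℕ.∸ b))) (cong ι (sym (ℕ.m≤n⇒∣n-m∣≡n∸m b≤a)))))
    where
    open +-*-Solver
    go : ∀ x y → x + y - x ≡ y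
    go = solve 2 (λ x y → x :+ y :- x := y) refl

  scaled-dist : ∀ c a b → 0ℚ ≤ c → ℚ.∣ c * ι a - c * ι b ∣ ≡ c * ι ℕ.∣ a - b ∣
  scaled-dist c a b 0≤c = trans (cong ℚ.∣_∣ (go c (ι a) (ι b))) (trans (ℚ.∣p*q∣≡∣p∣*∣q∣ c (ι a - ι b))
    (cong₂ _*_ (ℚ.0≤p⇒∣p∣≡p 0≤c) (ι-dist a b)))
    where
    open +-*-Solver
    go : ∀ c x y → c * x - c * y ≡ c * (x - y)
    go = solve 3 (λ c x y → c :* x :- c :* y := c :* (x :- y)) refl

  scale-≤ : ∀ {c a b} → 0ℚ ≤ c → a ≤ b → c * a ≤ c * b
  scale-≤ {c} 0≤c h = ℚ.*-monoˡ-≤-nonNeg c {{ℚ.nonNegative 0≤c}} h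

  pos⇒0≤ : ∀ {c} → Positive c → 0ℚ ≤ c
  pos⇒0≤ {c} p = ℚ.<⇒≤ (ℚ.positive⁻¹ c {{p}})

  min-lower : ∀ {A : Set} k c (l : A → ℝ) (x : ℝ) xs → c ≤ seq x k → (∀ a → c ≤ seq (l a) k) →
    c ≤ seq (List.foldr R._⊓_ x (List.map l xs)) k
  min-lower k c l x [] h₀ h = h₀
  min-lower k c l x (a ∷ xs) h₀ h = ℚ.⊓-glb (h a) (min-lower k c l x xs h₀ h)

  min-upper : ∀ {A : Set} k (l : A → ℝ) (x : ℝ) {xs a} → a ∈ xs → seq (List.foldr R._⊓_ x (List.map l xs))
    k ≤ seq (l a) k
  min-upper k l x {b ∷ xs} (here refl) = ℚ.p⊓q≤p (seq (l b) k) _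
  min-upper k l x {b ∷ xs} (there h) = ≤-trans (ℚ.p⊓q≤q (seq (l b) k) _) (min-upper k l x h)

  -- Observables from rational data

  module Rational (G : Graph) (conn : Connected G) where
    private
      n = order G
      instance
        n≢0 : NonZero n
        n≢0 = Connected.nonempty conn

    above : ∀ p q η → 0ℚ < η → p ≤ q → p ≤ q + η
    above p q η η>0 h = ≤-trans h (subst (_≤ q + η) (ℚ.+-identityʳ q) (ℚ.+-monoʳ-≤ q (ℚ.<⇒≤ η>0)))

    deviation : (V G → ℚ) → ℚ
    deviation F = ∑ℚ λ x → ∑ℚ λ y → ℚ.∣ F x - F y ∣

    module _ (ω F : V G → ℚ) (ω≥0 : ∀ v → 0ℚ ≤ ω v) (norm : recip n * ∑ℚ ω ≤ 1ℚ)
      (lip : ∀ {x y} → Edge G x y → ℚ.∣ F x - F y ∣ ≤ ½ * (ω x + ω y)) where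

      private
        weight function : V G → ℝ
        weight v = fromℚ (ω v)
        function v = fromℚ (F v)

        difference : V G → V G → ℝ
        difference x y = R.∣ function x R.- function y ∣

      walk-lip : ∀ k {x y} (p : Walk G x y) → ℚ.∣ F x - F y ∣ ≤ seq (length G weight p) k
      walk-lip k {x} ε = ≤-reflexive (cong ℚ.∣_∣ (ℚ.+-inverseʳ (F x)))
      walk-lip k {x} {y} (_◅_ {j = z} e p) = begin
        ℚ.∣ F x - F y ∣                                ≡⟨ cong ℚ.∣_∣ (go (F x) (F z) (F y)) ⟩
        ℚ.∣ (F x - F z) + (F z - F y) ∣                ≤⟨ ℚ.∣p+q∣≤∣p∣+∣q∣ (F x - F z) (F z - F y) ⟩
        ℚ.∣ F x - F z ∣ + ℚ.∣ F z - F y ∣              ≤⟨ +-mono-≤ (lip e) (walk-lip k p) ⟩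
        ½ * (ω x + ω z) + seq (length G weight p) k    ∎
        where
        open ℚ.≤-Reasoning
        go : ∀ x z y → x - y ≡ (x - z) + (z - y)
        go = solve 3 (λ x z y → x :- y := (x :- z) :+ (z :- y)) refl where open +-*-Solver

      average : ∀ k → seq (∑ λ x → ∑ λ y → difference x y) k ≡ deviation F
      average k = trans (seq-∑ (λ x → ∑ (difference x)) k) (∑ℚ-cong (λ x → seq-∑ (difference x) k))

      -- Constant sequences turn the data into reals, so all estimates hold from index 0 on, and the
      -- strict one has the constant margin `avg - r`.
      deviation⇒obs : ∀ r → r < recip n * recip n * deviation F → 𝔰̄obs G conn r
      deviation⇒obs r r< = (weight , weight-nonneg , weight-norm) , (function , function-lip) ,
        (avg - r , diff>0 , 0 , λ k _ →
          ≤-reflexive (trans (go r avg) (cong (recip n * recip n *_) (sym (average k)))))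
        where
        avg = recip n * recip n * deviation F
        go : ∀ r a → r + (a - r) ≡ a
        go = solve 2 (λ r a → r :+ (a :- r) := a) refl where open +-*-Solver
        diff>0 : 0ℚ < avg - r
        diff>0 = subst (_< avg - r) (ℚ.+-inverseʳ r) (ℚ.+-monoˡ-< (- r) r<)
        weight-nonneg : ∀ v → 0ℝ R.≤ weight v
        weight-nonneg v η η>0 = 0 , λ k _ → above 0ℚ (ω v) η η>0 (ω≥0 v)
        weight-norm : ‖_‖₁ G conn weight R.≤ 1ℝ
        weight-norm η η>0 = 0 , λ k _ → above (recip n * seq (∑ weight) k) 1ℚ η η>0
          (subst (λ z → recip n * z ≤ 1ℚ) (sym (seq-∑ weight k)) norm)
        function-lip : Lipschitz₁ (dist G conn weight) function
        function-lip x y η η>0 = 0 , λ k _ → above ℚ.∣ F x - F y ∣ (seq (dist G conn weight x y) k) η η>0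
          (min-lower k ℚ.∣ F x - F y ∣ (length G weight) (length G weight (Connected.walk conn x y))
            (walks G n x y)
            (walk-lip k (Connected.walk conn x y)) (walk-lip k))

    module _ (g f : V G → ℕ) (D : ℕ) .{{_ : NonZero D}} (∑g≤ : sum g ℕ.≤ D ℕ.* n)
      (lip : ∀ {x y} → Edge G x y → f x ℕ.≤ f y ℕ.+ (g x ℕ.+ g y)) where

      natural⇒obs : ∀ r → r < recip n * recip n * (½ * recip D * ι (variation f)) → 𝔰̄obs G conn r
      natural⇒obs = scaled (recip D) (pos⇒0≤ {recip D} (recip-pos D)) (recip-inv D)
        where
        scaled : ∀ δ → 0ℚ ≤ δ → δ * ι D ≡ 1ℚ → ∀ r → r < recip n * recip n * (½ * δ * ι (variation f)) →
          𝔰̄obs G conn r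
        scaled δ 0≤δ δD r r< = deviation⇒obs (λ v → δ * ι (g v)) (λ v → c * ι (f v)) nonneg total edge r
            (subst (λ z → r < recip n * recip n * z) (sym dev) r<)
          where
          open ℚ.≤-Reasoning
          c = ½ * δ
          0≤c : 0ℚ ≤ c
          0≤c = subst (_≤ c) (ℚ.*-zeroʳ ½) (scale-≤ (pos⇒0≤ {½} _) 0≤δ)
          nonneg : ∀ v → 0ℚ ≤ δ * ι (g v)
          nonneg v = subst (_≤ δ * ι (g v)) (ℚ.*-zeroʳ δ) (scale-≤ 0≤δ (0≤ι (g v)))
          total : recip n * ∑ℚ (λ v → δ * ι (g v)) ≤ 1ℚ
          total = begin
            recip n * ∑ℚ (λ v → δ * ι (g v))  ≡⟨ cong (recip n *_) (∑ℚ-scale δ g) ⟩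
            recip n * (δ * ι (sum g))        
              ≤⟨ scale-≤ {recip n} (pos⇒0≤ {recip n} (recip-pos n)) (scale-≤ 0≤δ (ι-mono ∑g≤)) ⟩
            recip n * (δ * ι (D ℕ.* n))       ≡⟨ cong (λ z → recip n * (δ * z)) (ι-* D n) ⟩
            recip n * (δ * (ι D * ι n))       ≡⟨ go' (recip n) δ (ι D) (ι n) ⟩
            (recip n * ι n) * (δ * ι D)       ≡⟨ cong₂ _*_ (recip-inv n) δD ⟩
            1ℚ * 1ℚ                           ≡⟨ ℚ.*-identityˡ 1ℚ ⟩
            1ℚ                                ∎
            where
            go' : ∀ a b x y → a * (b * (x * y)) ≡ (a * y) * (b * x)
            go' = solve 4 (λ a b x y → a :* (b :* (x :* y)) := (a :* y) :* (b :* x)) refl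
              where open +-*-Solver
          spread : ∀ {x z} → Edge G x z → ℕ.∣ f x - f z ∣ ℕ.≤ g x ℕ.+ g z
          spread {x} {z} e with ℕ.≤-total (f x) (f z)
          ... | inj₁ h = subst (ℕ._≤ g x ℕ.+ g z) (sym (ℕ.m≤n⇒∣m-n∣≡n∸m h))
                  (ℕ.m≤n+o⇒m∸n≤o (f z) (f x)
                    (subst (λ t → f z ℕ.≤ f x ℕ.+ t) (ℕ.+-comm (g z) (g x)) (lip (Graph.symm G e))))
          ... | inj₂ h = subst (ℕ._≤ g x ℕ.+ g z) (sym (ℕ.m≤n⇒∣n-m∣≡n∸m h))
            (ℕ.m≤n+o⇒m∸n≤o (f x) (f z) (lip e))
          edge : ∀ {x z} → Edge G x z → ℚ.∣ c * ι (f x) - c * ι (f z) ∣ ≤ ½ * (δ * ι (g x) + δ * ι (g z))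
          edge {x} {z} e = begin
            ℚ.∣ c * ι (f x) - c * ι (f z) ∣     ≡⟨ scaled-dist c (f x) (f z) 0≤c ⟩
            c * ι ℕ.∣ f x - f z ∣               ≤⟨ scale-≤ 0≤c (ι-mono (spread e)) ⟩
            c * ι (g x ℕ.+ g z)                 ≡⟨ cong (c *_) (ι-+ (g x) (g z)) ⟩
            ½ * δ * (ι (g x) + ι (g z))         ≡⟨ ℚ.*-assoc ½ δ _ ⟩
            ½ * (δ * (ι (g x) + ι (g z)))       ≡⟨ cong (½ *_) (ℚ.*-distribˡ-+ δ (ι (g x)) (ι (g z))) ⟩
            ½ * (δ * ι (g x) + δ * ι (g z))     ∎
          dev : deviation (λ v → c * ι (f v)) ≡ c * ι (variation f)
          dev = trans (∑ℚ-cong (λ x → trans (∑ℚ-cong (λ y → scaled-dist c (f x) (f y) 0≤c))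
            (∑ℚ-scale c (λ y → ℕ.∣ f x - f y ∣))))
            (∑ℚ-scale c (λ x → sum (λ y → ℕ.∣ f x - f y ∣)))

  -- Upper bounds for the average distance

  pair-total : ∀ {n} (d : Fin n → Fin n → ℚ) (c : Fin n → ℕ) → (∀ u v → d u v ≤ ½ * ι (c u ℕ.+ c v)) →
    ∑ℚ (λ u → ∑ℚ (d u)) ≤ ι n * ι (sum c)
  pair-total {n} d c h = begin
    ∑ℚ (λ u → ∑ℚ (d u))                              ≤⟨ ∑ℚ-mono (λ u → ∑ℚ-mono (h u)) ⟩
    ∑ℚ (λ u → ∑ℚ (λ v → ½ * ι (c u ℕ.+ c v)))        ≡⟨ ∑ℚ-cong (λ u → ∑ℚ-scale ½ (λ v → c u ℕ.+ c v)) ⟩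
    ∑ℚ (λ u → ½ * ι (sum (λ v → c u ℕ.+ c v)))       ≡⟨ ∑ℚ-scale ½ (λ u → sum (λ v → c u ℕ.+ c v)) ⟩
    ½ * ι (sum (λ u → sum (λ v → c u ℕ.+ c v)))      ≡⟨ cong (λ z → ½ * ι z) count ⟩
    ½ * ι (2 ℕ.* (n ℕ.* F))                          ≡⟨ cong (½ *_) (ι-* 2 (n ℕ.* F)) ⟩
    ½ * (ι 2 * ι (n ℕ.* F))                          ≡⟨ ℚ.*-assoc ½ (ι 2) (ι (n ℕ.* F)) ⟨
    ½ * ι 2 * ι (n ℕ.* F)                            ≡⟨ cong (_* ι (n ℕ.* F)) {½ * ι 2} {1ℚ} refl ⟩
    1ℚ * ι (n ℕ.* F)                                 ≡⟨ ℚ.*-identityˡ (ι (n ℕ.* F)) ⟩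
    ι (n ℕ.* F)                                      ≡⟨ ι-* n F ⟩
    ι n * ι F                                        ∎
    where
    open ℚ.≤-Reasoning
    F = sum c
    count : sum (λ u → sum (λ v → c u ℕ.+ c v)) ≡ 2 ℕ.* (n ℕ.* F)
    count = trans (Sum.sum-cong-≗ (λ u → trans (sum-+ (λ _ → c u) c) (cong (ℕ._+ F) (sum-const n (c u)))))
      (trans (sum-+ (λ u → n ℕ.* c u) (λ _ → F)) (trans (cong₂ ℕ._+_
        (trans (Sum.sum-cong-≗ (λ u → ℕ.*-comm n (c u))) (trans (sum-* c n) (ℕ.*-comm F n))) (sum-const n F))
        (cong (n ℕ.* F ℕ.+_) (sym (ℕ.+-identityʳ (n ℕ.* F))))))

  -- One index k of the Cauchy sequences ω, with the weights rounded up to m.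
  module AtIndex (G : Graph) (conn : Connected G) (ω : V G → ℝ) (m : V G → ℕ) (k : ℕ)
    (ω≤m : ∀ v → seq (ω v) k ≤ ι (m v)) where
    private
      n = order G
      instance
        n≢0 : NonZero n
        n≢0 = Connected.nonempty conn
    open Weighted G m
    open Shorten G m

    length≤cost : ∀ {u v} (p : Walk G u v) → seq (length G ω p) k ≤ ½ * ι (cost p)
    length≤cost ε = ≤-reflexive (sym (ℚ.*-zeroʳ ½))
    length≤cost (_◅_ {i = u} {j = w} e p) = begin
      ½ * (seq (ω u) k + seq (ω w) k) + seq (length G ω p) k
        ≤⟨ +-mono-≤ (scale-≤ {½} (pos⇒0≤ {½} _) (+-mono-≤ (ω≤m u) (ω≤m w))) (length≤cost p) ⟩
      ½ * (ι (m u) + ι (m w)) + ½ * ι (cost p)   ≡⟨ ℚ.*-distribˡ-+ ½ (ι (m u) + ι (m w)) (ι (cost p)) ⟨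
      ½ * (ι (m u) + ι (m w) + ι (cost p))       ≡⟨ cong (λ z → ½ * (z + ι (cost p))) (ι-+ (m u) (m w)) ⟨
      ½ * (ι (m u ℕ.+ m w) + ι (cost p))         ≡⟨ cong (½ *_) (ι-+ (m u ℕ.+ m w) (cost p)) ⟨
      ½ * ι (m u ℕ.+ m w ℕ.+ cost p)             ∎
      where open ℚ.≤-Reasoning

    dist≤cost : ∀ {u v} (p : Walk G u v) → seq (dist G conn ω u v) k ≤ ½ * ι (cost p)
    dist≤cost {u} {v} p = let q , q≤p , un = simple p in via q q≤p (listed ω n q (edges≤ q un))
      where
      via : ∀ q → cost q ℕ.≤ cost p →
        (∃ λ r → r ∈ walks G n u v × (∀ i → seq (length G ω r) i ≡ seq (length G ω q) i)) →
        seq (dist G conn ω u v) k ≤ ½ * ι (cost p)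
      via q q≤p (r , r∈ , eq) = ≤-trans (min-upper k (length G ω) (length G ω (Connected.walk conn u v)) r∈)
        (≤-trans (≤-reflexive (eq k)) (≤-trans (length≤cost q) (scale-≤ {½} (pos⇒0≤ {½} _) (ι-mono q≤p))))

    cost-reverse : ∀ {u v} (p : Walk G u v) → ∃ λ (q : Walk G v u) → cost q ≡ cost p
    cost-reverse ε = ε , refl
    cost-reverse (_◅_ {i = u} {j = w} e p) = let q , eq = cost-reverse p in
      q ◅◅ Graph.symm G e ◅ ε , trans (cost-◅◅ q (Graph.symm G e ◅ ε))
        (trans (cong₂ ℕ._+_ eq (trans (ℕ.+-identityʳ _) (ℕ.+-comm (m w) (m u)))) (ℕ.+-comm (cost p) _))

    dist-total : ℚ
    dist-total = seq (∑ λ u → ∑ λ v → dist G conn ω u v) k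

    dist-total≡ : dist-total ≡ ∑ℚ (λ u → ∑ℚ (λ v → seq (dist G conn ω u v) k))
    dist-total≡ = trans (seq-∑ (λ u → ∑ (dist G conn ω u)) k) (∑ℚ-cong (λ u → seq-∑ (dist G conn ω u) k))

    -- Route every pair through `v`: each walk of the family is used `2 * n` times, and the 2
    -- cancels against the doubling in `cost`. So the average distance is at most the average cost
    -- from any single vertex.
    total≤ : ∀ v (p : ∀ x → Walk G v x) → dist-total ≤ ι n * ι (sum (cost ∘ p))
    total≤ v p = subst (_≤ ι n * ι (sum (cost ∘ p))) (sym dist-total≡)
      (pair-total (λ u v → seq (dist G conn ω u v) k) (cost ∘ p) pair)
      where
      pair : ∀ x y → seq (dist G conn ω x y) k ≤ ½ * ι (cost (p x) ℕ.+ cost (p y))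
      pair x y = let q , eq = cost-reverse (p x) in
        subst (λ z → seq (dist G conn ω x y) k ≤ ½ * ι z)
          (trans (cost-◅◅ q (p y)) (cong (ℕ._+ cost (p y)) eq)) (dist≤cost (q ◅◅ p y))

    spread : ∀ q s → q ≤ recip n * recip n * dist-total → ι s ≤ q →
      ∀ v (p : ∀ x → Walk G v x) → s ℕ.* n ℕ.≤ sum (cost ∘ p)
    spread q s q≤ s≤q v p = ι-cancel (subst (_≤ ι (sum (cost ∘ p))) (sym (ι-* s n))
      (normalised (recip n) (ι n) (ι s) (ι (sum (cost ∘ p))) dist-total (pos⇒0≤ {recip n} (recip-pos n))
        (0≤ι n)
        (recip-inv n) (≤-trans s≤q q≤) (total≤ v p)))
      where
      normalised : ∀ ρ N s F t → 0ℚ ≤ ρ → 0ℚ ≤ N → ρ * N ≡ 1ℚ → s ≤ ρ * ρ * t → t ≤ N * F → s * N ≤ F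
      normalised ρ N s F t 0≤ρ 0≤N ρN s≤ t≤ = begin
        s * N                        
          ≤⟨ ℚ.*-monoʳ-≤-nonNeg N {{ℚ.nonNegative 0≤N}} (≤-trans s≤ (scale-≤ {ρ * ρ} 0≤ρ² t≤)) ⟩
        ρ * ρ * (N * F) * N           ≡⟨ go ρ N F ⟩
        (ρ * N) * (ρ * N) * F         ≡⟨ cong (λ x → x * x * F) ρN ⟩
        1ℚ * 1ℚ * F                   ≡⟨ cong (_* F) (ℚ.*-identityˡ 1ℚ) ⟩
        1ℚ * F                        ≡⟨ ℚ.*-identityˡ F ⟩
        F                             ∎
        where
        open ℚ.≤-Reasoning
        0≤ρ² : 0ℚ ≤ ρ * ρ
        0≤ρ² = subst (_≤ ρ * ρ) (ℚ.*-zeroʳ ρ) (scale-≤ {ρ} 0≤ρ 0≤ρ)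
        go : ∀ r n f → r * r * (n * f) * n ≡ (r * n) * (r * n) * f
        go = solve 3 (λ r n f → r :* r :* (n :* f) :* n := (r :* n) :* (r :* n) :* f) refl
          where open +-*-Solver

  -- Integer weights and the resulting rational inequality

  record Rounded (n : ℕ) (a : Fin n → ℚ) : Set where
    field
      m    : Fin n → ℕ
      m≥1  : ∀ v → 1 ℕ.≤ m v
      a≤m  : ∀ v → a v ≤ ι (m v)
      m≤4n : sum m ℕ.≤ 4 ℕ.* n

  -- Adding 1 to weights of average at most 1 changes them by a constant factor on
  -- average, and makes them positive integers.
  round-up : ∀ n (ρ : ℚ) (a : Fin n → ℚ) → ρ * ι n ≡ 1ℚ →
    (∀ v → ∃ λ k → ι k ≤ a v + 1ℚ × a v + 1ℚ < ι (suc k)) →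
    ρ * ∑ℚ a ≤ ι 2 → Rounded n a
  round-up n ρ a ρn k norm = record
    { m = λ v → suc (proj₁ (k v)) ; m≥1 = λ v → s≤s z≤n ; a≤m = a≤m ; m≤4n = ι-cancel total }
    where
    a≤m : ∀ v → a v ≤ ι (suc (proj₁ (k v)))
    a≤m v = ≤-trans (subst (_≤ a v + 1ℚ) (ℚ.+-identityʳ (a v)) (ℚ.+-monoʳ-≤ (a v) (0≤ι 1)))
      (ℚ.<⇒≤ (proj₂ (proj₂ (k v))))
    open ℚ.≤-Reasoning
    sum≤ : ∑ℚ a ≤ ι n * ι 2
    sum≤ = begin
      ∑ℚ a                 ≡⟨ ℚ.*-identityˡ (∑ℚ a) ⟨
      1ℚ * ∑ℚ a            ≡⟨ cong (_* ∑ℚ a) (trans (ℚ.*-comm (ι n) ρ) ρn) ⟨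
      ι n * ρ * ∑ℚ a       ≡⟨ ℚ.*-assoc (ι n) ρ (∑ℚ a) ⟩
      ι n * (ρ * ∑ℚ a)     ≤⟨ scale-≤ {ι n} (0≤ι n) norm ⟩
      ι n * ι 2            ∎
    pt : ∀ v → 1ℚ * ι (suc (proj₁ (k v))) ≤ a v + ι 2
    pt v = begin
      1ℚ * ι (suc (proj₁ (k v)))  ≡⟨ ℚ.*-identityˡ (ι (suc (proj₁ (k v)))) ⟩
      ι (suc (proj₁ (k v)))       ≡⟨ ι-+ 1 (proj₁ (k v)) ⟩
      1ℚ + ι (proj₁ (k v))        ≡⟨ ℚ.+-comm 1ℚ (ι (proj₁ (k v))) ⟩
      ι (proj₁ (k v)) + 1ℚ        ≤⟨ ℚ.+-monoˡ-≤ 1ℚ (proj₁ (proj₂ (k v))) ⟩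
      a v + 1ℚ + 1ℚ               ≡⟨ ℚ.+-assoc (a v) 1ℚ 1ℚ ⟩
      a v + ι 2                   ∎
    total : ι (sum (λ v → suc (proj₁ (k v)))) ≤ ι (4 ℕ.* n)
    total = begin
      ι (sum (λ v → suc (proj₁ (k v))))          ≡⟨ ℚ.*-identityˡ (ι (sum (λ v → suc (proj₁ (k v))))) ⟨
      1ℚ * ι (sum (λ v → suc (proj₁ (k v))))     ≡⟨ ∑ℚ-scale 1ℚ (λ v → suc (proj₁ (k v))) ⟨
      ∑ℚ (λ v → 1ℚ * ι (suc (proj₁ (k v))))      ≤⟨ ∑ℚ-mono pt ⟩
      ∑ℚ (λ v → a v + ι 2)                       ≡⟨ ∑ℚ-shift (ι 2) a ⟩
      ∑ℚ a + ι n * ι 2                           ≤⟨ ℚ.+-monoˡ-≤ (ι n * ι 2) sum≤ ⟩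
      ι n * ι 2 + ι n * ι 2                      ≡⟨ ℚ.*-distribˡ-+ (ι n) (ι 2) (ι 2) ⟨
      ι n * ι 4                                  ≡⟨ ℚ.*-comm (ι n) (ι 4) ⟩
      ι 4 * ι n                                  ≡⟨ ι-* 4 n ⟨
      ι (4 ℕ.* n)                                ∎

  -- Multiply the inequality of `Observable` by `K`, the product of the reciprocals; these enter
  -- only through the equations that characterise them.
  observable-value : ∀ n D s V H {ρ δ κ} → Positive ρ → Positive δ → Positive κ →
    ρ * ι n ≡ 1ℚ → δ * ι D ≡ 1ℚ → κ * ι H ≡ 1ℚ →
    2 ℕ.* D ℕ.* (n ℕ.* n) ℕ.* suc s ℕ.< V ℕ.* H →
    ι (suc s) * κ < ρ * ρ * (½ * δ * ι V)
  observable-value n D s V H {ρ} {δ} {κ} ρ>0 δ>0 κ>0 ρn δD κH lt =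
    subst₂ _<_ left right (ℚ.*-monoʳ-<-pos K {{K-pos}} (ι-mono-< lt))
    where
    K = ρ * ρ * (½ * δ) * κ
    pos* : ∀ {p q} → Positive p → Positive q → Positive (p * q)
    pos* {p} {q} hp hq = ℚ.positive
      (subst (_< p * q) (ℚ.*-zeroʳ p) (ℚ.*-monoʳ-<-pos p {{hp}} (ℚ.positive⁻¹ q {{hq}})))
    K-pos : Positive K
    K-pos = pos* {ρ * ρ * (½ * δ)} {κ} (pos* {ρ * ρ} {½ * δ} (pos* {ρ} {ρ} ρ>0 ρ>0) (pos* {½} {δ} _ δ>0)) κ>0
    open ≡-Reasoning
    expand : ι (2 ℕ.* D ℕ.* (n ℕ.* n) ℕ.* suc s) ≡ ι 2 * ι D * (ι n * ι n) * ι (suc s)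
    expand = trans (ι-* (2 ℕ.* D ℕ.* (n ℕ.* n)) (suc s)) (cong (_* ι (suc s))
             (trans (ι-* (2 ℕ.* D) (n ℕ.* n)) (cong₂ _*_ (ι-* 2 D) (ι-* n n))))
    left : K * ι (2 ℕ.* D ℕ.* (n ℕ.* n) ℕ.* suc s) ≡ ι (suc s) * κ
    left = trans (cong (K *_) expand) (go (ι D) (ι n) (ι (suc s)) δD ρn)
      where
      reorder : ∀ r o d k t D n s → r * r * (o * d) * k * (t * D * (n * n) * s) ≡ (o * t) * (d * D) *
        ((r * n) * (r * n)) * (s * k)
      reorder = solve 8 (λ r o d k t D n s → r :* r :* (o :* d) :* k :* (t :* D :* (n :* n) :* s) :=
        (o :* t) :* (d :* D) :* ((r :* n) :* (r :* n)) :* (s :* k)) refl where open +-*-Solver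
      go : ∀ D n s → δ * D ≡ 1ℚ → ρ * n ≡ 1ℚ → K * (ι 2 * D * (n * n) * s) ≡ s * κ
      go D n s e₁ e₂ = begin
        K * (ι 2 * D * (n * n) * s)                                ≡⟨ reorder ρ ½ δ κ (ι 2) D n s ⟩
        (½ * ι 2) * (δ * D) * ((ρ * n) * (ρ * n)) * (s * κ)       
          ≡⟨ cong₂ (λ x y → (½ * ι 2) * x * (y * y) * (s * κ)) e₁ e₂ ⟩
        1ℚ * (s * κ)                                               ≡⟨ ℚ.*-identityˡ (s * κ) ⟩
        s * κ                                                      ∎
    right : K * ι (V ℕ.* H) ≡ ρ * ρ * (½ * δ * ι V)
    right = trans (cong (K *_) (ι-* V H)) (go (½ * δ) (ι V) (ι H) κH)
      where
      reorder : ∀ r c k V H → r * r * c * k * (V * H) ≡ r * r * (c * V) * (k * H)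
      reorder = solve 5 (λ r c k V H → r :* r :* c :* k :* (V :* H) := r :* r :* (c :* V) :* (k :* H))
        refl where open +-*-Solver
      go : ∀ c V H → κ * H ≡ 1ℚ → ρ * ρ * c * κ * (V * H) ≡ ρ * ρ * (c * V)
      go c V H e = begin
        ρ * ρ * c * κ * (V * H)          ≡⟨ reorder ρ c κ V H ⟩
        ρ * ρ * (c * V) * (κ * H)        ≡⟨ cong (ρ * ρ * (c * V) *_) e ⟩
        ρ * ρ * (c * V) * 1ℚ             ≡⟨ ℚ.*-identityʳ (ρ * ρ * (c * V)) ⟩
        ρ * ρ * (c * V)                  ∎

  sum-singleton : ∀ {n} → ¬ 2 ℕ.≤ n → (f : Fin n → ℕ) → ∀ v → f v ≡ 0 → sum f ≡ 0
  sum-singleton {suc zero} _ f zero eq = trans (ℕ.+-identityʳ (f zero)) eq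
  sum-singleton {suc (suc n)} ¬2≤n = ⊥-elim (¬2≤n (s≤s (s≤s z≤n)))

  -- The inequality between lower reals

  module Theorem (h : ℕ) (1≤h : 1 ℕ.≤ h) (G : Graph) (no-minor : ¬ Minor (complete h) G)
    (Ĝ : Graph) (conn : Connected Ĝ) (rig : RIG Ĝ G) where
    private
      n = order Ĝ
      instance
        n≢0 : NonZero n
        n≢0 = Connected.nonempty conn
      H = h ℕ.* h ℕ.* C₀
      instance
        H≢0 : NonZero H
        H≢0 = ℕ.>-nonZero (ℕ.*-mono-≤ (ℕ.*-mono-≤ 1≤h 1≤h) (ℕ.≤ᵇ⇒≤ 1 C₀ _))
      c : ℝ
      c = (ℤ.+ (h ℕ.* h) / 1) R.· fromℚ (ι C₀)
      open Rational Ĝ conn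

    c≡ : (ℤ.+ (h ℕ.* h) / 1) * ι C₀ ≡ ι H
    c≡ = trans (cong (_* ι C₀) (/1≡ι (h ℕ.* h))) (sym (ι-* (h ℕ.* h) C₀))

    conclude : ∀ q η x → 0ℚ < η → q + η ≤ x → 𝔰̄obs Ĝ conn (x * recip H) → (c ⊛ 𝔰̄obs Ĝ conn) q
    conclude q η x η>0 le obs = x * recip H , obs , η , η>0 , 0 , λ _ _ → subst (q + η ≤_) (sym value) le
      where
      value : x * recip H * ((ℤ.+ (h ℕ.* h) / 1) * ι C₀) ≡ x
      value = trans (cong (x * recip H *_) c≡) (trans (ℚ.*-assoc x (recip H) (ι H))
        (trans (cong (x *_) (recip-inv H)) (ℚ.*-identityʳ x)))

    -- A lower real contains all rationals below it, so the negative ones have to be supplied too;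
    -- zero weight and a constant function do this.
    negative : ∀ x → x < 0ℚ → 𝔰̄obs Ĝ conn (x * recip H)
    negative x x<0 = natural⇒obs (λ _ → 0) (λ _ → 0) 1 (ℕ.≤-trans (ℕ.≤-reflexive (sum-zero n)) z≤n)
      (λ _ → z≤n) _
      (subst₂ _<_ refl (sym zero-rhs)
        (subst (x * recip H <_) (ℚ.*-zeroˡ (recip H)) (ℚ.*-monoˡ-<-pos (recip H) {{recip-pos H}} x<0)))
      where
      sum-zero : ∀ n → sum {n} (λ _ → 0) ≡ 0
      sum-zero n = trans (sum-const n 0) (ℕ.*-zeroʳ n)
      variation-zero : variation {n} (λ _ → 0) ≡ 0
      variation-zero = trans (Sum.sum-cong-≗ {n} {x = λ _ → sum {n} (λ _ → 0)} {y = λ _ → 0}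
        (λ _ → sum-zero n)) (sum-zero n)
      zero-rhs : recip n * recip n * (½ * recip 1 * ι (variation {n} (λ _ → 0))) ≡ 0ℚ
      zero-rhs = trans (cong (λ v → recip n * recip n * (½ * recip 1 * ι v)) variation-zero)
        (trans (cong (recip n * recip n *_) (ℚ.*-zeroʳ (½ * recip 1))) (ℚ.*-zeroʳ (recip n * recip n)))

    from-observable : ∀ s → Observable Ĝ h s → 𝔰̄obs Ĝ conn (ι (suc s) * recip H)
    from-observable s O = natural⇒obs g f D ∑g≤ lip (ι (suc s) * recip H)
      (observable-value n D s (variation f) H {recip n} {recip D} {recip H} (recip-pos n) (recip-pos D)
        (recip-pos H)
        (recip-inv n) (recip-inv D) (recip-inv H) large)
      where
      open Observable O
      instance
        D≢0 : NonZero D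
        D≢0 = ℕ.>-nonZero 1≤D

    module _ (ω : V Ĝ → ℝ) (k : ℕ) (rounded : Rounded n (λ v → seq (ω v) k)) where
      open Rounded rounded
      open AtIndex Ĝ conn ω m k a≤m
      open Weighted Ĝ m

      -- On a single vertex all distances are 0, which leaves no room for a positive `p`.
      at-least-two : ∀ p → 0ℚ < p → p ≤ recip n * recip n * dist-total → 2 ℕ.≤ n
      at-least-two p p>0 p≤ = decide (2 ℕ.≤? n)
        where
        v : V Ĝ
        v = fromℕ< (ℕ.>-nonZero⁻¹ n)
        open Potential (relax (Connected.walk conn) v)
        decide : Dec (2 ℕ.≤ n) → 2 ℕ.≤ n
        decide (yes h) = h
        decide (no h) = ⊥-elim
          (ℚ.<-irrefl refl (ℚ.<-≤-trans p>0
            (≤-trans p≤ (bound (recip n) dist-total (pos⇒0≤ {recip n} (recip-pos n)) zero-total))))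
          where
          zero-total : dist-total ≤ 0ℚ
          zero-total = subst (dist-total ≤_)
            (trans (cong (λ F → ι n * ι F) (sum-singleton h (cost ∘ path) v root)) (ℚ.*-zeroʳ (ι n)))
              (total≤ v path)
          bound : ∀ ρ t → 0ℚ ≤ ρ → t ≤ 0ℚ → ρ * ρ * t ≤ 0ℚ
          bound ρ t 0≤ρ t≤0 = subst₂ _≤_ (sym (ℚ.*-assoc ρ ρ t))
            (trans (cong (ρ *_) (ℚ.*-zeroʳ ρ)) (ℚ.*-zeroʳ ρ))
            (scale-≤ {ρ} 0≤ρ (scale-≤ {ρ} 0≤ρ t≤0))

      positive : ∀ p s → 0ℚ < p → ι s ≤ p → p ≤ recip n * recip n * dist-total → Observable Ĝ h s
      positive p s p>0 s≤p p≤ = Discrete.observable h 1≤h G Ĝ rig no-minor (Connected.walk conn)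
        (at-least-two p p>0 p≤)
        m m≥1 m≤4n s (spread p s p≤ s≤p)

    theorem : ∀ q → 𝔰̄₁ Ĝ conn q → (c ⊛ 𝔰̄obs Ĝ conn) q
    theorem q ((ω , ω≥0 , norm) , (η , η>0 , N₀ , large)) = decide (0ℚ ℚ.<? q + η)
      where
      1>0 : 0ℚ < 1ℚ
      1>0 = ℚ.positive⁻¹ 1ℚ
      -- At index `k` the hypotheses on `ω` are used with tolerance 1: weights at least -1, average
      -- at most 2. Rounding adds at most 2 to each weight, which gives the bound `4 * n` on their
      -- sum.
      N₁ = proj₁ (norm 1ℚ 1>0)
      N : V Ĝ → ℕ
      N v = proj₁ (ω≥0 v 1ℚ 1>0)
      k = N₀ ℕ.+ (N₁ ℕ.+ sum N)
      rounded : Rounded n (λ v → seq (ω v) k)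
      rounded = round-up n (recip n) (λ v → seq (ω v) k) (recip-inv n)
        (λ v → floor (seq (ω v) k + 1ℚ) (proj₂ (ω≥0 v 1ℚ 1>0) k
          (ℕ.≤-trans (≤-sum N v) (ℕ.≤-trans (ℕ.m≤n+m (sum N) N₁) (ℕ.m≤n+m (N₁ ℕ.+ sum N) N₀)))))
        (subst (λ z → recip n * z ≤ ι 2) (seq-∑ ω k) (proj₂ (norm 1ℚ 1>0) k
          (ℕ.≤-trans (ℕ.m≤m+n N₁ (sum N)) (ℕ.m≤n+m (N₁ ℕ.+ sum N) N₀))))
      decide : Dec (0ℚ < q + η) → (c ⊛ 𝔰̄obs Ĝ conn) q
      -- `s` is the integer part of `q + η`, so that `suc s` lies above it; this is the `suc s` in
      -- `Observable`.
      decide (yes p>0) = let s , s≤ , s> = floor (q + η) (ℚ.<⇒≤ p>0) in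
        conclude q η (ι (suc s)) η>0 (ℚ.<⇒≤ s>)
          (from-observable s (positive ω k rounded (q + η) s p>0 s≤ (large k (ℕ.m≤m+n N₀ (N₁ ℕ.+ sum N)))))
      -- Half of `η` is kept as the margin; adding only the other half to `q` leaves it negative.
      decide (no p≤0) = conclude q (½ * η) (q + ½ * η) ½η>0 ≤-refl (negative (q + ½ * η)
          (ℚ.<-≤-trans (ℚ.+-monoʳ-< q ½η<η) (ℚ.≮⇒≥ p≤0)))
        where
        ½η>0 : 0ℚ < ½ * η
        ½η>0 = subst (_< ½ * η) (ℚ.*-zeroʳ ½) (ℚ.*-monoʳ-<-pos ½ η>0)
        ½η<η : ½ * η < η
        ½η<η = subst₂ _<_ (ℚ.+-identityʳ (½ * η)) (trans (sym (ℚ.*-distribʳ-+ η ½ ½)) (ℚ.*-identityˡ η))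
          (ℚ.+-monoʳ-< (½ * η) ½η>0)

open import Defs
open import Data.Nat.Base as ℕ using (ℕ)
open import Data.Integer.Base using (+_)
import Data.Nat.Properties as ℕ
open import Data.Rational.Base as ℚ using ()
import Data.Rational.Properties as ℚ

theorem2p4 : ∃[ C ] (0ℝ < C ×
    (∀ (h : ℕ) → 1 ℕ.≤ h →
    ∀ (G : Graph) → ¬ Minor (complete h) G →
    ∀ (Ĝ : Graph) (conn : Connected Ĝ) → RIG Ĝ G →
    𝔰̄₁ Ĝ conn ≤ₗ ((+ (h ℕ.* h) ℚ./ 1) · C) ⊛ 𝔰̄obs Ĝ conn))
theorem2p4 = fromℚ (ι C₀) , (ℚ.1ℚ , ℚ.positive⁻¹ ℚ.1ℚ , 0 , λ _ _ → ι-mono {1} {C₀} (ℕ.≤ᵇ⇒≤ 1 C₀ _)) ,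
  λ h 1≤h G no-minor Ĝ conn rig → Theorem.theorem h 1≤h G no-minor Ĝ conn rig
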